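{- The barycentric subdivision of the boundary complex of a cuboid has a real-rooted $h$-polynomial. That is, for all $d\ge1$ and $0\le\ell\le d$, the polynomial $h(\mathrm{sd}(\mathcal{C}(\partial Q^d_\ell));x)$ is real-rooted, where $Q^d_\ell$ is the $\ell$-th $d$-dimensional cuboid.
   Context: Cuboids: for $d\ge1$ and $0\le \ell\le d$, $Q_0^d$ is the $d$-cube, and for $\ell>0$ the boundary complex $\mathcal{C}(\partial Q^d_\ell)$ of the cuboid $Q^d_\ell$ is (combinatorially) the boundary of the cubical complex obtained by subdividing $[-1,1]^d$ by the $\ell$ hyperplanes $x_1=0,\ldots,x_\ell=0$; i.e. it is the cubical complex obtained by subdividing the boundary complex of $[-1,1]^d$ by these hyperplanes. (Equivalently, the boundary of $Q^d_\ell$ is the boundary of the complex obtained by gluing two copies of $Q^d_{\ell-1}$ along a common $Q^{d-1}_{\ell-1}$.) The boundary complex of a polytope is the polytopal complex of its proper faces (including $\emptyset$). The barycentric subdivision $\mathrm{sd}(\mathcal{C})$ of a polytopal complex $\mathcal{C}$ is the simplicial complex whose $k$-dimensional faces are the sets $\{F_0,\ldots,F_k\}$ of faces of $\mathcal{C}$ with $\emptyset\subsetneq F_0\subsetneq\cdots\subsetneq F_k$ (together with the empty face). For an $(m-1)$-dimensional complex $\mathcal{K}$, $f(\mathcal{K};x)=\sum_{k=-1}^{m-1}f_k(\mathcal{K})x^{k+1}$, where $f_k$ is the number of $k$-dimensional faces ($f_{ -1}=1$), and $h(\mathcal{K};x)=(1-x)^m f(\mathcal{K};\frac{x}{1-x})$.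 A real polynomial is real-rooted if it is identically zero or has only real zeros. -}

module Defs where

open import Data.Integer using (ℤ; +_; -[1+_]; 0ℤ; 1ℤ; -1ℤ)
import Data.Integer as ℤ
open import Data.List using (List; []; _∷_; map; filter; foldr; length;
  cartesianProductWith; concatMap; upTo)
open import Data.List.Relation.Unary.All using (All)
open import Data.List.Relation.Unary.Linked using (linked?)
open import Data.Nat using (ℕ; zero; suc; _∸_)
import Data.Nat as ℕ
import Data.Nat.Properties as ℕ
open import Data.Product using (∃; _×_; _,_)
open import Data.Rational as ℚ using (ℚ; 0ℚ; 1ℚ; ½)
import Data.Rational.Properties as ℚ
open import Data.Rational.Solver using (module +-*-Solver)
open import Data.Sum using (_⊎_)
open import Data.Vec using (Vec; []; _∷_)
open import Data.Vec.Relation.Binary.Pointwise.Inductive as Pointwise using (Pointwise)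
open import Data.Vec.Relation.Unary.Any using (Any; any?)
open import Relation.Binary using (Rel; Decidable)
open import Relation.Binary.PropositionalEquality using (_≡_; refl; sym; trans; cong; cong₂; subst)
open import Relation.Nullary using (¬_; Dec; ¬?; _×-dec_; _⊎-dec_)
open import Level using (0ℓ)

Cauchy : (ℕ → ℚ) → Set
Cauchy x = ∀ ε → 0ℚ ℚ.< ε →
  ∃ λ N → ∀ m n → N ℕ.≤ m → N ℕ.≤ n → ℚ.∣ x m ℚ.- x n ∣ ℚ.< ε

record ℝ : Set where
  constructor mkℝ
  field
    seq    : ℕ → ℚ
    cauchy : Cauchy seq

open ℝ public

infix 4 _≈ᴿ_

_≈ᴿ_ : Rel ℝ 0ℓ
x ≈ᴿ y = ∀ ε → 0ℚ ℚ.< ε →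
  ∃ λ N → ∀ n → N ℕ.≤ n → ℚ.∣ seq x n ℚ.- seq y n ∣ ℚ.< ε

fromℚ : ℚ → ℝ
fromℚ q = mkℝ (λ _ → q) λ ε 0<ε → 0 , λ _ _ _ _ →
  subst (ℚ._< ε) (sym (cong ℚ.∣_∣ (ℚ.+-inverseʳ q))) 0<ε

fromℤ : ℤ → ℝ
fromℤ i = fromℚ (i ℚ./ 1)

0ᴿ : ℝ
0ᴿ = fromℚ 0ℚ

private
  abstract
    ½*-pos : ∀ {ε} → 0ℚ ℚ.< ε → 0ℚ ℚ.< ½ ℚ.* ε
    ½*-pos = ℚ.*-monoʳ-<-pos ½

    ½+½ : ∀ ε → ½ ℚ.* ε ℚ.+ ½ ℚ.* ε ≡ ε
    ½+½ ε = trans (sym (ℚ.*-distribʳ-+ ε ½ ½)) (ℚ.*-identityˡ ε)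

    +-cauchy : ∀ x y → Cauchy x → Cauchy y → Cauchy (λ n → x n ℚ.+ y n)
    +-cauchy x y cx cy ε 0<ε with cx (½ ℚ.* ε) (½*-pos 0<ε) | cy (½ ℚ.* ε) (½*-pos 0<ε)
    ... | M , p | N , q = M ℕ.⊔ N , λ m n m≥ n≥ → begin-strict
      ℚ.∣ (x m ℚ.+ y m) ℚ.- (x n ℚ.+ y n) ∣
        ≡⟨ cong ℚ.∣_∣ (rearrange (x m) (y m) (x n) (y n)) ⟩
      ℚ.∣ (x m ℚ.- x n) ℚ.+ (y m ℚ.- y n) ∣
        ≤⟨ ℚ.∣p+q∣≤∣p∣+∣q∣ (x m ℚ.- x n) (y m ℚ.- y n) ⟩
      ℚ.∣ x m ℚ.- x n ∣ ℚ.+ ℚ.∣ y m ℚ.- y n ∣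
        <⟨ ℚ.+-mono-< (p m n (ℕ.m⊔n≤o⇒m≤o M N m≥) (ℕ.m⊔n≤o⇒m≤o M N n≥))
                      (q m n (ℕ.m⊔n≤o⇒n≤o M N m≥) (ℕ.m⊔n≤o⇒n≤o M N n≥)) ⟩
      ½ ℚ.* ε ℚ.+ ½ ℚ.* ε
        ≡⟨ ½+½ ε ⟩
      ε ∎
      where
      open ℚ.≤-Reasoning
      open +-*-Solver
      rearrange : ∀ a b c d → (a ℚ.+ b) ℚ.- (c ℚ.+ d) ≡ (a ℚ.- c) ℚ.+ (b ℚ.- d)
      rearrange = solve 4 (λ a b c d → (a :+ b) :- (c :+ d) := (a :- c) :+ (b :- d)) refl

    neg-cauchy : ∀ x → Cauchy x → Cauchy (λ n → ℚ.- x n)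
    neg-cauchy x cx ε 0<ε with cx ε 0<ε
    ... | N , p = N , λ m n m≥ n≥ → begin-strict
      ℚ.∣ (ℚ.- x m) ℚ.- (ℚ.- x n) ∣  ≡⟨ cong ℚ.∣_∣ (rearrange (x m) (x n)) ⟩
      ℚ.∣ x n ℚ.- x m ∣              <⟨ p n m n≥ m≥ ⟩
      ε                              ∎
      where
      open ℚ.≤-Reasoning
      open +-*-Solver
      rearrange : ∀ a b → (ℚ.- a) ℚ.- (ℚ.- b) ≡ b ℚ.- a
      rearrange = solve 2 (λ a b → (:- a) :- (:- b) := b :- a) refl

    eventuallyBounded : ∀ x → Cauchy x →
      ∃ λ A → 0ℚ ℚ.< A × ∃ λ N → ∀ n → N ℕ.≤ n → ℚ.∣ x n ∣ ℚ.≤ A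
    eventuallyBounded x cx with cx 1ℚ (ℚ.positive⁻¹ 1ℚ)
    ... | N , p = 1ℚ ℚ.+ ℚ.∣ x N ∣
      , ℚ.+-mono-<-≤ (ℚ.positive⁻¹ 1ℚ) (ℚ.0≤∣p∣ (x N))
      , N , λ n n≥ → begin
        ℚ.∣ x n ∣
          ≡⟨ cong ℚ.∣_∣ (rearrange (x n) (x N)) ⟩
        ℚ.∣ (x n ℚ.- x N) ℚ.+ x N ∣
          ≤⟨ ℚ.∣p+q∣≤∣p∣+∣q∣ (x n ℚ.- x N) (x N) ⟩
        ℚ.∣ x n ℚ.- x N ∣ ℚ.+ ℚ.∣ x N ∣
          ≤⟨ ℚ.+-monoˡ-≤ ℚ.∣ x N ∣ (ℚ.<⇒≤ (p n N n≥ ℕ.≤-refl)) ⟩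
        1ℚ ℚ.+ ℚ.∣ x N ∣ ∎
      where
      open ℚ.≤-Reasoning
      open +-*-Solver
      rearrange : ∀ a b → a ≡ (a ℚ.- b) ℚ.+ b
      rearrange = solve 2 (λ a b → a := (a :- b) :+ b) refl

    divide : ∀ A B ε → 0ℚ ℚ.< A → 0ℚ ℚ.< B → 0ℚ ℚ.< ε →
      ∃ λ δ → 0ℚ ℚ.< δ × A ℚ.* δ ℚ.+ B ℚ.* δ ≡ ε
    divide A B ε 0<A 0<B 0<ε = go (A ℚ.+ B) refl (ℚ.+-mono-< 0<A 0<B)
      where
      go : ∀ C → A ℚ.+ B ≡ C → 0ℚ ℚ.< C → ∃ λ δ → 0ℚ ℚ.< δ × A ℚ.* δ ℚ.+ B ℚ.* δ ≡ ε
      go C A+B≡C 0<C = 1/C ℚ.* ε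
        , ℚ.positive⁻¹ (1/C ℚ.* ε) {{ℚ.pos*pos⇒pos 1/C {{ℚ.1/pos⇒pos C}} ε {{ℚ.positive 0<ε}}}}
        , trans (sym (ℚ.*-distribʳ-+ (1/C ℚ.* ε) A B))
            (trans (cong (ℚ._* (1/C ℚ.* ε)) A+B≡C)
              (trans (sym (ℚ.*-assoc C 1/C ε))
                (trans (cong (ℚ._* ε) (ℚ.*-inverseʳ C)) (ℚ.*-identityˡ ε))))
        where
        instance
          C⁺ : ℚ.Positive C
          C⁺ = ℚ.positive 0<C
          C≢0 : ℚ.NonZero C
          C≢0 = ℚ.pos⇒nonZero C
        1/C : ℚ
        1/C = ℚ.1/ C

    *-bound : ∀ D δ a b → 0ℚ ℚ.< D → ℚ.∣ a ∣ ℚ.≤ D → ℚ.∣ b ∣ ℚ.< δ →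
      ℚ.∣ a ℚ.* b ∣ ℚ.< D ℚ.* δ
    *-bound D δ a b 0<D a≤D b<δ = begin-strict
      ℚ.∣ a ℚ.* b ∣        ≡⟨ ℚ.∣p*q∣≡∣p∣*∣q∣ a b ⟩
      ℚ.∣ a ∣ ℚ.* ℚ.∣ b ∣  ≤⟨ ℚ.*-monoʳ-≤-nonNeg ℚ.∣ b ∣ {{ℚ.∣-∣-nonNeg b}} a≤D ⟩
      D ℚ.* ℚ.∣ b ∣        <⟨ ℚ.*-monoʳ-<-pos D {{ℚ.positive 0<D}} b<δ ⟩
      D ℚ.* δ              ∎
      where open ℚ.≤-Reasoning

    *-split : ∀ a b c d →
      a ℚ.* b ℚ.- c ℚ.* d ≡ a ℚ.* (b ℚ.- d) ℚ.+ d ℚ.* (a ℚ.- c)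
    *-split = solve 4 (λ a b c d → a :* b :- c :* d := a :* (b :- d) :+ d :* (a :- c)) refl
      where open +-*-Solver

    triangle : ∀ p q r s → ℚ.∣ p ∣ ℚ.< r → ℚ.∣ q ∣ ℚ.< s → ℚ.∣ p ℚ.+ q ∣ ℚ.< r ℚ.+ s
    triangle p q r s p<r q<s = ℚ.≤-<-trans (ℚ.∣p+q∣≤∣p∣+∣q∣ p q) (ℚ.+-mono-< p<r q<s)

    *-estimate : ∀ {A B δ ε} a b c d → 0ℚ ℚ.< A → 0ℚ ℚ.< B → A ℚ.* δ ℚ.+ B ℚ.* δ ≡ ε →
      ℚ.∣ a ∣ ℚ.≤ A → ℚ.∣ d ∣ ℚ.≤ B → ℚ.∣ a ℚ.- c ∣ ℚ.< δ → ℚ.∣ b ℚ.- d ∣ ℚ.< δ →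
      ℚ.∣ a ℚ.* b ℚ.- c ℚ.* d ∣ ℚ.< ε
    *-estimate {A} {B} {δ} a b c d 0<A 0<B Aδ+Bδ≡ε a≤A d≤B a-c<δ b-d<δ =
      subst (ℚ.∣ a ℚ.* b ℚ.- c ℚ.* d ∣ ℚ.<_) Aδ+Bδ≡ε
        (subst (λ t → ℚ.∣ t ∣ ℚ.< A ℚ.* δ ℚ.+ B ℚ.* δ) (sym (*-split a b c d))
          (triangle (a ℚ.* (b ℚ.- d)) (d ℚ.* (a ℚ.- c)) (A ℚ.* δ) (B ℚ.* δ)
            (*-bound A δ a (b ℚ.- d) 0<A a≤A b-d<δ)
            (*-bound B δ d (a ℚ.- c) 0<B d≤B a-c<δ)))

    *-cauchy : ∀ x y → Cauchy x → Cauchy y → Cauchy (λ n → x n ℚ.* y n)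
    *-cauchy x y cx cy ε 0<ε =
      let A , 0<A , M , boundX = eventuallyBounded x cx
          B , 0<B , N , boundY = eventuallyBounded y cy
          δ , 0<δ , Aδ+Bδ≡ε    = divide A B ε 0<A 0<B 0<ε
          M′ , p = cx δ 0<δ
          N′ , q = cy δ 0<δ
      in (M ℕ.⊔ N) ℕ.⊔ (M′ ℕ.⊔ N′) , λ m n m≥ n≥ →
        let m≥ˡ = ℕ.m⊔n≤o⇒m≤o (M ℕ.⊔ N) (M′ ℕ.⊔ N′) m≥
            n≥ˡ = ℕ.m⊔n≤o⇒m≤o (M ℕ.⊔ N) (M′ ℕ.⊔ N′) n≥
            m≥ʳ = ℕ.m⊔n≤o⇒n≤o (M ℕ.⊔ N) (M′ ℕ.⊔ N′) m≥
            n≥ʳ = ℕ.m⊔n≤o⇒n≤o (M ℕ.⊔ N) (M′ ℕ.⊔ N′) n≥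
        in *-estimate (x m) (y m) (x n) (y n) 0<A 0<B Aδ+Bδ≡ε
             (boundX m (ℕ.m⊔n≤o⇒m≤o M N m≥ˡ))
             (boundY n (ℕ.m⊔n≤o⇒n≤o M N n≥ˡ))
             (p m n (ℕ.m⊔n≤o⇒m≤o M′ N′ m≥ʳ) (ℕ.m⊔n≤o⇒m≤o M′ N′ n≥ʳ))
             (q m n (ℕ.m⊔n≤o⇒n≤o M′ N′ m≥ʳ) (ℕ.m⊔n≤o⇒n≤o M′ N′ n≥ʳ))

infix  8 -ᴿ_
infixl 6 _+ᴿ_ _-ᴿ_
infixl 7 _*ᴿ_

_+ᴿ_ _*ᴿ_ : ℝ → ℝ → ℝ
x +ᴿ y = mkℝ (λ n → seq x n ℚ.+ seq y n) (+-cauchy (seq x) (seq y) (cauchy x) (cauchy y))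
x *ᴿ y = mkℝ (λ n → seq x n ℚ.* seq y n) (*-cauchy (seq x) (seq y) (cauchy x) (cauchy y))

-ᴿ_ : ℝ → ℝ
-ᴿ x = mkℝ (λ n → ℚ.- seq x n) (neg-cauchy (seq x) (cauchy x))

_-ᴿ_ : ℝ → ℝ → ℝ
x -ᴿ y = x +ᴿ -ᴿ y

record ℂ : Set where
  constructor mkℂ
  field
    re im : ℝ

open ℂ public

infix 4 _≈ᶜ_
infixl 6 _+ᶜ_
infixl 7 _*ᶜ_

_≈ᶜ_ : Rel ℂ 0ℓ
z ≈ᶜ w = (re z ≈ᴿ re w) × (im z ≈ᴿ im w)

fromℝ : ℝ → ℂ
fromℝ x = mkℂ x 0ᴿ

0ᶜ : ℂ
0ᶜ = fromℝ 0ᴿ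

_+ᶜ_ _*ᶜ_ : ℂ → ℂ → ℂ
z +ᶜ w = mkℂ (re z +ᴿ re w) (im z +ᴿ im w)
z *ᶜ w = mkℂ (re z *ᴿ re w -ᴿ im z *ᴿ im w) (re z *ᴿ im w +ᴿ im z *ᴿ re w)

-- The list a₀ ∷ a₁ ∷ … ∷ aₙ ∷ [] stands for a₀ + a₁ x + … + aₙ xⁿ;
-- zeros at the end of the list are allowed.

eval : List ℝ → ℂ → ℂ
eval []      z = 0ᶜ
eval (a ∷ p) z = fromℝ a +ᶜ z *ᶜ eval p z

-- A complex number z is real iff im z ≈ᴿ 0ᴿ.
RealRooted : List ℝ → Set
RealRooted p = All (_≈ᴿ 0ᴿ) p ⊎ (∀ z → eval p z ≈ᶜ 0ᶜ → im z ≈ᴿ 0ᴿ)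

ℤ[x] : Set
ℤ[x] = List ℤ

infixl 6 _+ᴾ_
infixl 7 _*ᴾ_
infixr 8 _^ᴾ_

_+ᴾ_ : ℤ[x] → ℤ[x] → ℤ[x]
[]      +ᴾ q       = q
(a ∷ p) +ᴾ []      = a ∷ p
(a ∷ p) +ᴾ (b ∷ q) = (a ℤ.+ b) ∷ (p +ᴾ q)

_*ᴾ_ : ℤ[x] → ℤ[x] → ℤ[x]
[]      *ᴾ q = []
(a ∷ p) *ᴾ q = map (a ℤ.*_) q +ᴾ (0ℤ ∷ (p *ᴾ q))

_^ᴾ_ : ℤ[x] → ℕ → ℤ[x]
p ^ᴾ zero  = 1ℤ ∷ []
p ^ᴾ suc n = p *ᴾ p ^ᴾ n

sumᴾ : List ℤ[x] → ℤ[x]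
sumᴾ = foldr _+ᴾ_ []

-- Every simplex (the empty one included) occurs in `simplices` exactly once,
-- as a repetition-free list of its vertices.
record SimplicialComplex : Set₁ where
  field
    Vertex    : Set
    simplices : List (List Vertex)

module _ (K : SimplicialComplex) where
  open SimplicialComplex K

  -- f₍ᵢ₋₁₎(K): simplices of dimension i − 1 have i vertices.
  #simplices : ℕ → ℕ
  #simplices i = length (filter (λ σ → length σ ℕ.≟ i) simplices)

  -- The m for which K is (m − 1)-dimensional.
  dim+1 : ℕ
  dim+1 = foldr ℕ._⊔_ 0 (map length simplices)

  -- (1 − x)ᵐ f(K; x/(1 − x)) with f(K; y) = Σ_{0 ≤ i ≤ m} f₍ᵢ₋₁₎(K) yⁱ, i.e.
  -- Σ_{0 ≤ i ≤ m} f₍ᵢ₋₁₎(K) xⁱ (1 − x)ᵐ⁻ⁱ.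
  hPolynomial : ℤ[x]
  hPolynomial = sumᴾ (map term (upTo (suc dim+1)))
    where
    x 1-x : ℤ[x]
    x   = 0ℤ ∷ 1ℤ ∷ []
    1-x = 1ℤ ∷ -1ℤ ∷ []
    term : ℕ → ℤ[x]
    term i = (+ #simplices i ∷ []) *ᴾ x ^ᴾ i *ᴾ 1-x ^ᴾ (dim+1 ∸ i)

-- A finite polytopal complex is given by the poset of its nonempty faces.
-- Every nonempty face occurs in `faces` exactly once.  The empty face is left
-- out, since it is not a vertex of the barycentric subdivision.
record PolytopalComplex : Set₁ where
  field
    Face  : Set
    faces : List Face
    _⊆_   : Rel Face 0ℓ
    _⊆?_  : Decidable _⊆_

module _ (C : PolytopalComplex) where
  open PolytopalComplex C

  _⊊_ : Rel Face 0ℓ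
  F ⊊ G = F ⊆ G × ¬ (G ⊆ F)

  _⊊?_ : Decidable _⊊_
  F ⊊? G = F ⊆? G ×-dec ¬? (G ⊆? F)

  -- All lists F₁ ∷ … ∷ Fₖ ∷ [] of faces with F₁ ⊊ ⋯ ⊊ Fₖ.
  chains : ℕ → List (List Face)
  chains zero    = [] ∷ []
  chains (suc k) = filter (linked? _⊊?_) (cartesianProductWith _∷_ faces (chains k))

  -- A chain has no more elements than there are faces, so the bound on k
  -- leaves nothing out.
  sd : SimplicialComplex
  sd = record
    { Vertex    = Face
    ; simplices = concatMap chains (upTo (suc (length faces)))
    }

-- The interval [lo, hi]; only intervals with lo ≤ hi are used.
record Interval : Set where
  constructor [_,_]
  field
    lo hi : ℤ

open Interval public

infix 4 _⊑_ _⊑?_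

_⊑_ : Rel Interval 0ℓ
I ⊑ J = (lo J ℤ.≤ lo I) × (hi I ℤ.≤ hi J)

_⊑?_ : Decidable _⊑_
I ⊑? J = (lo J ℤ.≤? lo I) ×-dec (hi I ℤ.≤? hi J)

-- The nonempty faces of [-1, 1], as it is and subdivided at 0.
whole halved : List Interval
whole  = [ -1ℤ , -1ℤ ] ∷ [ 1ℤ , 1ℤ ] ∷ [ -1ℤ , 1ℤ ] ∷ []
halved = [ -1ℤ , -1ℤ ] ∷ [ 0ℤ , 0ℤ ] ∷ [ 1ℤ , 1ℤ ] ∷ [ -1ℤ , 0ℤ ] ∷ [ 0ℤ , 1ℤ ] ∷ []

-- The nonempty cells of [-1, 1]ᵈ subdivided by x₁ = 0, …, x_ℓ = 0.  Each cell
-- is a product of intervals, given by the vector of its factors.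
cells : (d ℓ : ℕ) → List (Vec Interval d)
cells zero    _       = [] ∷ []
cells (suc d) zero    = cartesianProductWith _∷_ whole (cells d zero)
cells (suc d) (suc ℓ) = cartesianProductWith _∷_ halved (cells d ℓ)

-- A cell lies in the boundary of [-1, 1]ᵈ iff it lies in a facet xᵢ = ±1.
Extreme : Interval → Set
Extreme I = (I ⊑ [ -1ℤ , -1ℤ ]) ⊎ (I ⊑ [ 1ℤ , 1ℤ ])

extreme? : ∀ I → Dec (Extreme I)
extreme? I = (I ⊑? [ -1ℤ , -1ℤ ]) ⊎-dec (I ⊑? [ 1ℤ , 1ℤ ])

-- The boundary complex of the cuboid Q^d_ℓ, for ℓ ≤ d.
∂Cuboid : (d ℓ : ℕ) → PolytopalComplex
∂Cuboid d ℓ = record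
  { Face  = Vec Interval d
  ; faces = filter (any? extreme?) (cells d ℓ)
  ; _⊆_   = Pointwise _⊑_
  ; _⊆?_  = Pointwise.decidable _⊑?_
  }

{-# OPTIONS --safe #-}

-- Let Z(m) be the number of multichains F₁ ⊆ ⋯ ⊆ Fₘ of nonempty faces of ∂Q^d_ℓ.  Then
-- h(x)/(1 − x)ᵈ = 1 + Σ_{m≥1} Z(m) xᵐ, and since the face poset of the subdivided cube is a
-- product, Z(m) = (2m+1)^{d−ℓ} (4m+1)^ℓ − (2m−1)^{d−ℓ} (4m−1)^ℓ.  Telescoping through
-- (2m)^{d−ℓ} (4m)^ℓ writes this series as a nonnegative combination of the 2d series
-- Σ_{m≥0} (2m)ⁱ (2m+1)ʲ xᵐ and Σ_{m≥1} (2m−1)ⁱ (2m)ʲ xᵐ with i + j = d − 1, in which the first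
-- one, with i = 0, has coefficient 1.  At a point z of the upper half-plane the values of these
-- series, taken in this order, turn counterclockwise from the first value u to z u: the values
-- for d + 1 are, up to a common factor, sums of the values for d over full periods, and such
-- sums inherit the order.  So h(z) lies in the sector between u and z u and is not 0.  The
-- argument is carried out over ℚ(i) with explicit lower bounds, which pass to Cauchy reals.

module Submission where

open import Defs
open import Algebra.Bundles using (CommutativeRing)
import Algebra.Solver.Ring.AlmostCommutativeRing as AlmostCommutativeRing
import Algebra.Solver.Ring.Simple as RingSolver
open import Data.Bool using (true; false; if_then_else_; _∧_; _∨_; not)
open import Data.Integer using (ℤ; 0ℤ; 1ℤ; -1ℤ)
import Data.Integer as ℤ
import Data.Integer.Properties as ℤ
open import Data.List using (List; []; _∷_; _++_; map; filter; foldr; length; concatMap; upTo; applyUpTo; cartesianProductWith)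
open import Data.List.Membership.Propositional using (_∈_)
open import Data.List.Membership.Propositional.Properties using (∈-filter⁻; ∈-cartesianProductWith⁻)
open import Data.List.Relation.Unary.Any using (here; there)
open import Data.List.Relation.Unary.Linked using (linked?)
open import Data.Nat using (ℕ; zero; suc; _∸_; _≤_; z≤n; s≤s)
import Data.Nat as ℕ
import Data.Nat.Properties as ℕ
open import Data.Nat.Solver using () renaming (module +-*-Solver to ℕ-Solver)
open import Data.Product using (∃; _×_; _,_; proj₁; proj₂)
open import Data.Rational as ℚ using (ℚ; 0ℚ; 1ℚ; ½)
import Data.Rational.Properties as ℚ
open import Data.Rational.Solver using () renaming (module +-*-Solver to ℚ-Solver)
import Data.Rational.Unnormalised as ℚᵘ
import Data.Rational.Unnormalised.Properties as ℚᵘ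
open import Data.Sum as Sum using (_⊎_; inj₁; inj₂)
open import Data.Vec using (Vec; []; _∷_)
open import Data.Vec.Relation.Binary.Pointwise.Inductive as Pointwise using (Pointwise; _∷_)
open import Data.Vec.Relation.Unary.Any using (Any; any?; here; there)
open import Function using (_∘_; id)
open import Level using (0ℓ)
open import Relation.Binary using (Rel; Decidable; DecidableEquality)
open import Relation.Binary.PropositionalEquality
  using (_≡_; refl; sym; trans; cong; cong₂; subst; subst₂; isEquivalence; module ≡-Reasoning)
open import Relation.Nullary using (Dec; yes; no; does; ¬?; _×-dec_)
open import Relation.Nullary.Decidable using (dec-true; toWitness)
open import Relation.Nullary.Negation using (contradiction)

-- Multichains are counted because they factor over products of posets, which strict chains do not;
-- the strict chain numbers that define h are the forward differences at 0 of the multichain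
-- numbers. No power series is summed: each is replaced by its Newton polynomial in y = z/(1 - z),
-- which gives the same rational function and makes sense at every z other than 1, inside the unit
-- disc or not. Angles are replaced by signs of the determinants Im(conj(a) b), which are bilinear,
-- so the order passes to sums. This order is weak, and 0 is comparable with everything, so it
-- cannot by itself exclude a zero. Strictness comes from the first value u, one copy of which is
-- kept apart: its area with z u is Im z |u|², and the other terms only add to it. A root given by
-- Cauchy sequences is known only through rational points where h becomes small, so nonvanishing at
-- each point is too little: a positive lower bound, uniform for Im z ≥ δ and bounded z, is carried
-- through the induction on the degree. The lower half-plane follows by conjugation.

-- Counting chains and multichains of cells

module Counting where
  open import Data.Nat using (_+_; _*_)
  open ℕ-Solver using (solve; _:=_; _:+_; _:*_; con)

  private variable
    A B C : Set
    P : Set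

  ∑ : List A → (A → ℕ) → ℕ
  ∑ []       f = 0
  ∑ (x ∷ xs) f = f x + ∑ xs f

  ⟦_⟧ : Dec P → ℕ
  ⟦ d ⟧ = if does d then 1 else 0

  ∑-cong∈ : ∀ (xs : List A) {f g} → (∀ {x} → x ∈ xs → f x ≡ g x) → ∑ xs f ≡ ∑ xs g
  ∑-cong∈ []       f≡g = refl
  ∑-cong∈ (x ∷ xs) f≡g = cong₂ _+_ (f≡g (here refl)) (∑-cong∈ xs (f≡g ∘ there))

  ∑-cong : ∀ (xs : List A) {f g} → (∀ x → f x ≡ g x) → ∑ xs f ≡ ∑ xs g
  ∑-cong xs f≡g = ∑-cong∈ xs (λ {x} _ → f≡g x)

  ∑-++ : ∀ (xs : List A) {ys f} → ∑ (xs ++ ys) f ≡ ∑ xs f + ∑ ys f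
  ∑-++ []       = refl
  ∑-++ (x ∷ xs) {ys} {f} = trans (cong (f x +_) (∑-++ xs)) (sym (ℕ.+-assoc (f x) (∑ xs f) (∑ ys f)))

  ∑-map : ∀ (h : A → B) xs {f} → ∑ (map h xs) f ≡ ∑ xs (f ∘ h)
  ∑-map h []       = refl
  ∑-map h (x ∷ xs) = cong (_ +_) (∑-map h xs)

  ∑-+ : ∀ (xs : List A) {f g} → ∑ xs (λ x → f x + g x) ≡ ∑ xs f + ∑ xs g
  ∑-+ []       = refl
  ∑-+ (x ∷ xs) {f} {g} = trans (cong (f x + g x +_) (∑-+ xs))
    (solve 4 (λ a b c d → (a :+ b) :+ (c :+ d) := (a :+ c) :+ (b :+ d)) refl (f x) (g x) (∑ xs f) (∑ xs g))

  ∑-*ˡ : ∀ c (xs : List A) {f} → ∑ xs (λ x → c * f x) ≡ c * ∑ xs f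
  ∑-*ˡ c []       = sym (ℕ.*-zeroʳ c)
  ∑-*ˡ c (x ∷ xs) = trans (cong (_ +_) (∑-*ˡ c xs)) (sym (ℕ.*-distribˡ-+ c _ _))

  ∑-*ʳ : ∀ c (xs : List A) {f} → ∑ xs (λ x → f x * c) ≡ ∑ xs f * c
  ∑-*ʳ c xs {f} = trans (∑-cong xs (λ x → ℕ.*-comm (f x) c))
    (trans (∑-*ˡ c xs) (ℕ.*-comm c (∑ xs f)))

  ∑-product : ∀ (h : A → B → C) xs ys {f} →
    ∑ (cartesianProductWith h xs ys) f ≡ ∑ xs (λ x → ∑ ys (λ y → f (h x y)))
  ∑-product h []       ys = refl
  ∑-product h (x ∷ xs) ys = trans (∑-++ (map (h x) ys))
    (cong₂ _+_ (∑-map (h x) ys) (∑-product h xs ys))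

  ∑-⊗ : ∀ (xs : List A) (ys : List B) {f g} →
    ∑ xs (λ x → ∑ ys (λ y → f x * g y)) ≡ ∑ xs f * ∑ ys g
  ∑-⊗ xs ys {f} = trans (∑-cong xs (λ x → ∑-*ˡ (f x) ys)) (∑-*ʳ _ xs)

  module _ {Q : A → Set} (Q? : ∀ x → Dec (Q x)) where

    ∑-filter : ∀ xs {f} → ∑ (filter Q? xs) f ≡ ∑ xs (λ x → ⟦ Q? x ⟧ * f x)
    ∑-filter []       = refl
    ∑-filter (x ∷ xs) {f} with does (Q? x)
    ... | true  = cong₂ _+_ (sym (ℕ.*-identityˡ (f x))) (∑-filter xs)
    ... | false = ∑-filter xs

  length≡∑1 : ∀ (xs : List A) → length xs ≡ ∑ xs (λ _ → 1)
  length≡∑1 []       = refl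
  length≡∑1 (x ∷ xs) = cong suc (length≡∑1 xs)

  iterate : (A → A) → ℕ → A → A
  iterate f zero    x = x
  iterate f (suc n) x = f (iterate f n x)

  module _ {_≤_ : Rel A 0ℓ} (_≤?_ : Decidable _≤_) (xs : List A) where

    -- The zeta operator of the order. Its k-th iterate on φ, taken at x, counts the multichains
    -- that continue x by k members, weighted by φ at the last one; so `multichains φ k` is about
    -- multichains with k + 1 members.
    above : (A → ℕ) → A → ℕ
    above φ x = ∑ xs (λ y → ⟦ x ≤? y ⟧ * φ y)

    above-cong∈ : ∀ {φ ψ} → (∀ {x} → x ∈ xs → φ x ≡ ψ x) → ∀ x → above φ x ≡ above ψ x
    above-cong∈ φ≡ψ x = ∑-cong∈ xs (λ y∈ → cong (⟦ x ≤? _ ⟧ *_) (φ≡ψ y∈))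

    above-+ : ∀ φ ψ x → above (λ y → φ y + ψ y) x ≡ above φ x + above ψ x
    above-+ φ ψ x =
      trans (∑-cong xs (λ y → ℕ.*-distribˡ-+ ⟦ x ≤? y ⟧ (φ y) (ψ y))) (∑-+ xs)

    multichains : (A → ℕ) → ℕ → ℕ
    multichains φ k = ∑ xs (iterate above k φ)

    -- _≤_ is antisymmetric on xs and xs has no repetitions, in the form in
    -- which these two facts are used.
    UniqueAntisymmetric : Set
    UniqueAntisymmetric = ∀ {x} → x ∈ xs → ∀ (φ : A → ℕ) →
      ∑ xs (λ y → ⟦ x ≤? y ×-dec y ≤? x ⟧ * φ y) ≡ φ x

  module _ {A : Set} {_≤_ : Rel A 0ℓ} (_≤?_ : Decidable _≤_) {Q : A → Set} (Q? : ∀ x → Dec (Q x)) (xs : List A) where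

    private
      swap : ∀ a b c → a * (b * c) ≡ b * (a * c)
      swap = solve 3 (λ a b c → a :* (b :* c) := b :* (a :* c)) refl

    -- The hypothesis is applied to φ cut off outside Q; the cut-off has no effect at x, which lies
    -- in Q.
    filter-uniqueAntisymmetric : UniqueAntisymmetric _≤?_ xs → UniqueAntisymmetric _≤?_ (filter Q? xs)
    filter-uniqueAntisymmetric antisym {x} x∈ φ with ∈-filter⁻ Q? {xs = xs} x∈
    ... | x∈xs , Qx = begin
      ∑ (filter Q? xs) (λ y → ⟦ x ≤? y ×-dec y ≤? x ⟧ * φ y)
        ≡⟨ ∑-filter Q? xs ⟩
      ∑ xs (λ y → ⟦ Q? y ⟧ * (⟦ x ≤? y ×-dec y ≤? x ⟧ * φ y))
        ≡⟨ ∑-cong xs (λ y → swap ⟦ Q? y ⟧ ⟦ x ≤? y ×-dec y ≤? x ⟧ (φ y)) ⟩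
      ∑ xs (λ y → ⟦ x ≤? y ×-dec y ≤? x ⟧ * (⟦ Q? y ⟧ * φ y))
        ≡⟨ antisym x∈xs (λ y → ⟦ Q? y ⟧ * φ y) ⟩
      ⟦ Q? x ⟧ * φ x
        ≡⟨ cong (λ b → (if b then 1 else 0) * φ x) (dec-true (Q? x) Qx) ⟩
      1 * φ x
        ≡⟨ ℕ.*-identityˡ (φ x) ⟩
      φ x ∎
      where open ≡-Reasoning

    module _ (Q-down : ∀ {x y} → x ≤ y → Q y → Q x) where

      private
        within : ∀ x y n → ⟦ Q? x ⟧ * (⟦ Q? y ⟧ * (⟦ x ≤? y ⟧ * n)) ≡ ⟦ x ≤? y ⟧ * (⟦ Q? y ⟧ * n)
        within x y n with x ≤? y | Q? y | Q? x
        ... | yes x≤y | yes Qy | yes Qx = ℕ.*-identityˡ _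
        ... | yes x≤y | yes Qy | no ¬Qx = contradiction (Q-down x≤y Qy) ¬Qx
        ... | yes x≤y | no _   | q      = ℕ.*-zeroʳ ⟦ q ⟧
        ... | no _    | yes _  | q      = ℕ.*-zeroʳ ⟦ q ⟧
        ... | no _    | no _   | q      = ℕ.*-zeroʳ ⟦ q ⟧

        complement : ∀ x → ⟦ Q? x ⟧ * 1 + ⟦ ¬? (Q? x) ⟧ ≡ 1
        complement x with does (Q? x)
        ... | true  = refl
        ... | false = refl

        inside outside all : ℕ → A → ℕ
        inside  k = iterate (above _≤?_ (filter Q? xs)) k (λ _ → 1)
        outside k = iterate (above _≤?_ xs) k (λ x → ⟦ ¬? (Q? x) ⟧)
        all     k = iterate (above _≤?_ xs) k (λ _ → 1)

        -- A multichain lies in a downset exactly if its last member does, and `outside` weights the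
        -- last member by not being in Q. The factor `⟦ Q? x ⟧` is there because `inside 0` is 1 off
        -- Q as well.
        inside+outside : ∀ k x → ⟦ Q? x ⟧ * inside k x + outside k x ≡ all k x
        inside+outside zero    x = complement x
        inside+outside (suc k) x = begin
          ⟦ Q? x ⟧ * inside (suc k) x + outside (suc k) x
            ≡⟨ cong (λ n → ⟦ Q? x ⟧ * n + outside (suc k) x) (∑-filter Q? xs) ⟩
          ⟦ Q? x ⟧ * ∑ xs (λ y → ⟦ Q? y ⟧ * (⟦ x ≤? y ⟧ * inside k y)) + outside (suc k) x
            ≡⟨ cong (_+ outside (suc k) x) (sym (∑-*ˡ ⟦ Q? x ⟧ xs)) ⟩
          ∑ xs (λ y → ⟦ Q? x ⟧ * (⟦ Q? y ⟧ * (⟦ x ≤? y ⟧ * inside k y))) + outside (suc k) x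
            ≡⟨ cong (_+ outside (suc k) x) (∑-cong xs λ y → within x y (inside k y)) ⟩
          above _≤?_ xs (λ y → ⟦ Q? y ⟧ * inside k y) x + outside (suc k) x
            ≡⟨ sym (above-+ _≤?_ xs (λ y → ⟦ Q? y ⟧ * inside k y) (outside k) x) ⟩
          above _≤?_ xs (λ y → ⟦ Q? y ⟧ * inside k y + outside k y) x
            ≡⟨ above-cong∈ _≤?_ xs (λ {y} _ → inside+outside k y) x ⟩
          all (suc k) x ∎
          where open ≡-Reasoning

      multichains-downset : ∀ k →
        multichains _≤?_ (filter Q? xs) (λ _ → 1) k + multichains _≤?_ xs (λ x → ⟦ ¬? (Q? x) ⟧) k
        ≡ multichains _≤?_ xs (λ _ → 1) k
      multichains-downset k = trans (cong (_+ ∑ xs (outside k)) (∑-filter Q? xs))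
        (trans (sym (∑-+ xs)) (∑-cong xs (inside+outside k)))

  module _ {A : Set} {_≤_ : Rel A 0ℓ} (_≤?_ : Decidable _≤_) {n} (xs : List A) (ys : List (Vec A n)) where

    private
      _≤*?_ : ∀ {n} → Decidable (Pointwise _≤_ {n} {n})
      _≤*?_ = Pointwise.decidable _≤?_

      ∧-* : ∀ a b m n → (if a ∧ b then 1 else 0) * (m * n) ≡
        ((if a then 1 else 0) * m) * ((if b then 1 else 0) * n)
      ∧-* false b     m n = refl
      ∧-* true  false m n = sym (ℕ.*-zeroʳ (m + 0))
      ∧-* true  true  m n = solve 2 (λ m n → con 1 :* (m :* n) := (con 1 :* m) :* (con 1 :* n)) refl m n

      ∧-∧-* : ∀ a b c d n → (if (a ∧ b) ∧ (c ∧ d) then 1 else 0) * n ≡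
        (if a ∧ c then 1 else 0) * ((if b ∧ d then 1 else 0) * n)
      ∧-∧-* false b     c     d n = refl
      ∧-∧-* true  false c     d n = sym (ℕ.*-zeroʳ (if c then 1 else 0))
      ∧-∧-* true  true  false d n = refl
      ∧-∧-* true  true  true  d n = sym (ℕ.+-identityʳ _)

    product-uniqueAntisymmetric : UniqueAntisymmetric _≤?_ xs → UniqueAntisymmetric _≤*?_ ys →
      UniqueAntisymmetric _≤*?_ (cartesianProductWith Vec._∷_ xs ys)
    product-uniqueAntisymmetric antisymˣ antisymʸ v∈ φ
      with ∈-cartesianProductWith⁻ Vec._∷_ xs ys v∈
    ... | x , y , x∈ , y∈ , refl = begin
      ∑ (cartesianProductWith Vec._∷_ xs ys) (λ w → ⟦ (x ∷ y) ≤*? w ×-dec w ≤*? (x ∷ y) ⟧ * φ w)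
        ≡⟨ ∑-product Vec._∷_ xs ys ⟩
      ∑ xs (λ x′ → ∑ ys (λ y′ → ⟦ (x ∷ y) ≤*? (x′ ∷ y′) ×-dec (x′ ∷ y′) ≤*? (x ∷ y) ⟧ * φ (x′ ∷ y′)))
        ≡⟨ ∑-cong xs (λ x′ → trans
             (∑-cong ys λ y′ → ∧-∧-* (does (x ≤? x′)) (does (y ≤*? y′)) (does (x′ ≤? x)) (does (y′ ≤*? y)) (φ (x′ ∷ y′)))
             (trans (∑-*ˡ ⟦ x ≤? x′ ×-dec x′ ≤? x ⟧ ys)
               (cong (⟦ x ≤? x′ ×-dec x′ ≤? x ⟧ *_) (antisymʸ y∈ (λ y′ → φ (x′ ∷ y′)))))) ⟩
      ∑ xs (λ x′ → ⟦ x ≤? x′ ×-dec x′ ≤? x ⟧ * φ (x′ ∷ y))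
        ≡⟨ antisymˣ x∈ (λ x′ → φ (x′ ∷ y)) ⟩
      φ (x ∷ y) ∎
      where open ≡-Reasoning

    module _ {φ : A → ℕ} {ψ : Vec A n → ℕ} {χ : Vec A (suc n) → ℕ}
             (χ≡φ⊗ψ : ∀ x y → χ (x ∷ y) ≡ φ x * ψ y) where

      private
        xys : List (Vec A (suc n))
        xys = cartesianProductWith Vec._∷_ xs ys

        iterate-above-⊗ : ∀ k x y → iterate (above _≤*?_ xys) k χ (x ∷ y) ≡
          iterate (above _≤?_ xs) k φ x * iterate (above _≤*?_ ys) k ψ y
        iterate-above-⊗ zero    x y = χ≡φ⊗ψ x y
        iterate-above-⊗ (suc k) x y = trans (∑-product Vec._∷_ xs ys) (trans
          (∑-cong xs λ x′ → ∑-cong ys λ y′ → trans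
            (cong (⟦ (x ∷ y) ≤*? (x′ ∷ y′) ⟧ *_) (iterate-above-⊗ k x′ y′))
            (∧-* (does (x ≤? x′)) (does (y ≤*? y′)) _ _))
          (∑-⊗ xs ys))

      -- The product order is componentwise, so a multichain of vectors is a pair of multichains of
      -- the same length, with repetitions allowed in each.
      multichains-⊗ : ∀ k → multichains _≤*?_ xys χ k ≡ multichains _≤?_ xs φ k * multichains _≤*?_ ys ψ k
      multichains-⊗ k = trans (∑-product Vec._∷_ xs ys)
        (trans (∑-cong xs λ x → ∑-cong ys λ y → iterate-above-⊗ k x y) (∑-⊗ xs ys))

  module _ (C : PolytopalComplex) where
    open PolytopalComplex C

    strict weak : (Face → ℕ) → Face → ℕ
    strict = above (_⊊?_ C) faces
    weak   = above _⊆?_ faces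

    ∑-chains : ∀ k (f : List Face → ℕ) → ∑ (chains C (suc k)) f ≡
      ∑ faces (λ G → ∑ (chains C k) (λ σ → ⟦ linked? (_⊊?_ C) (G ∷ σ) ⟧ * f (G ∷ σ)))
    ∑-chains k f = trans (∑-filter (linked? (_⊊?_ C)) (cartesianProductWith _∷_ faces (chains C k)))
      (∑-product _∷_ faces (chains C k))

    -- Putting a face in front adds one strict inclusion to the test. The tail is then tested twice,
    -- by the filter in `chains` and again by `linked?`, and the second test is absorbed.
    linked-extensions : ∀ k F →
      ∑ (chains C k) (λ σ → ⟦ linked? (_⊊?_ C) (F ∷ σ) ⟧) ≡ iterate strict k (λ _ → 1) F
    linked-extensions zero    F = refl
    linked-extensions (suc k) F = trans (∑-chains k _) (∑-cong faces λ G →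
      trans (∑-cong (chains C k) λ σ →
              absorb (does (_⊊?_ C F G)) (does (linked? (_⊊?_ C) (G ∷ σ))))
        (trans (∑-*ˡ ⟦ _⊊?_ C F G ⟧ (chains C k)) (cong (⟦ _⊊?_ C F G ⟧ *_) (linked-extensions k G))))
      where
      absorb : ∀ a b → (if b then 1 else 0) * (if a ∧ b then 1 else 0) ≡
        (if a then 1 else 0) * (if b then 1 else 0)
      absorb false false = refl
      absorb false true  = refl
      absorb true  false = refl
      absorb true  true  = refl

    length-chains : ∀ k →
      length (chains C (suc k)) ≡ ∑ faces (iterate strict k (λ _ → 1))
    length-chains k = trans (length≡∑1 (chains C (suc k))) (trans (∑-chains k (λ _ → 1))
      (∑-cong faces λ G → trans (∑-cong (chains C k) (λ σ → ℕ.*-identityʳ ⟦ linked? (_⊊?_ C) (G ∷ σ) ⟧))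
        (linked-extensions k G)))

    -- chainTable j 0 counts strict chains with j + 1 members, chainTable 0 k multichains with k + 1.
    chainTable : ℕ → ℕ → ℕ
    chainTable j k = ∑ faces (iterate strict j (iterate weak k (λ _ → 1)))

    module _ (antisym : UniqueAntisymmetric _⊆?_ faces) where

      weak≡id+strict : ∀ (φ : Face → ℕ) {F} → F ∈ faces → weak φ F ≡ φ F + strict φ F
      weak≡id+strict φ {F} F∈ = trans
        (∑-cong faces λ G → split (does (F ⊆? G)) (does (G ⊆? F)) (φ G))
        (trans (∑-+ faces) (cong (_+ strict φ F) (antisym F∈ φ)))
        where
        split : ∀ a b n → (if a then 1 else 0) * n ≡
          (if a ∧ b then 1 else 0) * n + (if a ∧ not b then 1 else 0) * n
        split false false n = refl
        split false true  n = refl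
        split true  false n = refl
        split true  true  n = sym (ℕ.+-identityʳ (n + 0))

      strict^-weak : ∀ j (φ : Face → ℕ) {F} → F ∈ faces →
        iterate strict j (weak φ) F ≡ iterate strict j φ F + iterate strict (suc j) φ F
      strict^-weak zero    φ F∈ = weak≡id+strict φ F∈
      strict^-weak (suc j) φ {F} F∈ = trans
        (above-cong∈ (_⊊?_ C) faces (strict^-weak j φ) F)
        (above-+ (_⊊?_ C) faces (iterate strict j φ) (iterate strict (suc j) φ) F)

      -- By antisymmetry `weak` is the identity plus `strict`. Hence this is a difference table: the
      -- strict chain numbers `chainTable j 0` are the j-th forward differences at 0 of the
      -- multichain numbers.
      chainTable-Δ : ∀ j k → chainTable j (suc k) ≡ chainTable j k + chainTable (suc j) k
      chainTable-Δ j k = trans (∑-cong∈ faces (strict^-weak j (iterate weak k (λ _ → 1)))) (∑-+ faces)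

  inner : Interval → ℕ
  inner I = ⟦ ¬? (extreme? I) ⟧

  module _ where
    private
      ⟪_⟫ : Interval → (List Interval → (Interval → ℕ) → ℕ → ℕ)
      ⟪ I ⟫ Js φ k = iterate (above _⊑?_ Js) k φ I

      V₋ V₀ V₊ E E₋ E₊ : Interval
      V₋ = [ -1ℤ , -1ℤ ]
      V₀ = [ 0ℤ , 0ℤ ]
      V₊ = [ 1ℤ , 1ℤ ]
      E  = [ -1ℤ , 1ℤ ]
      E₋ = [ -1ℤ , 0ℤ ]
      E₊ = [ 0ℤ , 1ℤ ]

    -- Only the weight of the edge is fixed, so that the count serves both for weight 1 and for
    -- `inner`, which is 0 at the endpoints. An endpoint lies below itself and one edge, hence the
    -- linear growth.
    module Whole (φ : Interval → ℕ) (φE≡1 : φ E ≡ 1) where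
      E≡ : ∀ k → ⟪ E ⟫ whole φ k ≡ 1
      E≡ zero    = φE≡1
      E≡ (suc k) rewrite E≡ k = refl

      V₋≡ : ∀ k → ⟪ V₋ ⟫ whole φ k ≡ φ V₋ + k
      V₋≡ zero    = sym (ℕ.+-identityʳ _)
      V₋≡ (suc k) rewrite V₋≡ k | E≡ k = solve 2 (λ a k → a :+ k :+ con 0 :+ con 1 := a :+ (con 1 :+ k)) refl (φ V₋) k

      V₊≡ : ∀ k → ⟪ V₊ ⟫ whole φ k ≡ φ V₊ + k
      V₊≡ zero    = sym (ℕ.+-identityʳ _)
      V₊≡ (suc k) rewrite V₊≡ k | E≡ k = solve 2 (λ a k → a :+ k :+ con 0 :+ con 1 := a :+ (con 1 :+ k)) refl (φ V₊) k

      total : ∀ k → multichains _⊑?_ whole φ k ≡ (φ V₋ + k) + ((φ V₊ + k) + 1)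
      total k rewrite V₋≡ k | V₊≡ k | E≡ k = refl

    -- The midpoint lies below two edges and grows twice as fast as an endpoint.
    module Halved (φ : Interval → ℕ) (φV₀≡1 : φ V₀ ≡ 1) (φE₋≡1 : φ E₋ ≡ 1) (φE₊≡1 : φ E₊ ≡ 1) where
      E₋≡ : ∀ k → ⟪ E₋ ⟫ halved φ k ≡ 1
      E₋≡ zero    = φE₋≡1
      E₋≡ (suc k) rewrite E₋≡ k = refl

      E₊≡ : ∀ k → ⟪ E₊ ⟫ halved φ k ≡ 1
      E₊≡ zero    = φE₊≡1
      E₊≡ (suc k) rewrite E₊≡ k = refl

      V₋≡ : ∀ k → ⟪ V₋ ⟫ halved φ k ≡ φ V₋ + k
      V₋≡ zero    = sym (ℕ.+-identityʳ _)
      V₋≡ (suc k) rewrite V₋≡ k | E₋≡ k = solve 2 (λ a k → a :+ k :+ con 0 :+ con 1 := a :+ (con 1 :+ k)) refl (φ V₋) k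

      V₊≡ : ∀ k → ⟪ V₊ ⟫ halved φ k ≡ φ V₊ + k
      V₊≡ zero    = sym (ℕ.+-identityʳ _)
      V₊≡ (suc k) rewrite V₊≡ k | E₊≡ k = solve 2 (λ a k → a :+ k :+ con 0 :+ con 1 := a :+ (con 1 :+ k)) refl (φ V₊) k

      V₀≡ : ∀ k → ⟪ V₀ ⟫ halved φ k ≡ 1 + 2 * k
      V₀≡ zero    = φV₀≡1
      V₀≡ (suc k) rewrite V₀≡ k | E₋≡ k | E₊≡ k =
        solve 1 (λ k → con 1 :+ con 2 :* k :+ con 0 :+ con 2 := con 1 :+ con 2 :* (con 1 :+ k)) refl k

      total : ∀ k → multichains _⊑?_ halved φ k ≡ (φ V₋ + k) + ((1 + 2 * k) + ((φ V₊ + k) + 2))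
      total k rewrite V₋≡ k | V₀≡ k | V₊≡ k | E₋≡ k | E₊≡ k = refl

  -- The product of ℓ factors v and d − ℓ factors u, for ℓ ≤ d.
  ∏ : ℕ → ℕ → ℕ → ℕ → ℕ
  ∏ u v zero    _       = 1
  ∏ u v (suc d) zero    = u * ∏ u v d zero
  ∏ u v (suc d) (suc ℓ) = v * ∏ u v d ℓ

  private
    1*n+0≡n : ∀ n → 1 * n + 0 ≡ n
    1*n+0≡n = solve 1 (λ n → con 1 :* n :+ con 0 := n) refl

  whole-uniqueAntisymmetric : UniqueAntisymmetric _⊑?_ whole
  whole-uniqueAntisymmetric (here refl)                 φ = 1*n+0≡n _
  whole-uniqueAntisymmetric (there (here refl))         φ = 1*n+0≡n _
  whole-uniqueAntisymmetric (there (there (here refl))) φ = 1*n+0≡n _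

  halved-uniqueAntisymmetric : UniqueAntisymmetric _⊑?_ halved
  halved-uniqueAntisymmetric (here refl)                                 φ = 1*n+0≡n _
  halved-uniqueAntisymmetric (there (here refl))                         φ = 1*n+0≡n _
  halved-uniqueAntisymmetric (there (there (here refl)))                 φ = 1*n+0≡n _
  halved-uniqueAntisymmetric (there (there (there (here refl))))         φ = 1*n+0≡n _
  halved-uniqueAntisymmetric (there (there (there (there (here refl))))) φ = 1*n+0≡n _

  cells-uniqueAntisymmetric : ∀ d ℓ → UniqueAntisymmetric (Pointwise.decidable _⊑?_) (cells d ℓ)
  cells-uniqueAntisymmetric zero    ℓ       (here refl) φ = 1*n+0≡n _
  cells-uniqueAntisymmetric (suc d) zero    = product-uniqueAntisymmetric _⊑?_ whole (cells d zero)
    whole-uniqueAntisymmetric (cells-uniqueAntisymmetric d zero)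
  cells-uniqueAntisymmetric (suc d) (suc ℓ) = product-uniqueAntisymmetric _⊑?_ halved (cells d ℓ)
    halved-uniqueAntisymmetric (cells-uniqueAntisymmetric d ℓ)

  ⊑-trans : ∀ {I J K} → I ⊑ J → J ⊑ K → I ⊑ K
  ⊑-trans (J≤I , I≤J) (K≤J , J≤K) = ℤ.≤-trans K≤J J≤I , ℤ.≤-trans I≤J J≤K

  boundary-downset : ∀ {d} {F G : Vec Interval d} → Pointwise _⊑_ F G → Any Extreme G → Any Extreme F
  boundary-downset (I⊑J ∷ _)   (here extreme)  = here (Sum.map (⊑-trans I⊑J) (⊑-trans I⊑J) extreme)
  boundary-downset (_   ∷ F⊆G) (there extreme) = there (boundary-downset F⊆G extreme)

  multichains-point : ∀ (φ : Vec Interval 0 → ℕ) k →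
    multichains (Pointwise.decidable _⊑?_) ([] ∷ []) φ k ≡ φ []
  multichains-point φ zero    = ℕ.+-identityʳ (φ [])
  multichains-point φ (suc k) = trans (ℕ.+-identityʳ _)
    (trans (cong (_+ 0) (ℕ.+-identityʳ _)) (multichains-point φ k))

  -- For m = k + 1 members the factors are 2m + 1 and 4m + 1.
  multichains-cells : ∀ d ℓ k → multichains (Pointwise.decidable _⊑?_) (cells d ℓ) (λ _ → 1) k ≡
    ∏ (3 + 2 * k) (5 + 4 * k) d ℓ
  multichains-cells zero    ℓ       k = multichains-point (λ _ → 1) k
  multichains-cells (suc d) zero    k = trans
    (multichains-⊗ _⊑?_ whole (cells d zero) {φ = λ _ → 1} {ψ = λ _ → 1} (λ _ _ → refl) k)
    (cong₂ _*_ (trans (Whole.total (λ _ → 1) refl k)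
        (solve 1 (λ k → (con 1 :+ k) :+ ((con 1 :+ k) :+ con 1) := con 3 :+ con 2 :* k) refl k))
      (multichains-cells d zero k))
  multichains-cells (suc d) (suc ℓ) k = trans
    (multichains-⊗ _⊑?_ halved (cells d ℓ) {φ = λ _ → 1} {ψ = λ _ → 1} (λ _ _ → refl) k)
    (cong₂ _*_ (trans (Halved.total (λ _ → 1) refl refl refl k)
        (solve 1 (λ k → (con 1 :+ k) :+ ((con 1 :+ con 2 :* k) :+ ((con 1 :+ k) :+ con 2)) := con 5 :+ con 4 :* k) refl k))
      (multichains-cells d ℓ k))

  interior : ∀ {d} → Vec Interval d → ℕ
  interior F = ⟦ ¬? (any? extreme? F) ⟧

  interior-∷ : ∀ {d} I (F : Vec Interval d) → interior (I ∷ F) ≡ inner I * interior F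
  interior-∷ I F = not-∨ (does (extreme? I)) (does (any? extreme? F))
    where
    not-∨ : ∀ a b → (if not (a ∨ b) then 1 else 0) ≡
      (if not a then 1 else 0) * (if not b then 1 else 0)
    not-∨ false false = refl
    not-∨ false true  = refl
    not-∨ true  b     = refl

  -- The last cell is off the boundary exactly if none of its factors is an endpoint of [-1, 1], so
  -- the weight is a product too. For m = k + 1 members the factors are 2m - 1 and 4m - 1.
  multichains-interior : ∀ d ℓ k → multichains (Pointwise.decidable _⊑?_) (cells d ℓ) interior k ≡
    ∏ (1 + 2 * k) (3 + 4 * k) d ℓ
  multichains-interior zero    ℓ       k = multichains-point interior k
  multichains-interior (suc d) zero    k = trans
    (multichains-⊗ _⊑?_ whole (cells d zero) interior-∷ k)
    (cong₂ _*_ (trans (Whole.total inner refl k)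
        (solve 1 (λ k → k :+ (k :+ con 1) := con 1 :+ con 2 :* k) refl k))
      (multichains-interior d zero k))
  multichains-interior (suc d) (suc ℓ) k = trans
    (multichains-⊗ _⊑?_ halved (cells d ℓ) interior-∷ k)
    (cong₂ _*_ (trans (Halved.total inner refl refl refl k)
        (solve 1 (λ k → k :+ ((con 1 :+ con 2 :* k) :+ (k :+ con 2)) := con 3 :+ con 4 :* k) refl k))
      (multichains-interior d ℓ k))

  module _ (d ℓ : ℕ) where
    open PolytopalComplex (∂Cuboid d ℓ)

    ∂Cuboid-uniqueAntisymmetric : UniqueAntisymmetric _⊆?_ faces
    ∂Cuboid-uniqueAntisymmetric = filter-uniqueAntisymmetric (Pointwise.decidable _⊑?_)
      (any? extreme?) (cells d ℓ) (cells-uniqueAntisymmetric d ℓ)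

    chainTable-∂Cuboid : ∀ k → chainTable (∂Cuboid d ℓ) 0 k + ∏ (1 + 2 * k) (3 + 4 * k) d ℓ ≡
      ∏ (3 + 2 * k) (5 + 4 * k) d ℓ
    chainTable-∂Cuboid k = subst₂ (λ m n → chainTable (∂Cuboid d ℓ) 0 k + m ≡ n)
      (multichains-interior d ℓ k) (multichains-cells d ℓ k)
      (multichains-downset (Pointwise.decidable _⊑?_) (any? extreme?) (cells d ℓ) boundary-downset k)

    -- The sum over chain lengths runs up to the number of faces, and this bound lets its Newton
    -- form be cut down to d terms. Faces are multichains with one member, so their number is
    -- `∏ 3 5 d ℓ` minus `∏ 1 3 d ℓ`.
    d≤∣faces∣ : d ≤ length faces
    d≤∣faces∣ = ℕ.+-cancelʳ-≤ (∏ 1 3 d ℓ) d (length faces) (ℕ.≤-trans (grow d ℓ)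
      (ℕ.≤-reflexive (sym (trans (cong (_+ ∏ 1 3 d ℓ) (length≡∑1 faces)) (chainTable-∂Cuboid 0)))))
      where
      ∏-pos : ∀ d ℓ → 1 ≤ ∏ 1 3 d ℓ
      ∏-pos zero    ℓ       = ℕ.≤-refl
      ∏-pos (suc d) zero    = ℕ.*-mono-≤ {1} {1} ℕ.≤-refl (∏-pos d zero)
      ∏-pos (suc d) (suc ℓ) = ℕ.*-mono-≤ {1} {3} (ℕ.s≤s ℕ.z≤n) (∏-pos d ℓ)
      -- Both kinds of factor grow by 2, from g = 1 to 3 and from g = 3 to 5.
      step : ∀ g d P Q → 1 ≤ P → d + P ≤ Q → suc d + g * P ≤ (2 + g) * Q
      step g d P Q 1≤P d+P≤Q = ℕ.≤-trans
        (ℕ.≤-trans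
          (ℕ.+-monoˡ-≤ (g * P) (ℕ.≤-trans (ℕ.≤-reflexive (ℕ.+-comm 1 d)) (ℕ.+-monoʳ-≤ d 1≤P)))
          (ℕ.+-mono-≤ (ℕ.≤-trans d+P≤Q (ℕ.m≤m+n Q (Q + 0))) (ℕ.*-monoʳ-≤ g (ℕ.≤-trans (ℕ.m≤n+m P d) d+P≤Q))))
        (ℕ.≤-reflexive (sym (ℕ.*-distribʳ-+ Q 2 g)))
      grow : ∀ d ℓ → d + ∏ 1 3 d ℓ ≤ ∏ 3 5 d ℓ
      grow zero    ℓ       = ℕ.≤-refl
      grow (suc d) zero    = step 1 d _ _ (∏-pos d zero) (grow d zero)
      grow (suc d) (suc ℓ) = step 3 d _ _ (∏-pos d ℓ) (grow d ℓ)

-- The commutative ring ℚ(i)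

module GaussianRationals where
  infix 5 _+i_
  record ℚ[i] : Set where
    constructor _+i_
    field
      ℜ ℑ : ℚ
  open ℚ[i] public

  infixl 6 _+_
  infixl 7 _*_
  infix 8 -_
  _+_ _*_ : ℚ[i] → ℚ[i] → ℚ[i]
  z + w = (ℜ z ℚ.+ ℜ w) +i (ℑ z ℚ.+ ℑ w)
  z * w = (ℜ z ℚ.* ℜ w ℚ.- ℑ z ℚ.* ℑ w) +i (ℜ z ℚ.* ℑ w ℚ.+ ℑ z ℚ.* ℜ w)
  -_ : ℚ[i] → ℚ[i]
  - z = (ℚ.- ℜ z) +i (ℚ.- ℑ z)
  0# 1# : ℚ[i]
  0# = 0ℚ +i 0ℚ
  1# = 1ℚ +i 0ℚ

  open import Algebra.Definitions {A = ℚ[i]} _≡_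
  open import Algebra.Structures {A = ℚ[i]} _≡_
  open ℚ-Solver

  *-assoc : Associative _*_
  *-assoc (a +i b) (c +i d) (e +i f) = cong₂ _+i_
    (solve 6 (λ a b c d e f → (a :* c :- b :* d) :* e :- (a :* d :+ b :* c) :* f
       := a :* (c :* e :- d :* f) :- b :* (c :* f :+ d :* e)) refl a b c d e f)
    (solve 6 (λ a b c d e f → (a :* c :- b :* d) :* f :+ (a :* d :+ b :* c) :* e
       := a :* (c :* f :+ d :* e) :+ b :* (c :* e :- d :* f)) refl a b c d e f)

  *-comm : Commutative _*_
  *-comm (a +i b) (c +i d) = cong₂ _+i_
    (solve 4 (λ a b c d → a :* c :- b :* d := c :* a :- d :* b) refl a b c d)
    (solve 4 (λ a b c d → a :* d :+ b :* c := c :* b :+ d :* a) refl a b c d)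

  *-identityˡ : LeftIdentity 1# _*_
  *-identityˡ (a +i b) = cong₂ _+i_
    (solve 2 (λ a b → con 1ℚ :* a :- con 0ℚ :* b := a) refl a b)
    (solve 2 (λ a b → con 1ℚ :* b :+ con 0ℚ :* a := b) refl a b)

  *-distribˡ-+ : _*_ DistributesOverˡ _+_
  *-distribˡ-+ (a +i b) (c +i d) (e +i f) = cong₂ _+i_
    (solve 6 (λ a b c d e f → a :* (c :+ e) :- b :* (d :+ f)
       := (a :* c :- b :* d) :+ (a :* e :- b :* f)) refl a b c d e f)
    (solve 6 (λ a b c d e f → a :* (d :+ f) :+ b :* (c :+ e)
       := (a :* d :+ b :* c) :+ (a :* f :+ b :* e)) refl a b c d e f)

  isCommutativeRing : IsCommutativeRing _+_ _*_ -_ 0# 1#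
  isCommutativeRing = record
    { isRing = record
      { +-isAbelianGroup = record
        { isGroup = record
          { isMonoid = record
            { isSemigroup = record
              { isMagma = record { isEquivalence = isEquivalence ; ∙-cong = cong₂ _+_ }
              ; assoc = λ a b c → cong₂ _+i_ (ℚ.+-assoc (ℜ a) (ℜ b) (ℜ c)) (ℚ.+-assoc (ℑ a) (ℑ b) (ℑ c)) }
            ; identity = (λ a → cong₂ _+i_ (ℚ.+-identityˡ (ℜ a)) (ℚ.+-identityˡ (ℑ a)))
                       , (λ a → cong₂ _+i_ (ℚ.+-identityʳ (ℜ a)) (ℚ.+-identityʳ (ℑ a))) }
          ; inverse = (λ a → cong₂ _+i_ (ℚ.+-inverseˡ (ℜ a)) (ℚ.+-inverseˡ (ℑ a)))
                    , (λ a → cong₂ _+i_ (ℚ.+-inverseʳ (ℜ a)) (ℚ.+-inverseʳ (ℑ a)))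
          ; ⁻¹-cong = cong -_ }
        ; comm = λ a b → cong₂ _+i_ (ℚ.+-comm (ℜ a) (ℜ b)) (ℚ.+-comm (ℑ a) (ℑ b)) }
      ; *-cong = cong₂ _*_
      ; *-assoc = *-assoc
      ; *-identity = *-identityˡ , λ z → trans (*-comm z 1#) (*-identityˡ z)
      ; distrib = *-distribˡ-+ , λ x y z → trans (*-comm (y + z) x) (trans (*-distribˡ-+ x y z) (cong₂ _+_ (*-comm x y) (*-comm x z)))
      }
    ; *-comm = *-comm }

  commutativeRing : CommutativeRing _ _
  commutativeRing = record { isCommutativeRing = isCommutativeRing }

  _≟_ : DecidableEquality ℚ[i]
  (a +i b) ≟ (c +i d) with a ℚ.≟ c | b ℚ.≟ d
  ... | yes refl | yes refl = yes refl
  ... | no p | _ = no λ { refl → p refl }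
  ... | _ | no p = no λ { refl → p refl }

  module ℚ[i]-Solver = RingSolver (AlmostCommutativeRing.fromCommutativeRing commutativeRing) _≟_

open GaussianRationals

-- Finite differences, Newton polynomials and products of consecutive values

module FiniteDifferences where
  open import Algebra.Properties.Semiring.Exp (CommutativeRing.semiring commutativeRing) using (_^_) public
  open CommutativeRing commutativeRing using (_-_; +-identityʳ; +-identityˡ; zeroʳ; zeroˡ; distribˡ; distribʳ; *-identityʳ; +-assoc) public
  open ℚ[i]-Solver using (solve; _:=_; _:+_; _:*_; _:-_; con)

  Δ : (ℕ → ℚ[i]) → ℕ → ℚ[i]
  Δ g m = g (suc m) - g m

  -- Polynomial sequences of degree below D, characterised by a vanishing D-th difference, so that
  -- no coefficients have to be carried along.
  Degree< : ℕ → (ℕ → ℚ[i]) → Set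
  Degree< zero    g = ∀ m → g m ≡ 0#
  Degree< (suc D) g = Degree< D (Δ g)

  Degree<-resp : ∀ D {f g : ℕ → ℚ[i]} → (∀ m → f m ≡ g m) → Degree< D f → Degree< D g
  Degree<-resp zero    f≗g f₀ m = trans (sym (f≗g m)) (f₀ m)
  Degree<-resp (suc D) f≗g fₛ   = Degree<-resp D (λ m → cong₂ _-_ (f≗g (suc m)) (f≗g m)) fₛ

  Degree<-0 : ∀ D → Degree< D (λ _ → 0#)
  Degree<-0 zero    m = refl
  Degree<-0 (suc D) = Degree<-resp D (λ _ → solve 0 (con 0# := con 0# :- con 0#) refl) (Degree<-0 D)

  Degree<-+ : ∀ D f g → Degree< D f → Degree< D g → Degree< D (λ m → f m + g m)
  Degree<-+ zero    f g f₀ g₀ m = trans (cong₂ _+_ (f₀ m) (g₀ m)) (+-identityˡ 0#)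
  Degree<-+ (suc D) f g fₛ gₛ = Degree<-resp D
    (λ m → solve 4 (λ a b c d → (a :- b) :+ (c :- d) := (a :+ c) :- (b :+ d)) refl (f (suc m)) (f m) (g (suc m)) (g m))
    (Degree<-+ D (Δ f) (Δ g) fₛ gₛ)

  Degree<-*ˡ : ∀ D c g → Degree< D g → Degree< D (λ m → c * g m)
  Degree<-*ˡ zero    c g g₀ m = trans (cong (c *_) (g₀ m)) (zeroʳ c)
  Degree<-*ˡ (suc D) c g gₛ = Degree<-resp D
    (λ m → solve 3 (λ a b c → c :* (a :- b) := c :* a :- c :* b) refl (g (suc m)) (g m) c)
    (Degree<-*ˡ D c (Δ g) gₛ)

  Degree<-suc : ∀ D g → Degree< D g → Degree< (suc D) g
  Degree<-suc zero    g g₀ m = trans (cong₂ _-_ (g₀ (suc m)) (g₀ m)) (solve 0 (con 0# :- con 0# := con 0#) refl)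
  Degree<-suc (suc D) g gₛ = Degree<-suc D (Δ g) gₛ

  Affine : (ℕ → ℚ[i]) → Set
  Affine f = ∃ λ c → ∀ m → f (suc m) ≡ f m + c

  -- The product rule Δ(f g)(m) = f(m + 1) Δg(m) + c g(m), where c is the slope of f. The induction
  -- meets the shifted f, which is affine with the same slope.
  Degree<-affine : ∀ D f g → Affine f → Degree< D g → Degree< (suc D) (λ m → f m * g m)
  Degree<-affine zero    f g _         g₀ = Degree<-suc 0 (λ m → f m * g m) (λ m → trans (cong (f m *_) (g₀ m)) (zeroʳ (f m)))
  Degree<-affine (suc D) f g (c , f-c) gₛ = Degree<-resp (suc D)
    (λ m → trans
      (solve 4 (λ f′ c g′ g → f′ :* (g′ :- g) :+ c :* g := f′ :* g′ :- (f′ :- c) :* g) refl (f (suc m)) c (g (suc m)) (g m))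
      (cong (λ a → f (suc m) * g (suc m) - a * g m)
        (trans (cong (_- c) (f-c m)) (solve 2 (λ a c → (a :+ c) :- c := a) refl (f m) c))))
    (Degree<-+ (suc D) (λ m → f (suc m) * Δ g m) (λ m → c * g m)
      (Degree<-affine D (f ∘ suc) (Δ g) (c , f-c ∘ suc) gₛ)
      (Degree<-*ˡ (suc D) c g gₛ))

  -- newton D g = Σ_{j<D} Δʲg(0) yʲ.  If g has degree < D and y = z/(1 − z), then
  -- (1 + y) newton D g stands for the power series Σ_{m≥0} g(m) zᵐ.
  module Newton (y : ℚ[i]) where

    newton : ℕ → (ℕ → ℚ[i]) → ℚ[i]
    newton zero    g = 0#
    newton (suc D) g = g 0 + y * newton D (Δ g)

    newton-cong : ∀ D {f g} → (∀ m → f m ≡ g m) → newton D f ≡ newton D g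
    newton-cong zero    f≗g = refl
    newton-cong (suc D) f≗g = cong₂ _+_ (f≗g 0)
      (cong (y *_) (newton-cong D λ m → cong₂ _-_ (f≗g (suc m)) (f≗g m)))

    newton-0 : ∀ D → newton D (λ _ → 0#) ≡ 0#
    newton-0 zero    = refl
    newton-0 (suc D) = trans (cong (λ a → 0# + y * a)
      (trans (newton-cong D (λ _ → solve 0 (con 0# :- con 0# := con 0#) refl)) (newton-0 D)))
      (trans (+-identityˡ _) (zeroʳ y))

    newton-+ : ∀ D f g → newton D (λ m → f m + g m) ≡ newton D f + newton D g
    newton-+ zero    f g = sym (+-identityˡ 0#)
    newton-+ (suc D) f g = trans
      (cong (λ a → f 0 + g 0 + y * a) (trans
        (newton-cong D λ m → solve 4 (λ a b c d → (a :+ c) :- (b :+ d) := (a :- b) :+ (c :- d)) refl (f (suc m)) (f m) (g (suc m)) (g m))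
        (newton-+ D (Δ f) (Δ g))))
      (solve 5 (λ a b y c d → a :+ b :+ y :* (c :+ d) := (a :+ y :* c) :+ (b :+ y :* d)) refl
        (f 0) (g 0) y (newton D (Δ f)) (newton D (Δ g)))

    newton-suc : ∀ D g → Degree< D g → newton (suc D) g ≡ newton D g
    newton-suc zero    g g₀ = trans (cong₂ _+_ (g₀ 0) (zeroʳ y)) (+-identityˡ 0#)
    newton-suc (suc D) g gₛ = cong (λ a → g 0 + y * a) (newton-suc D (Δ g) gₛ)

    newton-stable : ∀ D e g → Degree< D g → newton (e ℕ.+ D) g ≡ newton D g
    newton-stable D zero    g gₛ = refl
    newton-stable D (suc e) g gₛ = trans (newton-suc (e ℕ.+ D) g (degree-+ e)) (newton-stable D e g gₛ)
      where
      degree-+ : ∀ e → Degree< (e ℕ.+ D) g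
      degree-+ zero    = gₛ
      degree-+ (suc e) = Degree<-suc (e ℕ.+ D) g (degree-+ e)

    -- Splits the term m = 0 off the series Σ g(m) zᵐ: the factor 1 + y turns a Newton polynomial
    -- into the series, and z (1 + y) = y.
    newton-shift : ∀ D g → Degree< D g →
      g 0 + y * newton D (g ∘ suc) ≡ (1# + y) * newton D g
    newton-shift D g gₛ = begin
      g 0 + y * newton D (g ∘ suc)
        ≡⟨ cong (λ a → g 0 + y * a) (trans
             (newton-cong D λ m → solve 2 (λ a b → a := b :+ (a :- b)) refl (g (suc m)) (g m))
             (newton-+ D g (Δ g))) ⟩
      g 0 + y * (newton D g + newton D (Δ g))
        ≡⟨ solve 4 (λ a y b c → a :+ y :* (b :+ c) := (a :+ y :* c) :+ y :* b) refl
             (g 0) y (newton D g) (newton D (Δ g)) ⟩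
      newton (suc D) g + y * newton D g
        ≡⟨ cong (_+ y * newton D g) (newton-suc D g gₛ) ⟩
      newton D g + y * newton D g
        ≡⟨ solve 2 (λ a y → a :+ y :* a := (con 1# :+ y) :* a) refl (newton D g) y ⟩
      (1# + y) * newton D g ∎
      where open ≡-Reasoning

  ∏ᴷ : ℚ[i] → ℚ[i] → ℕ → ℕ → ℚ[i]
  ∏ᴷ u v zero    _       = 1#
  ∏ᴷ u v (suc d) zero    = u * ∏ᴷ u v d zero
  ∏ᴷ u v (suc d) (suc ℓ) = v * ∏ᴷ u v d ℓ

  module Consecutive (s t : ℕ → ℚ[i]) (t≡s+1 : ∀ m → t m ≡ s m + 1#) where

    monomial : ℕ → ℕ → ℕ → ℚ[i]
    monomial i j m = s m ^ i * t m ^ j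

    -- The reason for pairing s with s + 1: neighbouring monomials of one degree differ by a
    -- monomial of the degree below, so each list of monomials has the preceding list as its
    -- differences.
    monomial-step : ∀ i j m → monomial i (suc j) m ≡ monomial (suc i) j m + monomial i j m
    monomial-step i j m = trans (cong (λ a → s m ^ i * (a * t m ^ j)) (t≡s+1 m))
      (solve 3 (λ s a b → a :* ((s :+ con 1#) :* b) := (s :* a) :* b :+ a :* b) refl (s m) (s m ^ i) (t m ^ j))

    monomial-degree : Affine s → ∀ i j → Degree< (suc (i ℕ.+ j)) (monomial i j)
    monomial-degree affine-s@(c , s-c) (suc i) j = Degree<-resp (suc (suc (i ℕ.+ j)))
      (λ m → sym (*-assoc (s m) (s m ^ i) (t m ^ j)))
      (Degree<-affine (suc (i ℕ.+ j)) s (monomial i j) affine-s (monomial-degree affine-s i j))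
    monomial-degree affine-s@(c , s-c) zero (suc j) = Degree<-resp (suc (suc j))
      (λ m → solve 2 (λ a b → a :* (con 1# :* b) := con 1# :* (a :* b)) refl (t m) (t m ^ j))
      (Degree<-affine (suc j) t (monomial zero j) (c , affine-t) (monomial-degree affine-s zero j))
      where
      affine-t : ∀ m → t (suc m) ≡ t m + c
      affine-t m = trans (t≡s+1 (suc m)) (trans (cong (_+ 1#) (s-c m))
        (trans (solve 2 (λ a c → (a :+ c) :+ con 1# := (a :+ con 1#) :+ c) refl (s m) c) (cong (_+ c) (sym (t≡s+1 m)))))
    monomial-degree affine-s zero zero m = solve 0 (con 1# :* con 1# :- con 1# :* con 1# := con 0#) refl

    -- Combinations of the monomials of degree n with coefficients in ℕ. Sequences are compared
    -- pointwise, hence `resp`.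
    data Cone (n : ℕ) : (ℕ → ℚ[i]) → Set where
      gen  : ∀ {i} → i ≤ n → Cone n (monomial i (n ∸ i))
      null   : Cone n (λ _ → 0#)
      _⊕_  : ∀ {f g} → Cone n f → Cone n g → Cone n (λ m → f m + g m)
      resp : ∀ {f g} → (∀ m → f m ≡ g m) → Cone n f → Cone n g

    private
      _·_ : (ℕ → ℚ[i]) → (ℕ → ℚ[i]) → ℕ → ℚ[i]
      (f · g) m = f m * g m

    Multiplier : (ℕ → ℚ[i]) → Set
    Multiplier f = ∀ {n g} → Cone n g → Cone (suc n) (f · g)

    s· : Multiplier s
    s· {n} (gen {i} i≤n) = resp (λ m → *-assoc (s m) (s m ^ i) (t m ^ (n ∸ i))) (gen (s≤s i≤n))
    s· null = resp (λ m → sym (zeroʳ (s m))) null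
    s· (_⊕_ {f} {g} F G) = resp (λ m → sym (distribˡ (s m) (f m) (g m))) (s· F ⊕ s· G)
    s· (resp f≗g F) = resp (λ m → cong (s m *_) (f≗g m)) (s· F)

    t· : Multiplier t
    t· {n} (gen {i} i≤n) = resp
      (λ m → trans (cong (λ j → s m ^ i * t m ^ j) (ℕ.+-∸-assoc 1 i≤n))
        (solve 3 (λ t a b → a :* (t :* b) := t :* (a :* b)) refl (t m) (s m ^ i) (t m ^ (n ∸ i))))
      (gen (ℕ.m≤n⇒m≤1+n i≤n))
    t· null = resp (λ m → sym (zeroʳ (t m))) null
    t· (_⊕_ {f} {g} F G) = resp (λ m → sym (distribˡ (t m) (f m) (g m))) (t· F ⊕ t· G)
    t· (resp f≗g F) = resp (λ m → cong (t m *_) (f≗g m)) (t· F)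

    +· : ∀ f g → Multiplier f → Multiplier g → Multiplier (λ m → f m + g m)
    +· f g f· g· {n} {h} H = resp (λ m → sym (distribʳ (h m) (f m) (g m))) (f· H ⊕ g· H)

    1∈Cone : Cone 0 (λ _ → 1#)
    1∈Cone = resp (λ _ → *-identityʳ 1#) (gen z≤n)

    ∏∈Cone : ∀ u v → Multiplier u → Multiplier v → ∀ d ℓ → Cone d (λ m → ∏ᴷ (u m) (v m) d ℓ)
    ∏∈Cone u v u· v· zero    ℓ       = 1∈Cone
    ∏∈Cone u v u· v· (suc d) zero    = u· (∏∈Cone u v u· v· d zero)
    ∏∈Cone u v u· v· (suc d) (suc ℓ) = v· (∏∈Cone u v u· v· d ℓ)

    -- u F − u′ F′ = u (F − F′) + (u − u′) F′ with u − u′ = 1, so the difference of the two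
    -- products is a sum of products with one factor fewer.
    module Telescope
      (u v u′ v′ : ℕ → ℚ[i]) (u≡u′+1 : ∀ m → u m ≡ u′ m + 1#) (v≡v′+1 : ∀ m → v m ≡ v′ m + 1#)
      (u′· : Multiplier u′) (v′· : Multiplier v′)
      (H : ℕ → (ℕ → ℚ[i]) → Set)
      (H-resp : ∀ {n f g} → (∀ m → f m ≡ g m) → H n f → H n g)
      (H-1 : H 0 (λ _ → 1#)) (u·ᴴ : ∀ {n g} → H n g → H (suc n) (u · g)) (v·ᴴ : ∀ {n g} → H n g → H (suc n) (v · g))
      (_⊕ᴴ_ : ∀ {n f g} → H n f → Cone n g → H n (λ m → f m + g m)) where

      private
        step : ∀ a a′ F F′ X → a ≡ a′ + 1# → F ≡ F′ + X → a * F ≡ a′ * F′ + (a * X + F′)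
        step a a′ F F′ X refl refl =
          solve 3 (λ a′ F′ X → (a′ :+ con 1#) :* (F′ :+ X) := a′ :* F′ :+ ((a′ :+ con 1#) :* X :+ F′)) refl a′ F′ X

        base : ∀ a a′ → a ≡ a′ + 1# → a * 1# ≡ a′ * 1# + 1#
        base a a′ refl = solve 1 (λ a → (a :+ con 1#) :* con 1# := a :* con 1# :+ con 1#) refl a′

      telescope : ∀ n ℓ → ∃ λ X → H n X ×
        (∀ m → ∏ᴷ (u m) (v m) (suc n) ℓ ≡ ∏ᴷ (u′ m) (v′ m) (suc n) ℓ + X m)
      telescope zero    zero    = (λ _ → 1#) , H-1 , λ m → base (u m) (u′ m) (u≡u′+1 m)
      telescope zero    (suc ℓ) = (λ _ → 1#) , H-1 , λ m → base (v m) (v′ m) (v≡v′+1 m)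
      telescope (suc n) zero with telescope n zero
      ... | X , HX , eq = _ , (u·ᴴ HX ⊕ᴴ ∏∈Cone u′ v′ u′· v′· (suc n) zero) ,
        λ m → step (u m) (u′ m) _ _ (X m) (u≡u′+1 m) (eq m)
      telescope (suc n) (suc ℓ) with telescope n ℓ
      ... | X , HX , eq = _ , (v·ᴴ HX ⊕ᴴ ∏∈Cone u′ v′ u′· v′· (suc n) ℓ) ,
        λ m → step (v m) (v′ m) _ _ (X m) (v≡v′+1 m) (eq m)

    -- Keeps one copy of tⁿ apart, the term that later makes the estimate strict. It survives
    -- multiplication by t and by s + t, since both contain t.
    Cone⁺ : ℕ → (ℕ → ℚ[i]) → Set
    Cone⁺ n g = ∃ λ X → Cone n X × (∀ m → g m ≡ monomial 0 n m + X m)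

    -- For s = 2m and t = 2m + 1 the factors go from 2m + 1 and 4m + 1 down to 2m and 4m.
    telescope⁺ : ∀ n ℓ → ∃ λ X → Cone⁺ n X × (∀ m →
      ∏ᴷ (t m) (s m + t m) (suc n) ℓ ≡ ∏ᴷ (s m) (s m + s m) (suc n) ℓ + X m)
    telescope⁺ = Telescope.telescope t (λ m → s m + t m) s (λ m → s m + s m) t≡s+1
      (λ m → trans (cong (s m +_) (t≡s+1 m)) (sym (+-assoc (s m) (s m) 1#)))
      s· (+· s s s· s·) Cone⁺
      (λ { f≗g (X , CX , eq) → X , CX , λ m → trans (sym (f≗g m)) (eq m) })
      ((λ _ → 0#) , null , λ m → solve 0 (con 1# := con 1# :* con 1# :+ con 0#) refl)
      (λ { {n} {g} (X , CX , eq) → (λ m → t m * X m) , t· CX , λ m → trans (cong (t m *_) (eq m))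
           (solve 3 (λ t a x → t :* (con 1# :* a :+ x) := con 1# :* (t :* a) :+ t :* x) refl (t m) (t m ^ n) (X m)) })
      (λ { {n} {g} (X , CX , eq) → (λ m → s m * monomial 0 n m + (s m + t m) * X m) , (s· (gen z≤n) ⊕ +· s t s· t· CX) ,
           λ m → trans (cong ((s m + t m) *_) (eq m))
           (solve 4 (λ s t a x → (s :+ t) :* (con 1# :* a :+ x) := con 1# :* (t :* a) :+ (s :* (con 1# :* a) :+ (s :+ t) :* x)) refl
             (s m) (t m) (t m ^ n) (X m)) })
      (λ { {n} {f} {g} (X , CX , eq) CY → (λ m → X m + g m) , (CX ⊕ CY) ,
           λ m → trans (cong (_+ g m) (eq m)) (+-assoc (monomial 0 n m) (X m) (g m)) })

    -- For s = 2m + 1 and t = 2m + 2 the factors go from 2m + 2 and 4m + 4 down to 2m + 1 and 4m +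
    -- 3.
    telescope₂ : ∀ n ℓ → ∃ λ X → Cone n X × (∀ m →
      ∏ᴷ (t m) (t m + t m) (suc n) ℓ ≡ ∏ᴷ (s m) (s m + t m) (suc n) ℓ + X m)
    telescope₂ = Telescope.telescope t (λ m → t m + t m) s (λ m → s m + t m) t≡s+1
      (λ m → trans (cong (_+ t m) (t≡s+1 m)) (solve 2 (λ s t → (s :+ con 1#) :+ t := (s :+ t) :+ con 1#) refl (s m) (t m)))
      s· (+· s t s· t·) Cone resp 1∈Cone t· (+· t t t· t·) _⊕_

open FiniteDifferences

-- Counterclockwise order within an arc, and its inheritance by sums over periods

module Interlacing where
  -- Im(conj(a) b): its sign is the orientation of the pair, which replaces arguments of complex
  -- numbers.
  area : ℚ[i] → ℚ[i] → ℚ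
  area a b = ℜ a ℚ.* ℑ b ℚ.- ℑ a ℚ.* ℜ b

  ∣_∣² : ℚ[i] → ℚ
  ∣ a ∣² = ℜ a ℚ.* ℜ a ℚ.+ ℑ a ℚ.* ℑ a

  module _ where
    open ℚ-Solver

    area-+ˡ : ∀ a b c → area (a + b) c ≡ area a c ℚ.+ area b c
    area-+ˡ (a +i a′) (b +i b′) (c +i c′) = solve 6
      (λ a a′ b b′ c c′ → (a :+ b) :* c′ :- (a′ :+ b′) :* c := (a :* c′ :- a′ :* c) :+ (b :* c′ :- b′ :* c))
      refl a a′ b b′ c c′

    area-+ʳ : ∀ a b c → area a (b + c) ≡ area a b ℚ.+ area a c
    area-+ʳ (a +i a′) (b +i b′) (c +i c′) = solve 6
      (λ a a′ b b′ c c′ → a :* (b′ :+ c′) :- a′ :* (b :+ c) := (a :* b′ :- a′ :* b) :+ (a :* c′ :- a′ :* c))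
      refl a a′ b b′ c c′

    area-self : ∀ a → area a a ≡ 0ℚ
    area-self (a +i a′) = solve 2 (λ a a′ → a :* a′ :- a′ :* a := con 0ℚ) refl a a′

    area-0ˡ : ∀ a → area 0# a ≡ 0ℚ
    area-0ˡ (a +i a′) = solve 2 (λ a a′ → con 0ℚ :* a′ :- con 0ℚ :* a := con 0ℚ) refl a a′

    area-0ʳ : ∀ a → area a 0# ≡ 0ℚ
    area-0ʳ (a +i a′) = solve 2 (λ a a′ → a :* con 0ℚ :- a′ :* con 0ℚ := con 0ℚ) refl a a′

    area-rotate : ∀ z a → area a (z * a) ≡ ℑ z ℚ.* ∣ a ∣²
    area-rotate (z +i z′) (a +i a′) = solve 4
      (λ z z′ a a′ → a :* (z :* a′ :+ z′ :* a) :- a′ :* (z :* a :- z′ :* a′) := z′ :* (a :* a :+ a′ :* a′))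
      refl z z′ a a′

    area-scale : ∀ s a b → area (s * a) (s * b) ≡ ∣ s ∣² ℚ.* area a b
    area-scale (s +i s′) (a +i a′) (b +i b′) = solve 6
      (λ s s′ a a′ b b′ →
        (s :* a :- s′ :* a′) :* (s :* b′ :+ s′ :* b) :- (s :* a′ :+ s′ :* a) :* (s :* b :- s′ :* b′)
        := (s :* s :+ s′ :* s′) :* (a :* b′ :- a′ :* b))
      refl s s′ a a′ b b′

    ∣∣²-* : ∀ a b → ∣ a * b ∣² ≡ ∣ a ∣² ℚ.* ∣ b ∣²
    ∣∣²-* (a +i a′) (b +i b′) = solve 4
      (λ a a′ b b′ →
        (a :* b :- a′ :* b′) :* (a :* b :- a′ :* b′) :+ (a :* b′ :+ a′ :* b) :* (a :* b′ :+ a′ :* b)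
        := (a :* a :+ a′ :* a′) :* (b :* b :+ b′ :* b′))
      refl a a′ b b′

    lagrange : ∀ a b → ∣ a ∣² ℚ.* ∣ b ∣² ≡
      area a b ℚ.* area a b ℚ.+ (ℜ a ℚ.* ℜ b ℚ.+ ℑ a ℚ.* ℑ b) ℚ.* (ℜ a ℚ.* ℜ b ℚ.+ ℑ a ℚ.* ℑ b)
    lagrange (a +i a′) (b +i b′) = solve 4
      (λ a a′ b b′ →
        (a :* a :+ a′ :* a′) :* (b :* b :+ b′ :* b′) :=
        (a :* b′ :- a′ :* b) :* (a :* b′ :- a′ :* b) :+ (a :* b :+ a′ :* b′) :* (a :* b :+ a′ :* b′))
      refl a a′ b b′

  +-nonneg : ∀ {p q} → 0ℚ ℚ.≤ p → 0ℚ ℚ.≤ q → 0ℚ ℚ.≤ p ℚ.+ q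
  +-nonneg = ℚ.+-mono-≤

  *-nonneg : ∀ {p q} → 0ℚ ℚ.≤ p → 0ℚ ℚ.≤ q → 0ℚ ℚ.≤ p ℚ.* q
  *-nonneg {p} {q} 0≤p 0≤q = ℚ.nonNegative⁻¹ (p ℚ.* q)
    {{ℚ.nonNeg*nonNeg⇒nonNeg p {{ℚ.nonNegative 0≤p}} q {{ℚ.nonNegative 0≤q}}}}

  *-mono-≤-nonneg : ∀ {p q r s} → 0ℚ ℚ.≤ p → 0ℚ ℚ.≤ r → p ℚ.≤ q → r ℚ.≤ s → p ℚ.* r ℚ.≤ q ℚ.* s
  *-mono-≤-nonneg {p} {q} {r} {s} 0≤p 0≤r p≤q r≤s = ℚ.≤-trans
    (ℚ.*-monoʳ-≤-nonNeg r {{ℚ.nonNegative 0≤r}} p≤q)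
    (ℚ.*-monoˡ-≤-nonNeg q {{ℚ.nonNegative (ℚ.≤-trans 0≤p p≤q)}} r≤s)

  square-nonneg : ∀ p → 0ℚ ℚ.≤ p ℚ.* p
  square-nonneg p with ℚ.≤-total 0ℚ p
  ... | inj₁ 0≤p = *-nonneg 0≤p 0≤p
  ... | inj₂ p≤0 = subst (0ℚ ℚ.≤_) (solve 1 (λ p → (:- p) :* (:- p) := p :* p) refl p)
      (*-nonneg (ℚ.neg-antimono-≤ p≤0) (ℚ.neg-antimono-≤ p≤0))
    where open ℚ-Solver

  ∣∣²-nonneg : ∀ a → 0ℚ ℚ.≤ ∣ a ∣²
  ∣∣²-nonneg a = +-nonneg (square-nonneg (ℜ a)) (square-nonneg (ℑ a))

  area²≤ : ∀ a b → area a b ℚ.* area a b ℚ.≤ ∣ a ∣² ℚ.* ∣ b ∣²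
  area²≤ a b = subst (area a b ℚ.* area a b ℚ.≤_) (sym (lagrange a b))
    (subst (ℚ._≤ area a b ℚ.* area a b ℚ.+ a∙b ℚ.* a∙b) (ℚ.+-identityʳ (area a b ℚ.* area a b))
      (ℚ.+-monoʳ-≤ (area a b ℚ.* area a b) (square-nonneg a∙b)))
    where a∙b = ℜ a ℚ.* ℜ b ℚ.+ ℑ a ℚ.* ℑ b

  -- Cauchy-Schwarz in squared form, which avoids roots: c ∣u∣² is at most the area, which is at
  -- most the product of the moduli of a, z and u.
  ∣∣²-from-area : ∀ {c} a z u → 0ℚ ℚ.≤ c → 0ℚ ℚ.< ∣ u ∣² →
    c ℚ.* ∣ u ∣² ℚ.≤ area a (z * u) → (c ℚ.* c) ℚ.* ∣ u ∣² ℚ.≤ ∣ a ∣² ℚ.* ∣ z ∣²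
  ∣∣²-from-area {c} a z u 0≤c 0<u cu≤ = ℚ.*-cancelʳ-≤-pos ∣ u ∣² {{ℚ.positive 0<u}} (begin
    (c ℚ.* c) ℚ.* ∣ u ∣² ℚ.* ∣ u ∣²
      ≡⟨ solve 2 (λ c u → c :* c :* u :* u := (c :* u) :* (c :* u)) refl c ∣ u ∣² ⟩
    (c ℚ.* ∣ u ∣²) ℚ.* (c ℚ.* ∣ u ∣²)
      ≤⟨ *-mono-≤-nonneg 0≤cu 0≤cu cu≤ cu≤ ⟩
    area a (z * u) ℚ.* area a (z * u)
      ≤⟨ area²≤ a (z * u) ⟩
    ∣ a ∣² ℚ.* ∣ z * u ∣²
      ≡⟨ cong (∣ a ∣² ℚ.*_) (∣∣²-* z u) ⟩
    ∣ a ∣² ℚ.* (∣ z ∣² ℚ.* ∣ u ∣²)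
      ≡⟨ sym (ℚ.*-assoc ∣ a ∣² ∣ z ∣² ∣ u ∣²) ⟩
    ∣ a ∣² ℚ.* ∣ z ∣² ℚ.* ∣ u ∣² ∎)
    where
    open ℚ.≤-Reasoning
    open ℚ-Solver
    0≤cu = *-nonneg 0≤c (ℚ.<⇒≤ 0<u)

  private
    nonneg-resp : ∀ {p q} → p ≡ q → 0ℚ ℚ.≤ q → 0ℚ ℚ.≤ p
    nonneg-resp eq = subst (0ℚ ℚ.≤_) (sym eq)

  range : (ℕ → ℚ[i]) → ℕ → ℕ → ℚ[i]
  range U k zero    = 0#
  range U k (suc p) = U k + range U (suc k) p

  module Arc (z : ℚ[i]) (0≤ℑz : 0ℚ ℚ.≤ ℑ z) where

    -- a, b, z a occur in this order counterclockwise, within the angle arg z < π.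
    infix 4 _≼_
    _≼_ : ℚ[i] → ℚ[i] → Set
    a ≼ b = (0ℚ ℚ.≤ area a b) × (0ℚ ℚ.≤ area b (z * a))

    ≼-refl : ∀ a → a ≼ a
    ≼-refl a = nonneg-resp (area-self a) ℚ.≤-refl
      , nonneg-resp (area-rotate z a) (*-nonneg 0≤ℑz (∣∣²-nonneg a))

    ≼-rotate : ∀ {a b} → a ≼ b → b ≼ z * a
    ≼-rotate {a} {b} (ab , bza) = bza , nonneg-resp (area-scale z a b) (*-nonneg (∣∣²-nonneg z) ab)

    ≼-+ʳ : ∀ {a b c} → a ≼ b → a ≼ c → a ≼ b + c
    ≼-+ʳ {a} {b} {c} (ab , ba) (ac , ca) =
      nonneg-resp (area-+ʳ a b c) (+-nonneg ab ac) , nonneg-resp (area-+ˡ b c (z * a)) (+-nonneg ba ca)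

    ≼-+ˡ : ∀ {a b c} → a ≼ c → b ≼ c → a + b ≼ c
    ≼-+ˡ {a} {b} {c} (ac , ca) (bc , cb) =
      nonneg-resp (area-+ˡ a b c) (+-nonneg ac bc) ,
      nonneg-resp (trans (cong (area c) (*-distribˡ-+ z a b)) (area-+ʳ c (z * a) (z * b))) (+-nonneg ca cb)

    ≼-0ʳ : ∀ a → a ≼ 0#
    ≼-0ʳ a = nonneg-resp (area-0ʳ a) ℚ.≤-refl , nonneg-resp (area-0ˡ (z * a)) ℚ.≤-refl

    ≼-0ˡ : ∀ a → 0# ≼ a
    ≼-0ˡ a = nonneg-resp (area-0ˡ a) ℚ.≤-refl
      , nonneg-resp (trans (cong (area a) (zeroʳ z)) (area-0ʳ a)) ℚ.≤-refl

    -- The values b, e, z b come in this order, so all four comparisons of a summand on the left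
    -- with a summand on the right hold, and `≼` is additive on both sides.
    ≼-sum : ∀ {b e} → b ≼ e → b + e ≼ e + z * b
    ≼-sum {b} {e} b≼e = ≼-+ʳ {b + e} {e} {z * b} (≼-+ˡ {b} {e} {e} b≼e (≼-refl e))
      (≼-+ˡ {b} {e} {z * b} (≼-rotate {b} {b} (≼-refl b)) (≼-rotate {b} {e} b≼e))

    ≼-cancel : ∀ s {a b} → 0ℚ ℚ.< ∣ s ∣² → s * a ≼ s * b → a ≼ b
    ≼-cancel s {a} {b} 0<s (ab , ba) =
      cancel (subst (0ℚ ℚ.≤_) (area-scale s a b) ab) ,
      cancel (subst (0ℚ ℚ.≤_) (trans
        (cong (area (s * b)) (solve 3 (λ z s a → z :* (s :* a) := s :* (z :* a)) refl z s a))
        (area-scale s b (z * a))) ba)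
      where
      open ℚ[i]-Solver using (solve; _:=_; _:*_)
      cancel : ∀ {p} → 0ℚ ℚ.≤ ∣ s ∣² ℚ.* p → 0ℚ ℚ.≤ p
      cancel {p} 0≤sp = ℚ.*-cancelˡ-≤-pos ∣ s ∣² {{ℚ.positive 0<s}}
        (subst (ℚ._≤ ∣ s ∣² ℚ.* p) (sym (ℚ.*-zeroʳ ∣ s ∣²)) 0≤sp)

    range-≼ʳ : ∀ {a} U k p → (∀ i → k ℕ.≤ i → i ℕ.< k ℕ.+ p → a ≼ U i) → a ≼ range U k p
    range-≼ʳ {a} U k zero    a≼U = ≼-0ʳ a
    range-≼ʳ {a} U k (suc p) a≼U = ≼-+ʳ {a} {U k} {range U (suc k) p}
      (a≼U k ℕ.≤-refl (ℕ.m<m+n k (s≤s z≤n)))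
      (range-≼ʳ {a} U (suc k) p λ i k<i i< → a≼U i (ℕ.<⇒≤ k<i) (subst (i ℕ.<_) (sym (ℕ.+-suc k p)) i<))

    range-≼ˡ : ∀ {a} U k p → (∀ i → k ℕ.≤ i → i ℕ.< k ℕ.+ p → U i ≼ a) → range U k p ≼ a
    range-≼ˡ {a} U k zero    U≼a = ≼-0ˡ a
    range-≼ˡ {a} U k (suc p) U≼a = ≼-+ˡ {U k} {range U (suc k) p} {a}
      (U≼a k ℕ.≤-refl (ℕ.m<m+n k (s≤s z≤n)))
      (range-≼ˡ {a} U (suc k) p λ i k<i i< → U≼a i (ℕ.<⇒≤ k<i) (subst (i ℕ.<_) (sym (ℕ.+-suc k p)) i<))

    -- All pairs are compared and not only neighbours, because `≼` is not transitive in general: 0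
    -- is related to everything in both directions.
    Ascending : ℕ → (ℕ → ℚ[i]) → Set
    Ascending N U = ∀ i j → i ℕ.≤ j → j ℕ.< N → U i ≼ U j

    -- Extend U by U (N + i) = z U i.  Then (1 − z) V k is the sum of U over the period starting
    -- at k.  Cutting a period into blocks a, b, c, the periods starting with b and with c have
    -- the sums b + e and e + z b, where e = c + z a.
    module Integral (N : ℕ) (U V : ℕ → ℚ[i]) (V-step : ∀ k → k ℕ.< N → V k ≡ V (suc k) + U k)
                    (V-period : V N ≡ z * V 0) where
      open ℚ[i]-Solver using (solve; _:=_; _:+_; _:*_; _:-_; con)

      V-range : ∀ k p → k ℕ.+ p ℕ.≤ N → V k ≡ V (k ℕ.+ p) + range U k p
      V-range k zero    k+p≤N = trans (cong V (sym (ℕ.+-identityʳ k))) (sym (+-identityʳ _))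
      V-range k (suc p) k+p≤N = begin
        V k                                                ≡⟨ V-step k (ℕ.≤-trans (ℕ.m<m+n k (s≤s z≤n)) k+p≤N) ⟩
        V (suc k) + U k                                    ≡⟨ cong (_+ U k) (V-range (suc k) p (subst (ℕ._≤ N) (ℕ.+-suc k p) k+p≤N)) ⟩
        V (suc k ℕ.+ p) + range U (suc k) p + U k          ≡⟨ solve 3 (λ a b c → a :+ b :+ c := a :+ (c :+ b)) refl (V (suc k ℕ.+ p)) (range U (suc k) p) (U k) ⟩
        V (suc k ℕ.+ p) + range U k (suc p)                ≡⟨ cong (λ n → V n + range U k (suc p)) (sym (ℕ.+-suc k p)) ⟩
        V (k ℕ.+ suc p) + range U k (suc p)                ∎
        where open ≡-Reasoning

      V₀ : (1# - z) * V 0 ≡ range U 0 N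
      V₀ = trans
        (solve 2 (λ z v → (con 1# :- z) :* v := v :- z :* v) refl z (V 0))
        (trans (cong₂ _-_ (V-range 0 N ℕ.≤-refl) (sym V-period))
          (solve 2 (λ a b → a :+ b :- a := b) refl (V N) (range U 0 N)))

      integral-ascending : 0ℚ ℚ.< ∣ 1# - z ∣² → Ascending N U → Ascending (suc N) V
      integral-ascending 0<1-z asc i j i≤j (s≤s j≤N) =
        subst (λ l → V i ≼ V l) (ℕ.m+[n∸m]≡n i≤j)
          (main i (j ∸ i) (N ∸ j) (trans (cong (ℕ._+ (N ∸ j)) (ℕ.m+[n∸m]≡n i≤j)) (ℕ.m+[n∸m]≡n j≤N)))
        where
        main : ∀ k p q → (k ℕ.+ p) ℕ.+ q ≡ N → V k ≼ V (k ℕ.+ p)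
        main k p q kpq = ≼-cancel (1# - z) 0<1-z
          (subst₂ _≼_ (sym eqᵏ) (sym eqˡ) (≼-sum {b} {e} (≼-+ʳ {b} {c} {z * a} b≼c (≼-rotate {a} {b} a≼b))))
          where
          l = k ℕ.+ p
          a = range U 0 k
          b = range U k p
          c = range U l q
          e = c + z * a
          l≤N : l ℕ.≤ N
          l≤N = subst (l ℕ.≤_) kpq (ℕ.m≤m+n l q)
          a≼b : a ≼ b
          a≼b = range-≼ˡ {b} U 0 k λ i _ i<k → range-≼ʳ {U i} U k p λ j k≤j j<l →
            asc i j (ℕ.≤-trans (ℕ.<⇒≤ i<k) k≤j) (ℕ.≤-trans j<l l≤N)
          b≼c : b ≼ c
          b≼c = range-≼ˡ {c} U k p λ i _ i<l → range-≼ʳ {U i} U l q λ j l≤j j<N →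
            asc i j (ℕ.≤-trans (ℕ.<⇒≤ i<l) l≤j) (subst (j ℕ.<_) kpq j<N)
          v≡ : V k ≡ V l + b
          v≡ = V-range k p l≤N
          -- From l the period runs through c to N, where V N = z V 0 starts it again, and from 0
          -- through a to k.
          w≡ : V l ≡ z * (V k + a) + c
          w≡ = trans (V-range l q (ℕ.≤-reflexive kpq)) (cong (_+ c) (trans (cong V kpq) (trans V-period
            (cong (z *_) (V-range 0 k (ℕ.≤-trans (ℕ.m≤m+n k p) l≤N))))))
          eqᵏ : (1# - z) * V k ≡ b + e
          eqᵏ = trans (solve 2 (λ z v → (con 1# :- z) :* v := v :- z :* v) refl z (V k))
            (trans (cong (_- z * V k) (trans v≡ (cong (_+ b) w≡)))
              (solve 5 (λ z v a b c → z :* (v :+ a) :+ c :+ b :- z :* v := b :+ (c :+ z :* a)) refl z (V k) a b c))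
          eqˡ : (1# - z) * V l ≡ e + z * b
          eqˡ = trans (solve 2 (λ z v → (con 1# :- z) :* v := v :- z :* v) refl z (V l))
            (trans (cong (_- z * V l) (trans w≡ (cong (λ v → z * (v + a) + c) v≡)))
              (solve 5 (λ z w a b c → z :* (w :+ b :+ a) :+ c :- z :* w := c :+ z :* a :+ z :* b) refl z (V l) a b c))

      -- (1 - z) V 0 is the sum of U over one period. In its area with z U 0 the first term
      -- contributes ℑ z ∣U 0∣², and the later ones, which follow U 0 in the order, contribute
      -- nothing negative.
      ∣V₀∣²-bound : Ascending N U → 0 ℕ.< N → 0ℚ ℚ.< ∣ U 0 ∣² →
        (ℑ z ℚ.* ℑ z) ℚ.* ∣ U 0 ∣² ℚ.≤ ∣ 1# - z ∣² ℚ.* ∣ V 0 ∣² ℚ.* ∣ z ∣²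
      ∣V₀∣²-bound asc 0<N 0<U₀ = subst (λ r → _ ℚ.≤ r ℚ.* ∣ z ∣²)
        (trans (cong ∣_∣² (sym V₀)) (∣∣²-* (1# - z) (V 0)))
        (∣∣²-from-area (range U 0 N) z (U 0) 0≤ℑz 0<U₀ (bound N 0<N asc))
        where
        bound : ∀ N → 0 ℕ.< N → Ascending N U → ℑ z ℚ.* ∣ U 0 ∣² ℚ.≤ area (range U 0 N) (z * U 0)
        bound (suc M) _ asc = subst₂ ℚ._≤_ (trans (ℚ.+-identityʳ _) (area-rotate z (U 0)))
          (sym (area-+ˡ (U 0) (range U 1 M) (z * U 0)))
          (ℚ.+-monoʳ-≤ (area (U 0) (z * U 0)) (proj₂ (range-≼ʳ {U 0} U 1 M λ j _ j< → asc 0 j z≤n j<)))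

open Interlacing

-- The two families of series and their common order

module InterlacingFamilies where
  open Counting using (∏)

  private
    -- `ℚ._/_` cancels common factors, so the computation goes through unnormalised rationals.
    /1-+ : ∀ i j → (i ℤ.+ j) ℚ./ 1 ≡ (i ℚ./ 1) ℚ.+ (j ℚ./ 1)
    /1-+ i j = ℚ.toℚᵘ-injective (begin
      ℚ.toℚᵘ ((i ℤ.+ j) ℚ./ 1)                     ≈⟨ ℚ.toℚᵘ-fromℚᵘ (ℚᵘ.mkℚᵘ (i ℤ.+ j) 0) ⟩
      ℚᵘ.mkℚᵘ (i ℤ.+ j) 0                          ≈⟨ ℚᵘ.*≡* (cong (ℤ._* ℤ.+ 1) (sym (cong₂ ℤ._+_ (ℤ.*-identityʳ i) (ℤ.*-identityʳ j)))) ⟩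
      ℚᵘ.mkℚᵘ i 0 ℚᵘ.+ ℚᵘ.mkℚᵘ j 0                 ≈⟨ ℚᵘ.+-cong (ℚ.toℚᵘ-fromℚᵘ (ℚᵘ.mkℚᵘ i 0)) (ℚ.toℚᵘ-fromℚᵘ (ℚᵘ.mkℚᵘ j 0)) ⟨
      ℚ.toℚᵘ (i ℚ./ 1) ℚᵘ.+ ℚ.toℚᵘ (j ℚ./ 1)       ≈⟨ ℚ.toℚᵘ-homo-+ (i ℚ./ 1) (j ℚ./ 1) ⟨
      ℚ.toℚᵘ ((i ℚ./ 1) ℚ.+ (j ℚ./ 1))                 ∎)
      where open import Relation.Binary.Reasoning.Setoid ℚᵘ.≃-setoid

    /1-* : ∀ i j → (i ℤ.* j) ℚ./ 1 ≡ (i ℚ./ 1) ℚ.* (j ℚ./ 1)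
    /1-* i j = ℚ.toℚᵘ-injective (begin
      ℚ.toℚᵘ ((i ℤ.* j) ℚ./ 1)                     ≈⟨ ℚ.toℚᵘ-fromℚᵘ (ℚᵘ.mkℚᵘ (i ℤ.* j) 0) ⟩
      ℚᵘ.mkℚᵘ i 0 ℚᵘ.* ℚᵘ.mkℚᵘ j 0                 ≈⟨ ℚᵘ.*-cong (ℚ.toℚᵘ-fromℚᵘ (ℚᵘ.mkℚᵘ i 0)) (ℚ.toℚᵘ-fromℚᵘ (ℚᵘ.mkℚᵘ j 0)) ⟨
      ℚ.toℚᵘ (i ℚ./ 1) ℚᵘ.* ℚ.toℚᵘ (j ℚ./ 1)       ≈⟨ ℚ.toℚᵘ-homo-* (i ℚ./ 1) (j ℚ./ 1) ⟨
      ℚ.toℚᵘ ((i ℚ./ 1) ℚ.* (j ℚ./ 1))                 ∎)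
      where open import Relation.Binary.Reasoning.Setoid ℚᵘ.≃-setoid

  κ : ℤ → ℚ[i]
  κ i = (i ℚ./ 1) +i 0ℚ

  κ-+ : ∀ i j → κ (i ℤ.+ j) ≡ κ i + κ j
  κ-+ i j = cong₂ _+i_ (/1-+ i j) refl

  κ-* : ∀ i j → κ (i ℤ.* j) ≡ κ i * κ j
  κ-* i j = cong₂ _+i_
    (trans (/1-* i j) (solve 2 (λ a b → a :* b := a :* b :- con 0ℚ :* con 0ℚ) refl (i ℚ./ 1) (j ℚ./ 1)))
    (solve 2 (λ a b → con 0ℚ := a :* con 0ℚ :+ con 0ℚ :* b) refl (i ℚ./ 1) (j ℚ./ 1))
    where open ℚ-Solver

  ι : ℕ → ℚ[i]
  ι n = κ (ℤ.+ n)

  ι-+ : ∀ m n → ι (m ℕ.+ n) ≡ ι m + ι n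
  ι-+ m n = κ-+ (ℤ.+ m) (ℤ.+ n)

  ι-* : ∀ m n → ι (m ℕ.* n) ≡ ι m * ι n
  ι-* m n = trans (cong κ (ℤ.pos-* m n)) (κ-* (ℤ.+ m) (ℤ.+ n))

  ι-∏ : ∀ u v d ℓ → ι (∏ u v d ℓ) ≡ ∏ᴷ (ι u) (ι v) d ℓ
  ι-∏ u v zero    ℓ       = refl
  ι-∏ u v (suc d) zero    = trans (ι-* u _) (cong (ι u *_) (ι-∏ u v d zero))
  ι-∏ u v (suc d) (suc ℓ) = trans (ι-* v _) (cong (ι v *_) (ι-∏ u v d ℓ))

  join : ℕ → (ℕ → ℚ[i]) → (ℕ → ℚ[i]) → ℕ → ℚ[i]
  join zero    f g k       = g k
  join (suc n) f g zero    = f 0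
  join (suc n) f g (suc k) = join n (f ∘ suc) g k

  join-< : ∀ n f g {k} → k ℕ.< n → join n f g k ≡ f k
  join-< (suc n) f g {zero}  _         = refl
  join-< (suc n) f g {suc k} (s≤s k<n) = join-< n (f ∘ suc) g k<n

  join-+ : ∀ n f g k → join n f g (n ℕ.+ k) ≡ g k
  join-+ zero    f g k = refl
  join-+ (suc n) f g k = join-+ n (f ∘ suc) g k

  data Side (n : ℕ) : ℕ → Set where
    left  : ∀ {k} → k ℕ.< n → Side n k
    right : ∀ k → Side n (n ℕ.+ k)

  side : ∀ n k → Side n k
  side zero    k    = right k
  side (suc n) zero = left (s≤s z≤n)
  side (suc n) (suc k) with side n k
  ... | left k<n = left (s≤s k<n)
  ... | right j  = right j

  -- The second family of series runs over m ≥ 1 and is shifted to start at 0, so its pair 2m - 1,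
  -- 2m becomes `t₁`, `t₂`.
  s₁ t₁ t₂ : ℕ → ℚ[i]
  s₁ m = ι (2 ℕ.* m)
  t₁ m = ι (1 ℕ.+ 2 ℕ.* m)
  t₂ m = ι (2 ℕ.+ 2 ℕ.* m)

  t₁≡s₁+1 : ∀ m → t₁ m ≡ s₁ m + 1#
  t₁≡s₁+1 m = trans (cong ι (ℕ.+-comm 1 (2 ℕ.* m))) (ι-+ (2 ℕ.* m) 1)

  t₂≡t₁+1 : ∀ m → t₂ m ≡ t₁ m + 1#
  t₂≡t₁+1 m = trans (cong ι (ℕ.+-comm 1 (1 ℕ.+ 2 ℕ.* m))) (ι-+ (1 ℕ.+ 2 ℕ.* m) 1)

  s₁∘suc : ∀ m → s₁ (suc m) ≡ t₂ m
  s₁∘suc m = cong ι (ℕ.*-suc 2 m)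

  affine-s₁ : Affine s₁
  affine-s₁ = ι 2 , λ m → trans (s₁∘suc m) (trans (cong ι (ℕ.+-comm 2 (2 ℕ.* m))) (ι-+ (2 ℕ.* m) 2))

  affine-t₁ : Affine t₁
  affine-t₁ = ι 2 , λ m → trans (cong (λ n → ι (suc n)) (trans (ℕ.*-suc 2 m) (ℕ.+-comm 2 (2 ℕ.* m)))) (ι-+ (1 ℕ.+ 2 ℕ.* m) 2)

  module C₁ = Consecutive s₁ t₁ t₁≡s₁+1
  module C₂ = Consecutive t₁ t₂ t₂≡t₁+1

  module _ (s t : ℕ → ℚ[i]) (t≡s+1 : ∀ m → t m ≡ s m + 1#) (affine-s : Affine s) where
    open Consecutive s t t≡s+1
    monomial-degree′ : ∀ {n i} → i ℕ.≤ n → Degree< (suc n) (monomial i (n ∸ i))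
    monomial-degree′ {n} {i} i≤n = subst (λ N → Degree< (suc N) (monomial i (n ∸ i))) (ℕ.m+[n∸m]≡n i≤n)
      (monomial-degree affine-s i (n ∸ i))

    Cone-degree : ∀ {n g} → Cone n g → Degree< (suc n) g
    Cone-degree (gen i≤n) = monomial-degree′ i≤n
    Cone-degree {n} null = Degree<-0 (suc n)
    Cone-degree {n} (_⊕_ {f} {g} F G) = Degree<-+ (suc n) f g (Cone-degree F) (Cone-degree G)
    Cone-degree {n} (resp f≗g F) = Degree<-resp (suc n) f≗g (Cone-degree F)

    module _ (y : ℚ[i]) where
      open Newton y
      -- `monomial-step` under `newton`; the last monomial has only degree n, so one term less
      -- suffices for it.
      newton-step : ∀ {n i} → i ℕ.≤ n → ∀ c → c * newton (suc (suc n)) (monomial i (suc n ∸ i)) ≡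
        c * newton (suc (suc n)) (monomial (suc i) (n ∸ i)) + c * newton (suc n) (monomial i (n ∸ i))
      newton-step {n} {i} i≤n c = begin
        c * newton (suc (suc n)) (monomial i (suc n ∸ i))
          ≡⟨ cong (c *_) (trans (newton-cong (suc (suc n)) λ m →
               trans (cong (λ j → monomial i j m) (ℕ.+-∸-assoc 1 i≤n)) (monomial-step i (n ∸ i) m))
               (newton-+ (suc (suc n)) (monomial (suc i) (n ∸ i)) (monomial i (n ∸ i)))) ⟩
        c * (newton (suc (suc n)) (monomial (suc i) (n ∸ i)) + newton (suc (suc n)) (monomial i (n ∸ i)))
          ≡⟨ distribˡ c (newton (suc (suc n)) (monomial (suc i) (n ∸ i))) (newton (suc (suc n)) (monomial i (n ∸ i))) ⟩
        c * newton (suc (suc n)) (monomial (suc i) (n ∸ i)) + c * newton (suc (suc n)) (monomial i (n ∸ i))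
          ≡⟨ cong (λ a → c * newton (suc (suc n)) (monomial (suc i) (n ∸ i)) + c * a)
               (newton-suc (suc n) (monomial i (n ∸ i)) (monomial-degree′ i≤n)) ⟩
        c * newton (suc (suc n)) (monomial (suc i) (n ∸ i)) + c * newton (suc n) (monomial i (n ∸ i)) ∎
        where open ≡-Reasoning

  module Ladder (z : ℚ[i]) (P Q : ℕ → ℕ → ℚ[i])
    (P-step : ∀ {n i} → i ℕ.≤ n → P (suc n) i ≡ P (suc n) (suc i) + P n i)
    (Q-step : ∀ {n i} → i ℕ.≤ n → Q (suc n) i ≡ Q (suc n) (suc i) + Q n i)
    (P-last : ∀ n → P (suc n) (suc n) ≡ Q (suc n) 0)
    (Q-last : ∀ n → Q n n ≡ z * P n 0)
    (0≤ℑz : 0ℚ ℚ.≤ ℑ z) (0<1-z : 0ℚ ℚ.< ∣ 1# - z ∣²) where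

    -- U n runs through P n 0, …, P n n, Q n 0, …, Q n n, and V n through the same list for n + 1,
    -- in which the two equal neighbours P (n + 1) (n + 1) and Q (n + 1) 0 are identified.
    U V : ℕ → ℕ → ℚ[i]
    U n = join (suc n) (P n) (Q n)
    V n = join (suc n) (P (suc n)) (Q (suc n))

    V-P : ∀ n {k} → k ℕ.≤ suc n → V n k ≡ P (suc n) k
    V-P n {k} k≤1+n with ℕ.m≤n⇒m<n∨m≡n k≤1+n
    ... | inj₁ k<1+n = join-< (suc n) (P (suc n)) (Q (suc n)) k<1+n
    ... | inj₂ refl  = trans (cong (V n) (sym (ℕ.+-identityʳ (suc n))))
      (trans (join-+ (suc n) (P (suc n)) (Q (suc n)) 0) (sym (P-last n)))

    V-Q : ∀ n k → V n (suc n ℕ.+ k) ≡ Q (suc n) k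
    V-Q n k = join-+ (suc n) (P (suc n)) (Q (suc n)) k

    V-step : ∀ n k → k ℕ.< suc n ℕ.+ suc n → V n k ≡ V n (suc k) + U n k
    V-step n k k< with side (suc n) k
    ... | left k<1+n = begin
      V n k                         ≡⟨ V-P n (ℕ.<⇒≤ k<1+n) ⟩
      P (suc n) k                   ≡⟨ P-step (ℕ.≤-pred k<1+n) ⟩
      P (suc n) (suc k) + P n k     ≡⟨ cong₂ _+_ (sym (V-P n k<1+n)) (sym (join-< (suc n) (P n) (Q n) k<1+n)) ⟩
      V n (suc k) + U n k           ∎
      where open ≡-Reasoning
    ... | right j = begin
      V n (suc n ℕ.+ j)                                     ≡⟨ V-Q n j ⟩
      Q (suc n) j                                           ≡⟨ Q-step (ℕ.≤-pred (ℕ.+-cancelˡ-< (suc n) j (suc n) k<)) ⟩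
      Q (suc n) (suc j) + Q n j                             ≡⟨ cong₂ _+_ (sym (V-Q n (suc j))) (sym (join-+ (suc n) (P n) (Q n) j)) ⟩
      V n (suc n ℕ.+ suc j) + U n (suc n ℕ.+ j)             ≡⟨ cong (λ k → V n k + U n (suc n ℕ.+ j)) (ℕ.+-suc (suc n) j) ⟩
      V n (suc (suc n ℕ.+ j)) + U n (suc n ℕ.+ j)           ∎
      where open ≡-Reasoning

    V-period : ∀ n → V n (suc n ℕ.+ suc n) ≡ z * V n 0
    V-period n = trans (V-Q n (suc n)) (trans (Q-last (suc n)) (cong (z *_) (sym (V-P n {0} z≤n))))

    open Arc z 0≤ℑz

    -- Induction on the degree: the differences of the list for n + 1 are the list for n, and its
    -- last value is z times its first, so `integral-ascending` applies. The list for 0 is u, z u.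
    U-ascending : ∀ n → Ascending (suc n ℕ.+ suc n) (U n)
    U-ascending zero i j i≤j j<2 = base i j i≤j j<2
      where
      u₀ = U 0 0
      u₁≡ : U 0 1 ≡ z * u₀
      u₁≡ = Q-last 0
      base : ∀ i j → i ℕ.≤ j → j ℕ.< 2 → U 0 i ≼ U 0 j
      base zero zero _ _ = ≼-refl u₀
      base zero (suc zero) _ _ = subst (u₀ ≼_) (sym u₁≡) (≼-rotate {u₀} {u₀} (≼-refl u₀))
      base (suc zero) (suc zero) _ _ = ≼-refl (U 0 1)
      base (suc zero) (suc (suc j)) _ (s≤s (s≤s ()))
      base zero (suc (suc j)) _ (s≤s (s≤s ()))
      base (suc (suc i)) zero () _
      base (suc (suc i)) (suc zero) (s≤s ()) _
      base (suc (suc i)) (suc (suc j)) _ (s≤s (s≤s ()))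
    U-ascending (suc n) = reindex
      (Integral.integral-ascending _ (U n) (V n) (V-step n) (V-period n) 0<1-z (U-ascending n))
      where
      N = suc n
      V≡Uˡ : ∀ {k} → k ℕ.< suc N → V n k ≡ U N k
      V≡Uˡ k< = trans (V-P n (ℕ.≤-pred k<)) (sym (join-< (suc N) (P N) (Q N) k<))
      V≡Uʳ : ∀ k → V n (N ℕ.+ k) ≡ U N (suc N ℕ.+ k)
      V≡Uʳ k = trans (V-Q n k) (sym (join-+ (suc N) (P N) (Q N) k))
      boundʳ : ∀ k → suc N ℕ.+ k ℕ.< suc N ℕ.+ suc N → N ℕ.+ k ℕ.< suc (N ℕ.+ N)
      boundʳ k k< = ℕ.≤-trans (ℕ.+-monoʳ-< N (ℕ.+-cancelˡ-< (suc N) k (suc N) k<)) (ℕ.≤-reflexive (ℕ.+-suc N N))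
      -- The value where the two families meet occurs once in V and twice in U, so positions in the
      -- second half shift by one.
      reindex : Ascending (suc (N ℕ.+ N)) (V n) → Ascending (suc N ℕ.+ suc N) (U N)
      reindex asc i j i≤j j< with side (suc N) i | side (suc N) j
      ... | left i≤N | left j≤N = subst₂ _≼_ (V≡Uˡ i≤N) (V≡Uˡ j≤N)
        (asc i j i≤j (ℕ.≤-trans j≤N (s≤s (ℕ.m≤m+n N N))))
      ... | left i≤N | right l  = subst₂ _≼_ (V≡Uˡ i≤N) (V≡Uʳ l)
        (asc i (N ℕ.+ l) (ℕ.≤-trans (ℕ.≤-pred i≤N) (ℕ.m≤m+n N l)) (boundʳ l j<))
      ... | right k  | left j≤N = contradiction (ℕ.≤-trans (ℕ.m≤m+n (suc N) k) i≤j) (ℕ.<⇒≱ j≤N)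
      ... | right k  | right l  = subst₂ _≼_ (V≡Uʳ k) (V≡Uʳ l)
        (asc (N ℕ.+ k) (N ℕ.+ l) (ℕ.+-monoʳ-≤ N (ℕ.+-cancelˡ-≤ (suc N) k l i≤j)) (boundʳ l j<))

    P₀≼P : ∀ {n i} → i ℕ.≤ n → P n 0 ≼ P n i
    P₀≼P {n} {i} i≤n = subst (P n 0 ≼_) (join-< (suc n) (P n) (Q n) (s≤s i≤n))
      (U-ascending n 0 i z≤n (ℕ.≤-trans (s≤s i≤n) (ℕ.m≤m+n (suc n) (suc n))))

    P₀≼Q : ∀ {n i} → i ℕ.≤ n → P n 0 ≼ Q n i
    P₀≼Q {n} {i} i≤n = subst (P n 0 ≼_) (join-+ (suc n) (P n) (Q n) i)
      (U-ascending n 0 (suc n ℕ.+ i) z≤n (ℕ.+-monoʳ-< (suc n) (s≤s i≤n)))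

    ∣P₀∣²-bound : ∀ n → 0ℚ ℚ.< ∣ P n 0 ∣² →
      (ℑ z ℚ.* ℑ z) ℚ.* ∣ P n 0 ∣² ℚ.≤ ∣ 1# - z ∣² ℚ.* ∣ P (suc n) 0 ∣² ℚ.* ∣ z ∣²
    ∣P₀∣²-bound n = Integral.∣V₀∣²-bound _ (U n) (V n) (V-step n) (V-period n) (U-ascending n) (s≤s z≤n)

  module Families (z w : ℚ[i]) (w-inv : w * (1# - z) ≡ 1#) where

    y : ℚ[i]
    y = z * w

    1+y≡w : 1# + y ≡ w
    1+y≡w = trans (cong (_+ z * w) (sym w-inv))
      (solve 2 (λ z w → w :* (con 1# :- z) :+ z :* w := w) refl z w)
      where open ℚ[i]-Solver using (solve; _:=_; _:+_; _:*_; _:-_; con)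

    open Newton y

    -- As power series, P n i = Σ_{m≥0} (2m)ⁱ(2m+1)ⁿ⁻ⁱ zᵐ and Q n i = Σ_{m≥1} (2m−1)ⁱ(2m)ⁿ⁻ⁱ zᵐ.
    P Q : ℕ → ℕ → ℚ[i]
    P n i = w * newton (suc n) (C₁.monomial i (n ∸ i))
    Q n i = y * newton (suc n) (C₂.monomial i (n ∸ i))

    P-step : ∀ {n i} → i ℕ.≤ n → P (suc n) i ≡ P (suc n) (suc i) + P n i
    P-step i≤n = newton-step s₁ t₁ t₁≡s₁+1 affine-s₁ y i≤n w

    Q-step : ∀ {n i} → i ℕ.≤ n → Q (suc n) i ≡ Q (suc n) (suc i) + Q n i
    Q-step i≤n = newton-step t₁ t₂ t₂≡t₁+1 affine-t₁ y i≤n y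

    w*newton : ∀ D g → Degree< D g → w * newton D g ≡ g 0 + y * newton D (g ∘ suc)
    w*newton D g gₛ = trans (cong (_* newton D g) (sym 1+y≡w)) (sym (newton-shift D g gₛ))

    -- The term m = 0 of the series with coefficients (2m)ⁿ⁺¹ vanishes, and the rest is the first
    -- series of the second family. The exponent has to be positive, since 0⁰ = 1.
    P-last : ∀ n → P (suc n) (suc n) ≡ Q (suc n) 0
    P-last n = begin
      w * newton (suc (suc n)) g
        ≡⟨ w*newton (suc (suc n)) g (monomial-degree′ s₁ t₁ t₁≡s₁+1 affine-s₁ {suc n} {suc n} ℕ.≤-refl) ⟩
      g 0 + y * newton (suc (suc n)) (g ∘ suc)
        ≡⟨ cong₂ (λ a b → a + y * b) g₀ (newton-cong (suc (suc n)) λ m → trans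
             (cong₂ (λ a j → a ^ suc n * t₁ (suc m) ^ j) (s₁∘suc m) (ℕ.n∸n≡0 n))
             (trans (*-identityʳ (t₂ m ^ suc n)) (sym (*-identityˡ (t₂ m ^ suc n))))) ⟩
      0# + y * newton (suc (suc n)) (C₂.monomial 0 (suc n))
        ≡⟨ +-identityˡ (Q (suc n) 0) ⟩
      Q (suc n) 0 ∎
      where
      open ≡-Reasoning
      g = C₁.monomial (suc n) (suc n ∸ suc n)
      g₀ : g 0 ≡ 0#
      g₀ = trans (cong (_* t₁ 0 ^ (n ∸ n)) (zeroˡ (s₁ 0 ^ n))) (zeroˡ (t₁ 0 ^ (n ∸ n)))

    -- Σ_{m≥1} (2m - 1)ⁿ zᵐ is z times Σ_{m≥0} (2m + 1)ⁿ zᵐ.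
    Q-last : ∀ n → Q n n ≡ z * P n 0
    Q-last n = trans (cong (y *_) (newton-cong (suc n) λ m → trans
        (cong (λ j → t₁ m ^ n * t₂ m ^ j) (ℕ.n∸n≡0 n))
        (trans (*-identityʳ (t₁ m ^ n)) (sym (*-identityˡ (t₁ m ^ n))))))
      (*-assoc z w (newton (suc n) (C₁.monomial 0 n)))

    module _ (0≤ℑz : 0ℚ ℚ.≤ ℑ z) (0<1-z : 0ℚ ℚ.< ∣ 1# - z ∣²) where
      open Arc z 0≤ℑz
      open Ladder z P Q P-step Q-step P-last Q-last 0≤ℑz 0<1-z public using (P₀≼P; P₀≼Q; ∣P₀∣²-bound)

      module _ (s t : ℕ → ℚ[i]) (t≡s+1 : ∀ m → t m ≡ s m + 1#) (c a : ℚ[i]) where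
        open Consecutive s t t≡s+1
        -- The values that follow a include 0 and are closed under addition, so the generators
        -- decide.
        Cone-≼ : ∀ {n g} → (∀ {i} → i ℕ.≤ n → a ≼ c * newton (suc n) (monomial i (n ∸ i))) →
          Cone n g → a ≼ c * newton (suc n) g
        Cone-≼ a≼ (gen i≤n) = a≼ i≤n
        Cone-≼ {n} a≼ null = subst (a ≼_) (sym (trans (cong (c *_) (newton-0 (suc n))) (zeroʳ c))) (≼-0ʳ a)
        Cone-≼ {n} a≼ (_⊕_ {f} {g} F G) = subst (a ≼_)
          (sym (trans (cong (c *_) (newton-+ (suc n) f g)) (distribˡ c (newton (suc n) f) (newton (suc n) g))))
          (≼-+ʳ {a} {c * newton (suc n) f} {c * newton (suc n) g} (Cone-≼ a≼ F) (Cone-≼ a≼ G))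
        Cone-≼ {n} a≼ (resp f≗g F) = subst (λ b → a ≼ c * b) (newton-cong (suc n) f≗g) (Cone-≼ a≼ F)

open InterlacingFamilies

-- Uniform lower bounds in the upper half-plane

module LowerBound where
  open Counting using (∏)

  Degree<-shift : ∀ D g → Degree< D g → Degree< D (g ∘ suc)
  Degree<-shift zero    g g₀ m = g₀ (suc m)
  Degree<-shift (suc D) g gₛ   = Degree<-shift D (Δ g) gₛ

  -- T k is the number of multichains with k + 1 members.
  module Decomposition (n ℓ : ℕ) (T : ℕ → ℕ)
    (T-eq : ∀ k → T k ℕ.+ ∏ (1 ℕ.+ 2 ℕ.* k) (3 ℕ.+ 4 ℕ.* k) (suc n) ℓ ≡ ∏ (3 ℕ.+ 2 ℕ.* k) (5 ℕ.+ 4 ℕ.* k) (suc n) ℓ) where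

    private
      upper = C₁.telescope⁺ n ℓ
      lower = C₂.telescope₂ n ℓ
      X₁ X X₂ : ℕ → ℚ[i]
      X₁ = proj₁ upper
      X  = proj₁ (proj₁ (proj₂ upper))
      X₂ = proj₁ lower
      X∈Cone : C₁.Cone n X
      X∈Cone = proj₁ (proj₂ (proj₁ (proj₂ upper)))
      X₁≡ : ∀ m → X₁ m ≡ C₁.monomial 0 n m + X m
      X₁≡ = proj₂ (proj₂ (proj₁ (proj₂ upper)))
      X₂∈Cone : C₂.Cone n X₂
      X₂∈Cone = proj₁ (proj₂ lower)

    -- For m = k + 1 members, the first telescoping at m ends with the factors 2m and 4m, where the
    -- second one, indexed by k = m - 1, begins.
    ιT≡ : ∀ k → ι (T k) ≡ X₁ (suc k) + X₂ k
    ιT≡ k = begin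
      ι (T k)
        ≡⟨ ℚ[i]-Solver.solve 2 (λ a b → a := a :+ b :- b) refl (ι (T k)) (ι (∏ (1 ℕ.+ 2 ℕ.* k) (3 ℕ.+ 4 ℕ.* k) (suc n) ℓ)) ⟩
      ι (T k) + ι (∏ (1 ℕ.+ 2 ℕ.* k) (3 ℕ.+ 4 ℕ.* k) (suc n) ℓ) - ι (∏ (1 ℕ.+ 2 ℕ.* k) (3 ℕ.+ 4 ℕ.* k) (suc n) ℓ)
        ≡⟨ cong₂ _-_ (trans (sym (ι-+ (T k) _)) (cong ι (T-eq k))) (trans (ι-∏ (1 ℕ.+ 2 ℕ.* k) (3 ℕ.+ 4 ℕ.* k) (suc n) ℓ)
             (cong (λ v → ∏ᴷ (t₁ k) v (suc n) ℓ) t₁+t₂)) ⟩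
      ι (∏ (3 ℕ.+ 2 ℕ.* k) (5 ℕ.+ 4 ℕ.* k) (suc n) ℓ) - ∏ᴷ (t₁ k) (t₁ k + t₂ k) (suc n) ℓ
        ≡⟨ cong (_- ∏ᴷ (t₁ k) (t₁ k + t₂ k) (suc n) ℓ) (begin
             ι (∏ (3 ℕ.+ 2 ℕ.* k) (5 ℕ.+ 4 ℕ.* k) (suc n) ℓ)
               ≡⟨ ι-∏ (3 ℕ.+ 2 ℕ.* k) (5 ℕ.+ 4 ℕ.* k) (suc n) ℓ ⟩
             ∏ᴷ (ι (3 ℕ.+ 2 ℕ.* k)) (ι (5 ℕ.+ 4 ℕ.* k)) (suc n) ℓ
               ≡⟨ cong₂ (λ u v → ∏ᴷ u v (suc n) ℓ) t₁-suc s₁+t₁ ⟩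
             ∏ᴷ (t₁ (suc k)) (s₁ (suc k) + t₁ (suc k)) (suc n) ℓ
               ≡⟨ proj₂ (proj₂ upper) (suc k) ⟩
             ∏ᴷ (s₁ (suc k)) (s₁ (suc k) + s₁ (suc k)) (suc n) ℓ + X₁ (suc k)
               ≡⟨ cong (_+ X₁ (suc k)) (trans (cong (λ a → ∏ᴷ a (a + a) (suc n) ℓ) (s₁∘suc k)) (proj₂ (proj₂ lower) k)) ⟩
             ∏ᴷ (t₁ k) (t₁ k + t₂ k) (suc n) ℓ + X₂ k + X₁ (suc k) ∎) ⟩
      ∏ᴷ (t₁ k) (t₁ k + t₂ k) (suc n) ℓ + X₂ k + X₁ (suc k) - ∏ᴷ (t₁ k) (t₁ k + t₂ k) (suc n) ℓ
        ≡⟨ ℚ[i]-Solver.solve 3 (λ b x₂ x₁ → b :+ x₂ :+ x₁ :- b := x₁ :+ x₂) refl (∏ᴷ (t₁ k) (t₁ k + t₂ k) (suc n) ℓ) (X₂ k) (X₁ (suc k)) ⟩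
      X₁ (suc k) + X₂ k ∎
      where
      open ≡-Reasoning
      open ℚ[i]-Solver using (_:=_; _:+_; _:*_; _:-_)
      open ℕ-Solver using (con) renaming (solve to solveℕ; _:=_ to _≐_; _:+_ to _∔_; _:*_ to _∙_)
      t₁-suc : ι (3 ℕ.+ 2 ℕ.* k) ≡ t₁ (suc k)
      t₁-suc = cong ι (solveℕ 1 (λ k → con 3 ∔ con 2 ∙ k ≐ con 1 ∔ con 2 ∙ (con 1 ∔ k)) refl k)
      s₁+t₁ : ι (5 ℕ.+ 4 ℕ.* k) ≡ s₁ (suc k) + t₁ (suc k)
      s₁+t₁ = trans (cong ι (solveℕ 1 (λ k → con 5 ∔ con 4 ∙ k ≐ con 2 ∙ (con 1 ∔ k) ∔ (con 1 ∔ con 2 ∙ (con 1 ∔ k))) refl k))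
        (ι-+ (2 ℕ.* suc k) (1 ℕ.+ 2 ℕ.* suc k))
      t₁+t₂ : ι (3 ℕ.+ 4 ℕ.* k) ≡ t₁ k + t₂ k
      t₁+t₂ = trans (cong ι (solveℕ 1 (λ k → con 3 ∔ con 4 ∙ k ≐ (con 1 ∔ con 2 ∙ k) ∔ (con 2 ∔ con 2 ∙ k)) refl k))
        (ι-+ (1 ℕ.+ 2 ℕ.* k) (2 ℕ.+ 2 ℕ.* k))

    private
      X-degree : Degree< (suc n) X
      X-degree = Cone-degree s₁ t₁ t₁≡s₁+1 affine-s₁ X∈Cone

      X₁-degree : Degree< (suc n) X₁
      X₁-degree = Degree<-resp (suc n) (λ m → sym (X₁≡ m))
        (Degree<-+ (suc n) (C₁.monomial 0 n) X (C₁.monomial-degree affine-s₁ 0 n) X-degree)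

      -- At m = 0 the two products of the first telescoping are 1 and 0, the latter because there is
      -- at least one factor. This lets the 1 of the empty chain serve as the term m = 0 of the
      -- series.
      X₁-0 : X₁ 0 ≡ 1#
      X₁-0 = sym (begin
        1#                                                     ≡⟨ sym (∏ᴷ-1 (suc n) ℓ) ⟩
        ∏ᴷ 1# 1# (suc n) ℓ                                     ≡⟨ proj₂ (proj₂ upper) 0 ⟩
        ∏ᴷ 0# (0# + 0#) (suc n) ℓ + X₁ 0                       ≡⟨ cong (_+ X₁ 0) (∏ᴷ-0 ℓ) ⟩
        0# + X₁ 0                                              ≡⟨ +-identityˡ (X₁ 0) ⟩
        X₁ 0                                                   ∎)
        where
        open ≡-Reasoning
        ∏ᴷ-1 : ∀ d ℓ → ∏ᴷ 1# 1# d ℓ ≡ 1#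
        ∏ᴷ-1 zero    ℓ       = refl
        ∏ᴷ-1 (suc d) zero    = trans (*-identityˡ (∏ᴷ 1# 1# d zero)) (∏ᴷ-1 d zero)
        ∏ᴷ-1 (suc d) (suc ℓ) = trans (*-identityˡ (∏ᴷ 1# 1# d ℓ)) (∏ᴷ-1 d ℓ)
        ∏ᴷ-0 : ∀ ℓ → ∏ᴷ 0# (0# + 0#) (suc n) ℓ ≡ 0#
        ∏ᴷ-0 zero    = zeroˡ (∏ᴷ 0# (0# + 0#) n zero)
        ∏ᴷ-0 (suc ℓ) = zeroˡ (∏ᴷ 0# (0# + 0#) n ℓ)

    ιT-degree : Degree< (suc n) (ι ∘ T)
    ιT-degree = Degree<-resp (suc n) (λ k → sym (ιT≡ k))
      (Degree<-+ (suc n) (X₁ ∘ suc) X₂ (Degree<-shift (suc n) X₁ X₁-degree)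
        (Cone-degree t₁ t₂ t₂≡t₁+1 affine-t₁ X₂∈Cone))

    module _ (z w : ℚ[i]) (w-inv : w * (1# - z) ≡ 1#) where
      open Families z w w-inv
      open Newton y

      private
        rest : ℚ[i]
        rest = w * newton (suc n) X + y * newton (suc n) X₂

        f≡ : 1# + y * newton (suc n) (ι ∘ T) ≡ P n 0 + rest
        f≡ = begin
          1# + y * newton (suc n) (ι ∘ T)
            ≡⟨ cong (λ a → 1# + y * a) (trans (newton-cong (suc n) ιT≡) (newton-+ (suc n) (X₁ ∘ suc) X₂)) ⟩
          1# + y * (newton (suc n) (X₁ ∘ suc) + newton (suc n) X₂)
            ≡⟨ ℚ[i]-Solver.solve 4 (λ a y b c → a :+ y :* (b :+ c) := (a :+ y :* b) :+ y :* c) refl 1# y (newton (suc n) (X₁ ∘ suc)) (newton (suc n) X₂) ⟩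
          (1# + y * newton (suc n) (X₁ ∘ suc)) + y * newton (suc n) X₂
            ≡⟨ cong (λ a → (a + y * newton (suc n) (X₁ ∘ suc)) + y * newton (suc n) X₂) (sym X₁-0) ⟩
          (X₁ 0 + y * newton (suc n) (X₁ ∘ suc)) + y * newton (suc n) X₂
            ≡⟨ cong (_+ y * newton (suc n) X₂) (sym (w*newton (suc n) X₁ X₁-degree)) ⟩
          w * newton (suc n) X₁ + y * newton (suc n) X₂
            ≡⟨ cong (λ a → w * a + y * newton (suc n) X₂) (trans (newton-cong (suc n) X₁≡) (newton-+ (suc n) (C₁.monomial 0 n) X)) ⟩
          w * (newton (suc n) (C₁.monomial 0 n) + newton (suc n) X) + y * newton (suc n) X₂
            ≡⟨ ℚ[i]-Solver.solve 4 (λ w a b c → w :* (a :+ b) :+ c := w :* a :+ (w :* b :+ c)) refl w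
                 (newton (suc n) (C₁.monomial 0 n)) (newton (suc n) X) (y * newton (suc n) X₂) ⟩
          P n 0 + rest ∎
          where
          open ≡-Reasoning
          open ℚ[i]-Solver using (_:=_; _:+_; _:*_; _:-_)

      -- The copy of P n 0 set aside by `Cone⁺` has area ℑ z ∣P n 0∣² with z P n 0; `rest` follows P
      -- n 0 in the order and adds a nonnegative area.
      ∣f∣²-bound : 0ℚ ℚ.≤ ℑ z → 0ℚ ℚ.< ∣ 1# - z ∣² → 0ℚ ℚ.< ∣ P n 0 ∣² →
        (ℑ z ℚ.* ℑ z) ℚ.* ∣ P n 0 ∣² ℚ.≤ ∣ 1# + y * newton (suc n) (ι ∘ T) ∣² ℚ.* ∣ z ∣²
      ∣f∣²-bound 0≤ℑz 0<1-z 0<P = subst (λ a → (ℑ z ℚ.* ℑ z) ℚ.* ∣ P n 0 ∣² ℚ.≤ ∣ a ∣² ℚ.* ∣ z ∣²) (sym f≡)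
        (∣∣²-from-area (P n 0 + rest) z (P n 0) 0≤ℑz 0<P
          (subst₂ ℚ._≤_ (trans (ℚ.+-identityʳ _) (area-rotate z (P n 0))) (sym (area-+ˡ (P n 0) rest (z * P n 0)))
            (ℚ.+-monoʳ-≤ (area (P n 0) (z * P n 0)) (proj₂ P₀≼rest))))
        where
        open Arc z 0≤ℑz
        P₀≼rest : P n 0 ≼ rest
        P₀≼rest = ≼-+ʳ {P n 0} {w * newton (suc n) X} {y * newton (suc n) X₂}
          (Cone-≼ 0≤ℑz 0<1-z s₁ t₁ t₁≡s₁+1 w (P n 0) (P₀≼P 0≤ℑz 0<1-z) X∈Cone)
          (Cone-≼ 0≤ℑz 0<1-z t₁ t₂ t₂≡t₁+1 y (P n 0) (P₀≼Q 0≤ℑz 0<1-z) X₂∈Cone)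

  *-pos : ∀ {p q} → 0ℚ ℚ.< p → 0ℚ ℚ.< q → 0ℚ ℚ.< p ℚ.* q
  *-pos {p} {q} 0<p 0<q = ℚ.positive⁻¹ (p ℚ.* q) {{ℚ.pos*pos⇒pos p {{ℚ.positive 0<p}} q {{ℚ.positive 0<q}}}}

  -- For the multichain numbers T of the boundary complex, the f-polynomial of the subdivision at
  -- z/(1 - z) in Newton form, with w in the role of 1/(1 - z).
  chainPoly : ℕ → (ℕ → ℕ) → ℚ[i] → ℚ[i] → ℚ[i]
  chainPoly n T z w = 1# + z * w * Newton.newton (z * w) (suc n) (ι ∘ T)

  module Region (δ R : ℚ) (0<δ : 0ℚ ℚ.< δ) (0<R : 0ℚ ℚ.< R) where

    δ≤ℑ⇒δ²≤∣1-∣² : ∀ {z} → δ ℚ.≤ ℑ z → δ ℚ.* δ ℚ.≤ ∣ 1# - z ∣²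
    δ≤ℑ⇒δ²≤∣1-∣² {z} δ≤ℑz = begin
      δ ℚ.* δ                                 ≤⟨ *-mono-≤-nonneg (ℚ.<⇒≤ 0<δ) (ℚ.<⇒≤ 0<δ) δ≤ℑz δ≤ℑz ⟩
      ℑ z ℚ.* ℑ z                             ≡⟨ solve 1 (λ a → a :* a := con 0ℚ :+ (con 0ℚ :- a) :* (con 0ℚ :- a)) refl (ℑ z) ⟩
      0ℚ ℚ.+ ℑ (1# - z) ℚ.* ℑ (1# - z)         ≤⟨ ℚ.+-monoˡ-≤ (ℑ (1# - z) ℚ.* ℑ (1# - z)) (square-nonneg (ℜ (1# - z))) ⟩
      ∣ 1# - z ∣²                             ∎
      where
      open ℚ.≤-Reasoning
      open ℚ-Solver

    record InRegion (z w : ℚ[i]) : Set where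
      field
        δ≤ℑz    : δ ℚ.≤ ℑ z
        ∣z∣²≤R   : ∣ z ∣² ℚ.≤ R
        ∣1-z∣²≤R : ∣ 1# - z ∣² ℚ.≤ R
        w-inv   : w * (1# - z) ≡ 1#

      0≤ℑz : 0ℚ ℚ.≤ ℑ z
      0≤ℑz = ℚ.≤-trans (ℚ.<⇒≤ 0<δ) δ≤ℑz

      δ²≤∣1-z∣² : δ ℚ.* δ ℚ.≤ ∣ 1# - z ∣²
      δ²≤∣1-z∣² = δ≤ℑ⇒δ²≤∣1-∣² {z} δ≤ℑz

      δ²≤ℑz² : δ ℚ.* δ ℚ.≤ ℑ z ℚ.* ℑ z
      δ²≤ℑz² = *-mono-≤-nonneg (ℚ.<⇒≤ 0<δ) (ℚ.<⇒≤ 0<δ) δ≤ℑz δ≤ℑz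

    open InRegion public

    0<δ² : 0ℚ ℚ.< δ ℚ.* δ
    0<δ² = *-pos 0<δ 0<δ

    0<∣1-z∣² : ∀ {z w} → InRegion z w → 0ℚ ℚ.< ∣ 1# - z ∣²
    0<∣1-z∣² r = ℚ.<-≤-trans 0<δ² (δ²≤∣1-z∣² r)

    BoundedBelow : (∀ z w → InRegion z w → ℚ) → Set
    BoundedBelow φ = ∃ λ c → 0ℚ ℚ.< c × (∀ z w (r : InRegion z w) → c ℚ.≤ φ z w r)

    -- The factors a and b do not depend on the point, so a c / b is again a uniform bound.
    -- Positivity of ψ is handed on because the area estimates divide by it.
    boundedBelow-scale : ∀ {φ ψ} a b → 0ℚ ℚ.< a → 0ℚ ℚ.< b → BoundedBelow ψ →
      (∀ z w r → 0ℚ ℚ.< ψ z w r → a ℚ.* ψ z w r ℚ.≤ φ z w r ℚ.* b) → BoundedBelow φ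
    boundedBelow-scale {φ} {ψ} a b 0<a 0<b (c , 0<c , c≤ψ) aψ≤φb =
      a ℚ.* c ℚ.* 1/b , *-pos (*-pos 0<a 0<c) 0<1/b , λ z w r →
        ℚ.*-cancelʳ-≤-pos b {{ℚ.positive 0<b}} (begin
          a ℚ.* c ℚ.* 1/b ℚ.* b    ≡⟨ trans (ℚ.*-assoc (a ℚ.* c) 1/b b) (trans (cong (a ℚ.* c ℚ.*_) (ℚ.*-inverseˡ b)) (ℚ.*-identityʳ (a ℚ.* c))) ⟩
          a ℚ.* c                 ≤⟨ ℚ.*-monoˡ-≤-nonNeg a {{ℚ.nonNegative (ℚ.<⇒≤ 0<a)}} (c≤ψ z w r) ⟩
          a ℚ.* ψ z w r           ≤⟨ aψ≤φb z w r (ℚ.<-≤-trans 0<c (c≤ψ z w r)) ⟩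
          φ z w r ℚ.* b           ∎)
      where
      open ℚ.≤-Reasoning
      instance
        b≢0 : ℚ.NonZero b
        b≢0 = ℚ.pos⇒nonZero b {{ℚ.positive 0<b}}
      1/b : ℚ
      1/b = ℚ.1/ b
      0<1/b : 0ℚ ℚ.< 1/b
      0<1/b = ℚ.positive⁻¹ 1/b {{ℚ.1/pos⇒pos b {{ℚ.positive 0<b}}}}

    P₀ : ℕ → ∀ z w → InRegion z w → ℚ[i]
    P₀ n z w r = Families.P z w (w-inv r) n 0

    -- P 0 0 = 1/(1 - z) stays away from 0 because 1 - z is bounded; by `∣P₀∣²-bound` each further
    -- degree costs a factor δ²/R².
    P₀-boundedBelow : ∀ n → BoundedBelow (λ z w r → ∣ P₀ n z w r ∣²)
    P₀-boundedBelow zero = boundedBelow-scale {ψ = λ _ _ _ → 1ℚ} 1ℚ R (ℚ.positive⁻¹ 1ℚ) 0<R (1ℚ , ℚ.positive⁻¹ 1ℚ , λ _ _ _ → ℚ.≤-refl)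
      λ z w r _ → begin
        1ℚ ℚ.* 1ℚ                               ≡⟨⟩
        ∣ 1# ∣²                                 ≡⟨ cong ∣_∣² (sym (trans (cong (_* (1# - z)) (P₀≡ z w r)) (w-inv r))) ⟩
        ∣ P₀ 0 z w r * (1# - z) ∣²              ≡⟨ ∣∣²-* (P₀ 0 z w r) (1# - z) ⟩
        ∣ P₀ 0 z w r ∣² ℚ.* ∣ 1# - z ∣²         ≤⟨ ℚ.*-monoˡ-≤-nonNeg ∣ P₀ 0 z w r ∣² {{ℚ.nonNegative (∣∣²-nonneg (P₀ 0 z w r))}} (∣1-z∣²≤R r) ⟩
        ∣ P₀ 0 z w r ∣² ℚ.* R                   ∎
      where
      open ℚ.≤-Reasoning
      P₀≡ : ∀ z w r → P₀ 0 z w r ≡ w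
      P₀≡ z w r = ℚ[i]-Solver.solve 2 (λ z w → w :* (con 1# :* con 1# :+ (z :* w) :* con 0#) := w) refl z w
        where open ℚ[i]-Solver using (_:=_; _:+_; _:*_; con)
    P₀-boundedBelow (suc n) = boundedBelow-scale {φ = λ z w r → ∣ P₀ (suc n) z w r ∣²} {ψ = λ z w r → ∣ P₀ n z w r ∣²}
      (δ ℚ.* δ) (R ℚ.* R) 0<δ² (*-pos 0<R 0<R) (P₀-boundedBelow n)
      λ z w r 0<P → begin
        δ ℚ.* δ ℚ.* ∣ P₀ n z w r ∣²
          ≤⟨ ℚ.*-monoʳ-≤-nonNeg ∣ P₀ n z w r ∣² {{ℚ.nonNegative (ℚ.<⇒≤ 0<P)}} (δ²≤ℑz² r) ⟩
        ℑ z ℚ.* ℑ z ℚ.* ∣ P₀ n z w r ∣²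
          ≤⟨ Families.∣P₀∣²-bound z w (w-inv r) (0≤ℑz r) (0<∣1-z∣² r) n 0<P ⟩
        ∣ 1# - z ∣² ℚ.* ∣ P₀ (suc n) z w r ∣² ℚ.* ∣ z ∣²
          ≡⟨ solve 3 (λ a b c → a :* b :* c := b :* (a :* c)) refl ∣ 1# - z ∣² ∣ P₀ (suc n) z w r ∣² ∣ z ∣² ⟩
        ∣ P₀ (suc n) z w r ∣² ℚ.* (∣ 1# - z ∣² ℚ.* ∣ z ∣²)
          ≤⟨ ℚ.*-monoˡ-≤-nonNeg ∣ P₀ (suc n) z w r ∣² {{ℚ.nonNegative (∣∣²-nonneg (P₀ (suc n) z w r))}}
               (*-mono-≤-nonneg (∣∣²-nonneg (1# - z)) (∣∣²-nonneg z) (∣1-z∣²≤R r) (∣z∣²≤R r)) ⟩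
        ∣ P₀ (suc n) z w r ∣² ℚ.* (R ℚ.* R) ∎
      where
      open ℚ.≤-Reasoning
      open ℚ-Solver

    module _ (n ℓ : ℕ) (T : ℕ → ℕ)
      (T-eq : ∀ k → T k ℕ.+ ∏ (1 ℕ.+ 2 ℕ.* k) (3 ℕ.+ 4 ℕ.* k) (suc n) ℓ ≡ ∏ (3 ℕ.+ 2 ℕ.* k) (5 ℕ.+ 4 ℕ.* k) (suc n) ℓ) where

      chainPoly-boundedBelow : BoundedBelow (λ z w _ → ∣ chainPoly n T z w ∣²)
      chainPoly-boundedBelow = boundedBelow-scale {φ = λ z w _ → ∣ chainPoly n T z w ∣²} {ψ = λ z w r → ∣ P₀ n z w r ∣²}
        (δ ℚ.* δ) R 0<δ² 0<R (P₀-boundedBelow n)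
        λ z w r 0<P → begin
          δ ℚ.* δ ℚ.* ∣ P₀ n z w r ∣²
            ≤⟨ ℚ.*-monoʳ-≤-nonNeg ∣ P₀ n z w r ∣² {{ℚ.nonNegative (ℚ.<⇒≤ 0<P)}} (δ²≤ℑz² r) ⟩
          ℑ z ℚ.* ℑ z ℚ.* ∣ P₀ n z w r ∣²
            ≤⟨ Decomposition.∣f∣²-bound n ℓ T T-eq z w (w-inv r) (0≤ℑz r) (0<∣1-z∣² r) 0<P ⟩
          ∣ chainPoly n T z w ∣² ℚ.* ∣ z ∣²
            ≤⟨ ℚ.*-monoˡ-≤-nonNeg ∣ chainPoly n T z w ∣² {{ℚ.nonNegative (∣∣²-nonneg (chainPoly n T z w))}} (∣z∣²≤R r) ⟩
          ∣ chainPoly n T z w ∣² ℚ.* R ∎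
        where open ℚ.≤-Reasoning

      -- Each factor 1 - z costs δ², since its imaginary part has absolute value at least δ. The
      -- exponent is free because it will be `dim+1` of the subdivision, taken as it stands.
      [1-z]^*chainPoly-boundedBelow : ∀ m → BoundedBelow (λ z w _ → ∣ (1# - z) ^ m * chainPoly n T z w ∣²)
      [1-z]^*chainPoly-boundedBelow zero = boundedBelow-scale {φ = λ z w _ → ∣ 1# * chainPoly n T z w ∣²} {ψ = λ z w _ → ∣ chainPoly n T z w ∣²}
        1ℚ 1ℚ (ℚ.positive⁻¹ 1ℚ) (ℚ.positive⁻¹ 1ℚ) chainPoly-boundedBelow
        λ z w r _ → ℚ.≤-reflexive (trans (ℚ.*-comm 1ℚ ∣ chainPoly n T z w ∣²) (cong (λ a → ∣ a ∣² ℚ.* 1ℚ) (sym (*-identityˡ (chainPoly n T z w)))))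
      [1-z]^*chainPoly-boundedBelow (suc m) = boundedBelow-scale
        {φ = λ z w _ → ∣ (1# - z) ^ suc m * chainPoly n T z w ∣²} {ψ = λ z w _ → ∣ (1# - z) ^ m * chainPoly n T z w ∣²}
        (δ ℚ.* δ) 1ℚ 0<δ² (ℚ.positive⁻¹ 1ℚ) ([1-z]^*chainPoly-boundedBelow m)
        λ z w r _ → begin
          δ ℚ.* δ ℚ.* ∣ (1# - z) ^ m * chainPoly n T z w ∣²
            ≤⟨ ℚ.*-monoʳ-≤-nonNeg _ {{ℚ.nonNegative (∣∣²-nonneg ((1# - z) ^ m * chainPoly n T z w))}} (δ²≤∣1-z∣² r) ⟩
          ∣ 1# - z ∣² ℚ.* ∣ (1# - z) ^ m * chainPoly n T z w ∣²
            ≡⟨ sym (∣∣²-* (1# - z) ((1# - z) ^ m * chainPoly n T z w)) ⟩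
          ∣ (1# - z) * ((1# - z) ^ m * chainPoly n T z w) ∣²
            ≡⟨ cong ∣_∣² (sym (*-assoc (1# - z) ((1# - z) ^ m) (chainPoly n T z w))) ⟩
          ∣ (1# - z) ^ suc m * chainPoly n T z w ∣²
            ≡⟨ sym (ℚ.*-identityʳ _) ⟩
          ∣ (1# - z) ^ suc m * chainPoly n T z w ∣² ℚ.* 1ℚ ∎
        where open ℚ.≤-Reasoning

open LowerBound

-- The h-polynomial as a Newton polynomial of the multichain numbers

module Evaluation where
  open import Algebra.Properties.CommutativeSemiring.Exp (CommutativeRing.commutativeSemiring commutativeRing)
    using (^-distrib-*; ^-homo-*)
  open ℚ[i]-Solver using (solve; _:=_; _:+_; _:*_; _:-_; :-_; con)

  sumTo : ℕ → (ℕ → ℚ[i]) → ℚ[i]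
  sumTo zero    g = 0#
  sumTo (suc n) g = g 0 + sumTo n (g ∘ suc)

  sumTo-cong : ∀ n {f g} → (∀ i → i ℕ.< n → f i ≡ g i) → sumTo n f ≡ sumTo n g
  sumTo-cong zero    f≗g = refl
  sumTo-cong (suc n) f≗g = cong₂ _+_ (f≗g 0 (s≤s z≤n)) (sumTo-cong n (λ i i<n → f≗g (suc i) (s≤s i<n)))

  sumTo-+ : ∀ n f g → sumTo n (λ i → f i + g i) ≡ sumTo n f + sumTo n g
  sumTo-+ zero    f g = sym (+-identityˡ 0#)
  sumTo-+ (suc n) f g = trans (cong (λ s → f 0 + g 0 + s) (sumTo-+ n (f ∘ suc) (g ∘ suc)))
    (solve 4 (λ a b c d → a :+ b :+ (c :+ d) := (a :+ c) :+ (b :+ d)) refl (f 0) (g 0) (sumTo n (f ∘ suc)) (sumTo n (g ∘ suc)))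

  sumTo-*ˡ : ∀ n c f → sumTo n (λ i → c * f i) ≡ c * sumTo n f
  sumTo-*ˡ zero    c f = sym (zeroʳ c)
  sumTo-*ˡ (suc n) c f = trans (cong (c * f 0 +_) (sumTo-*ˡ n c (f ∘ suc))) (sym (distribˡ c (f 0) (sumTo n (f ∘ suc))))

  sumTo-0 : ∀ n f → (∀ i → f i ≡ 0#) → sumTo n f ≡ 0#
  sumTo-0 zero    f f≗0 = refl
  sumTo-0 (suc n) f f≗0 = trans (cong₂ _+_ (f≗0 0) (sumTo-0 n (f ∘ suc) (f≗0 ∘ suc))) (+-identityˡ 0#)

  sumTo-δ : ∀ n k (g : ℕ → ℚ[i]) → k ℕ.< n → sumTo n (λ i → ι (if does (k ℕ.≟ i) then 1 else 0) * g i) ≡ g k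
  sumTo-δ (suc n) zero g _ = trans
    (cong₂ _+_ (*-identityˡ (g 0)) (sumTo-0 n (λ i → 0# * g (suc i)) (λ i → zeroˡ (g (suc i)))))
    (+-identityʳ (g 0))
  sumTo-δ (suc n) (suc k) g (s≤s k<n) = trans
    (cong₂ _+_ (zeroˡ (g 0)) (sumTo-δ n k (g ∘ suc) k<n)) (+-identityˡ (g (suc k)))

  ∑ᴷ : {A : Set} → List A → (A → ℚ[i]) → ℚ[i]
  ∑ᴷ []       f = 0#
  ∑ᴷ (x ∷ xs) f = f x + ∑ᴷ xs f

  module _ {A : Set} where

    ∑ᴷ-++ : ∀ (xs ys : List A) f → ∑ᴷ (xs ++ ys) f ≡ ∑ᴷ xs f + ∑ᴷ ys f
    ∑ᴷ-++ []       ys f = sym (+-identityˡ (∑ᴷ ys f))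
    ∑ᴷ-++ (x ∷ xs) ys f = trans (cong (f x +_) (∑ᴷ-++ xs ys f)) (sym (+-assoc (f x) (∑ᴷ xs f) (∑ᴷ ys f)))

    ∑ᴷ-concatMap : ∀ {B : Set} (c : B → List A) (g : ℕ → B) n f →
      ∑ᴷ (concatMap c (applyUpTo g n)) f ≡ sumTo n (λ i → ∑ᴷ (c (g i)) f)
    ∑ᴷ-concatMap c g zero    f = refl
    ∑ᴷ-concatMap c g (suc n) f = trans (∑ᴷ-++ (c (g 0)) _ f)
      (cong (∑ᴷ (c (g 0)) f +_) (∑ᴷ-concatMap c (g ∘ suc) n f))

    ∑ᴷ-const : ∀ (xs : List A) f c → (∀ {x} → x ∈ xs → f x ≡ c) → ∑ᴷ xs f ≡ ι (length xs) * c
    ∑ᴷ-const []       f c f≡c = sym (zeroˡ c)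
    ∑ᴷ-const (x ∷ xs) f c f≡c = trans (cong₂ _+_ (f≡c (here refl)) (∑ᴷ-const xs f c (f≡c ∘ there)))
      (trans (solve 2 (λ c l → c :+ l :* c := (con 1# :+ l) :* c) refl c (ι (length xs)))
        (cong (_* c) (sym (ι-+ 1 (length xs)))))

    ∑ᴷ-by-length : ∀ n (xs : List (List A)) (g : ℕ → ℚ[i]) → (∀ {σ} → σ ∈ xs → length σ ℕ.< n) →
      sumTo n (λ i → ι (length (filter (λ σ → length σ ℕ.≟ i) xs)) * g i) ≡ ∑ᴷ xs (λ σ → g (length σ))
    ∑ᴷ-by-length n []       g <n = sumTo-0 n (λ i → 0# * g i) (λ i → zeroˡ (g i))
    ∑ᴷ-by-length n (σ ∷ xs) g <n = begin
      sumTo n (λ i → ι (length (filter (λ σ → length σ ℕ.≟ i) (σ ∷ xs))) * g i)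
        ≡⟨ sumTo-cong n (λ i _ → trans (cong (_* g i) (trans (cong ι (length-filter i)) (ι-+ (δ i) (# i))))
             (distribʳ (g i) (ι (δ i)) (ι (# i)))) ⟩
      sumTo n (λ i → ι (δ i) * g i + ι (# i) * g i)
        ≡⟨ sumTo-+ n (λ i → ι (δ i) * g i) (λ i → ι (# i) * g i) ⟩
      sumTo n (λ i → ι (δ i) * g i) + sumTo n (λ i → ι (# i) * g i)
        ≡⟨ cong₂ _+_ (sumTo-δ n (length σ) g (<n (here refl))) (∑ᴷ-by-length n xs g (<n ∘ there)) ⟩
      g (length σ) + ∑ᴷ xs (λ σ → g (length σ)) ∎
      where
      open ≡-Reasoning
      δ # : ℕ → ℕ
      δ i = if does (length σ ℕ.≟ i) then 1 else 0
      # i = length (filter (λ σ → length σ ℕ.≟ i) xs)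
      length-filter : ∀ i → length (filter (λ σ → length σ ℕ.≟ i) (σ ∷ xs)) ≡ δ i ℕ.+ # i
      length-filter i with does (length σ ℕ.≟ i)
      ... | true  = refl
      ... | false = refl

  -- Row j + 1 of T is the difference of row j, so the Newton coefficients of row 0 are the entries
  -- T j 0; for `chainTable` these count strict chains.
  newton-table : ∀ y (T : ℕ → ℕ → ℕ) → (∀ j k → T j (suc k) ≡ T j k ℕ.+ T (suc j) k) →
    ∀ n → Newton.newton y n (ι ∘ T 0) ≡ sumTo n (λ i → ι (T i 0) * y ^ i)
  newton-table y T T-Δ zero    = refl
  newton-table y T T-Δ (suc n) = cong₂ _+_ (sym (*-identityʳ (ι (T 0 0)))) (begin
    y * newton n (Δ (ι ∘ T 0))
      ≡⟨ cong (y *_) (trans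
           (newton-cong n λ k → trans (cong (_- ι (T 0 k)) (trans (cong ι (T-Δ 0 k)) (ι-+ (T 0 k) (T 1 k))))
             (solve 2 (λ a b → a :+ b :- a := b) refl (ι (T 0 k)) (ι (T 1 k))))
           (newton-table y (T ∘ suc) (T-Δ ∘ suc) n)) ⟩
    y * sumTo n (λ i → ι (T (suc i) 0) * y ^ i)
      ≡⟨ sym (sumTo-*ˡ n y (λ i → ι (T (suc i) 0) * y ^ i)) ⟩
    sumTo n (λ i → y * (ι (T (suc i) 0) * y ^ i))
      ≡⟨ sumTo-cong n (λ i _ → solve 3 (λ y a b → y :* (a :* b) := a :* (y :* b)) refl y (ι (T (suc i) 0)) (y ^ i)) ⟩
    sumTo n (λ i → ι (T (suc i) 0) * y ^ suc i) ∎)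
    where
    open ≡-Reasoning
    open Newton y

  length-chain : ∀ C k {σ} → σ ∈ chains C k → length σ ≡ k
  length-chain C zero    (here refl) = refl
  length-chain C (suc k) σ∈
    with ∈-cartesianProductWith⁻ _∷_ faces (chains C k)
           (proj₁ (∈-filter⁻ (linked? (_⊊?_ C)) {xs = cartesianProductWith _∷_ faces (chains C k)} σ∈))
    where open PolytopalComplex C
  ... | F , τ , _ , τ∈ , refl = cong suc (length-chain C k τ∈)

  ∑ᴷ-sd : ∀ C y → ∑ᴷ (SimplicialComplex.simplices (sd C)) (λ σ → y ^ length σ) ≡
    1# + y * sumTo (length (PolytopalComplex.faces C)) (λ i → ι (length (chains C (suc i))) * y ^ i)
  ∑ᴷ-sd C y = begin
    ∑ᴷ (concatMap (chains C) (upTo (suc n))) (λ σ → y ^ length σ)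
      ≡⟨ ∑ᴷ-concatMap (chains C) id (suc n) (λ σ → y ^ length σ) ⟩
    sumTo (suc n) (λ i → ∑ᴷ (chains C i) (λ σ → y ^ length σ))
      ≡⟨ sumTo-cong (suc n) (λ i _ → ∑ᴷ-const (chains C i) (λ σ → y ^ length σ) (y ^ i)
           (λ σ∈ → cong (y ^_) (length-chain C i σ∈))) ⟩
    sumTo (suc n) (λ i → ι (length (chains C i)) * y ^ i)
      ≡⟨ cong₂ _+_ (*-identityʳ 1#) (trans
           (sumTo-cong n λ i _ → solve 3 (λ y a b → a :* (y :* b) := y :* (a :* b)) refl y (ι (length (chains C (suc i)))) (y ^ i))
           (sumTo-*ˡ n y (λ i → ι (length (chains C (suc i))) * y ^ i))) ⟩
    1# + y * sumTo n (λ i → ι (length (chains C (suc i))) * y ^ i) ∎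
    where
    open ≡-Reasoning
    n = length (PolytopalComplex.faces C)

  module Eval (z : ℚ[i]) where

    ev : ℤ[x] → ℚ[i]
    ev []      = 0#
    ev (a ∷ p) = κ a + z * ev p

    ev-+ : ∀ p q → ev (p +ᴾ q) ≡ ev p + ev q
    ev-+ []      q       = sym (+-identityˡ (ev q))
    ev-+ (a ∷ p) []      = sym (+-identityʳ (ev (a ∷ p)))
    ev-+ (a ∷ p) (b ∷ q) = trans (cong₂ (λ c e → c + z * e) (κ-+ a b) (ev-+ p q))
      (solve 5 (λ a b z p q → a :+ b :+ z :* (p :+ q) := (a :+ z :* p) :+ (b :+ z :* q)) refl (κ a) (κ b) z (ev p) (ev q))

    ev-scale : ∀ a q → ev (map (a ℤ.*_) q) ≡ κ a * ev q
    ev-scale a []      = sym (zeroʳ (κ a))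
    ev-scale a (b ∷ q) = trans (cong₂ (λ c e → c + z * e) (κ-* a b) (ev-scale a q))
      (solve 4 (λ a b z q → a :* b :+ z :* (a :* q) := a :* (b :+ z :* q)) refl (κ a) (κ b) z (ev q))

    ev-* : ∀ p q → ev (p *ᴾ q) ≡ ev p * ev q
    ev-* []      q = sym (zeroˡ (ev q))
    ev-* (a ∷ p) q = trans (ev-+ (map (a ℤ.*_) q) (0ℤ ∷ (p *ᴾ q)))
      (trans (cong₂ (λ c e → c + (0# + z * e)) (ev-scale a q) (ev-* p q))
        (solve 4 (λ a z p q → a :* q :+ (con 0# :+ z :* (p :* q)) := (a :+ z :* p) :* q) refl (κ a) z (ev p) (ev q)))

    ev-^ : ∀ p n → ev (p ^ᴾ n) ≡ ev p ^ n
    ev-^ p zero    = solve 1 (λ z → con 1# :+ z :* con 0# := con 1#) refl z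
    ev-^ p (suc n) = trans (ev-* p (p ^ᴾ n)) (cong (ev p *_) (ev-^ p n))

    ev-const : ∀ a → ev (a ∷ []) ≡ κ a
    ev-const a = trans (cong (κ a +_) (zeroʳ z)) (+-identityʳ (κ a))

    ev-x : ev (0ℤ ∷ 1ℤ ∷ []) ≡ z
    ev-x = solve 1 (λ z → con 0# :+ z :* (con 1# :+ z :* con 0#) := z) refl z

    ev-1-x : ev (1ℤ ∷ -1ℤ ∷ []) ≡ 1# - z
    ev-1-x = solve 1 (λ z → con 1# :+ z :* ((:- con 1#) :+ z :* con 0#) := con 1# :- z) refl z

    ev-sum : ∀ (p : ℕ → ℤ[x]) f n → ev (sumᴾ (map p (applyUpTo f n))) ≡ sumTo n (λ i → ev (p (f i)))
    ev-sum p f zero    = refl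
    ev-sum p f (suc n) = trans (ev-+ (p (f 0)) _) (cong (λ e → ev (p (f 0)) + e) (ev-sum p (f ∘ suc) n))

    module _ (S : SimplicialComplex) where
      open SimplicialComplex S

      length≤dim+1 : ∀ {σ} → σ ∈ simplices → length σ ℕ.≤ dim+1 S
      length≤dim+1 = bound simplices
        where
        bound : ∀ xs {σ} → σ ∈ xs → length σ ℕ.≤ foldr ℕ._⊔_ 0 (map length xs)
        bound (σ ∷ xs) (here refl) = ℕ.m≤m⊔n (length σ) _
        bound (τ ∷ xs) (there σ∈)  = ℕ.≤-trans (bound xs σ∈) (ℕ.m≤n⊔m (length τ) _)

      module _ (w : ℚ[i]) (w-inv : w * (1# - z) ≡ 1#) where

        private
          1^ : ∀ n → 1# ^ n ≡ 1#
          1^ zero    = refl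
          1^ (suc n) = trans (*-identityˡ (1# ^ n)) (1^ n)

        [1-z]^*w^ : ∀ n → (1# - z) ^ n * w ^ n ≡ 1#
        [1-z]^*w^ n = trans (sym (^-distrib-* (1# - z) w n))
          (trans (cong (_^ n) (trans (*-comm (1# - z) w) w-inv)) (1^ n))

        private
          m = dim+1 S

          term : ℕ → ℤ[x]
          term i = (ℤ.+ #simplices S i ∷ []) *ᴾ (0ℤ ∷ 1ℤ ∷ []) ^ᴾ i *ᴾ (1ℤ ∷ -1ℤ ∷ []) ^ᴾ (m ∸ i)

          ev-term : ∀ i → i ℕ.< suc m → w ^ m * ev (term i) ≡ ι (#simplices S i) * (z * w) ^ i
          ev-term i (s≤s i≤m) = begin
            w ^ m * ev (term i)
              ≡⟨ cong (w ^ m *_) (trans (ev-* ((ℤ.+ #simplices S i ∷ []) *ᴾ (0ℤ ∷ 1ℤ ∷ []) ^ᴾ i) _) (cong₂ _*_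
                   (trans (ev-* (ℤ.+ #simplices S i ∷ []) ((0ℤ ∷ 1ℤ ∷ []) ^ᴾ i)) (cong₂ _*_ (ev-const (ℤ.+ #simplices S i))
                     (trans (ev-^ (0ℤ ∷ 1ℤ ∷ []) i) (cong (_^ i) ev-x))))
                   (trans (ev-^ (1ℤ ∷ -1ℤ ∷ []) (m ∸ i)) (cong (_^ (m ∸ i)) ev-1-x)))) ⟩
            w ^ m * (s * z ^ i * (1# - z) ^ (m ∸ i))
              ≡⟨ cong (_* (s * z ^ i * (1# - z) ^ (m ∸ i))) (trans (cong (w ^_) (sym (ℕ.m∸n+n≡m i≤m))) (^-homo-* w (m ∸ i) i)) ⟩
            w ^ (m ∸ i) * w ^ i * (s * z ^ i * (1# - z) ^ (m ∸ i))
              ≡⟨ solve 5 (λ a b s c d → a :* b :* (s :* c :* d) := (d :* a) :* (s :* (c :* b))) refl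
                   (w ^ (m ∸ i)) (w ^ i) s (z ^ i) ((1# - z) ^ (m ∸ i)) ⟩
            (1# - z) ^ (m ∸ i) * w ^ (m ∸ i) * (s * (z ^ i * w ^ i))
              ≡⟨ cong₂ (λ a b → a * (s * b)) ([1-z]^*w^ (m ∸ i)) (sym (^-distrib-* z w i)) ⟩
            1# * (s * (z * w) ^ i)
              ≡⟨ *-identityˡ (s * (z * w) ^ i) ⟩
            s * (z * w) ^ i ∎
            where
            open ≡-Reasoning
            s = ι (#simplices S i)

        -- wᵐ zⁱ (1 - z)ᵐ⁻ⁱ = (z w)ⁱ for i ≤ m. The sum over i misses no simplex, since m is the
        -- maximum of their lengths.
        ev-hPolynomial : w ^ m * ev (hPolynomial S) ≡ ∑ᴷ simplices (λ σ → (z * w) ^ length σ)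
        ev-hPolynomial = begin
          w ^ m * ev (hPolynomial S)
            ≡⟨ cong (w ^ m *_) (ev-sum term id (suc m)) ⟩
          w ^ m * sumTo (suc m) (λ i → ev (term i))
            ≡⟨ sym (sumTo-*ˡ (suc m) (w ^ m) (λ i → ev (term i))) ⟩
          sumTo (suc m) (λ i → w ^ m * ev (term i))
            ≡⟨ sumTo-cong (suc m) ev-term ⟩
          sumTo (suc m) (λ i → ι (#simplices S i) * (z * w) ^ i)
            ≡⟨ ∑ᴷ-by-length (suc m) simplices ((z * w) ^_) (λ σ∈ → s≤s (length≤dim+1 σ∈)) ⟩
          ∑ᴷ simplices (λ σ → (z * w) ^ length σ) ∎
          where open ≡-Reasoning

open Evaluation

-- Passage from rational points to Cauchy reals

module Analysis where
  open Counting using (∏)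

  conj : ℚ[i] → ℚ[i]
  conj (a +i b) = a +i (ℚ.- b)

  module _ where
    open ℚ-Solver

    conj-κ+* : ∀ a z u → conj (κ a + z * u) ≡ κ a + conj z * conj u
    conj-κ+* a (z +i z′) (u +i u′) = cong₂ _+i_
      (solve 5 (λ a z z′ u u′ → a :+ (z :* u :- z′ :* u′) := a :+ (z :* u :- (:- z′) :* (:- u′))) refl (ℜ (κ a)) z z′ u u′)
      (solve 4 (λ z z′ u u′ → :- (con 0ℚ :+ (z :* u′ :+ z′ :* u)) := con 0ℚ :+ (z :* (:- u′) :+ (:- z′) :* u)) refl z z′ u u′)

    ∣conj∣² : ∀ z → ∣ conj z ∣² ≡ ∣ z ∣²
    ∣conj∣² (a +i b) = solve 2 (λ a b → a :* a :+ (:- b) :* (:- b) := a :* a :+ b :* b) refl a b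

  ev-conj : ∀ p z → Eval.ev (conj z) p ≡ conj (Eval.ev z p)
  ev-conj []      z = refl
  ev-conj (a ∷ p) z = trans (cong (λ e → κ a + conj z * e) (ev-conj p z)) (sym (conj-κ+* a z (Eval.ev z p)))

  infix 9 _at_
  _at_ : ℂ → ℕ → ℚ[i]
  z at n = seq (re z) n +i seq (im z) n

  -- Arithmetic on `ℝ` is termwise, so the n-th approximation of the value is the exact value at the
  -- n-th approximation of z. Through this the rational bounds reach Cauchy reals.
  eval-at : ∀ p z n → eval (map fromℤ p) z at n ≡ Eval.ev (z at n) p
  eval-at []      z n = refl
  eval-at (a ∷ p) z n = cong (λ e → κ a + z at n * e) (eval-at p z n)

  -- A quantitative form of "p has no zero in the open upper half-plane".
  ZeroFree : ℤ[x] → Set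
  ZeroFree p = ∀ δ R → 0ℚ ℚ.< δ → 0ℚ ℚ.< R → ∃ λ c → 0ℚ ℚ.< c ×
    (∀ z → δ ℚ.≤ ℑ z → ∣ z ∣² ℚ.≤ R → ∣ 1# - z ∣² ℚ.≤ R → c ℚ.≤ ∣ Eval.ev z p ∣²)

  square-mono : ∀ {p q} → ℚ.∣ p ∣ ℚ.≤ q → p ℚ.* p ℚ.≤ q ℚ.* q
  square-mono {p} {q} p≤q = subst (ℚ._≤ q ℚ.* q)
    (trans (sym (ℚ.∣p*q∣≡∣p∣*∣q∣ p p)) (ℚ.0≤p⇒∣p∣≡p (square-nonneg p)))
    (*-mono-≤-nonneg (ℚ.0≤∣p∣ p) (ℚ.0≤∣p∣ p) p≤q p≤q)

  private
    ½-pos : ∀ {ε} → 0ℚ ℚ.< ε → 0ℚ ℚ.< ½ ℚ.* ε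
    ½-pos = ℚ.*-monoʳ-<-pos ½

    ½+½ : ∀ ε → ½ ℚ.* ε ℚ.+ ½ ℚ.* ε ≡ ε
    ½+½ ε = trans (sym (ℚ.*-distribʳ-+ ε ½ ½)) (ℚ.*-identityˡ ε)

    p-0 : ∀ p → p ℚ.- 0ℚ ≡ p
    p-0 = ℚ.+-identityʳ

    by-triangle : ∀ p q → ℚ.∣ p ∣ ℚ.≤ ℚ.∣ p ℚ.- q ∣ ℚ.+ ℚ.∣ q ∣
    by-triangle p q = subst (λ a → ℚ.∣ a ∣ ℚ.≤ ℚ.∣ p ℚ.- q ∣ ℚ.+ ℚ.∣ q ∣)
      (solve 2 (λ p q → p :- q :+ q := p) refl p q) (ℚ.∣p+q∣≤∣p∣+∣q∣ (p ℚ.- q) q)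
      where open ℚ-Solver

    ∣p-q∣≡∣q-p∣ : ∀ p q → ℚ.∣ p ℚ.- q ∣ ≡ ℚ.∣ q ℚ.- p ∣
    ∣p-q∣≡∣q-p∣ p q = trans (sym (ℚ.∣-p∣≡∣p∣ (p ℚ.- q)))
      (cong ℚ.∣_∣ (solve 2 (λ p q → :- (p :- q) := q :- p) refl p q))
      where open ℚ-Solver

    -- Stands in for a square root of c / 2.
    small : ∀ c → 0ℚ ℚ.< c → ∃ λ ε → 0ℚ ℚ.< ε × ε ℚ.* ε ℚ.+ ε ℚ.* ε ℚ.≤ c
    small c 0<c with ℚ.≤-total c 1ℚ
    ... | inj₁ c≤1 = ½ ℚ.* c , ½-pos 0<c , ℚ.≤-trans
      (ℚ.+-mono-≤ ε²≤ε ε²≤ε) (ℚ.≤-reflexive (½+½ c))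
      where
      ε = ½ ℚ.* c
      ε≤1 : ε ℚ.≤ 1ℚ
      ε≤1 = ℚ.≤-trans (subst (ε ℚ.≤_) (½+½ c) (subst (ℚ._≤ ε ℚ.+ ε) (ℚ.+-identityʳ ε) (ℚ.+-monoʳ-≤ ε (ℚ.<⇒≤ (½-pos 0<c))))) c≤1
      ε²≤ε : ε ℚ.* ε ℚ.≤ ε
      ε²≤ε = subst (ε ℚ.* ε ℚ.≤_) (ℚ.*-identityʳ ε)
        (ℚ.*-monoˡ-≤-nonNeg ε {{ℚ.nonNegative (ℚ.<⇒≤ (½-pos 0<c))}} ε≤1)
    ... | inj₂ 1≤c = ½ , ℚ.positive⁻¹ ½ , ℚ.≤-trans ½²+½²≤1 1≤c
      where
      ½²+½²≤1 : ½ ℚ.* ½ ℚ.+ ½ ℚ.* ½ ℚ.≤ 1ℚ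
      ½²+½²≤1 = toWitness {a? = (½ ℚ.* ½ ℚ.+ ½ ℚ.* ½) ℚ.≤? 1ℚ} _

  -- The coefficients are integers, so conjugating z conjugates the value, and all moduli involved
  -- stay the same.
  zeroFree-∣ℑ∣ : ∀ p → ZeroFree p → ∀ δ R → 0ℚ ℚ.< δ → 0ℚ ℚ.< R → ∃ λ c → 0ℚ ℚ.< c ×
    (∀ z → δ ℚ.≤ ℚ.∣ ℑ z ∣ → ∣ z ∣² ℚ.≤ R → ∣ 1# - z ∣² ℚ.≤ R → c ℚ.≤ ∣ Eval.ev z p ∣²)
  zeroFree-∣ℑ∣ p zeroFree δ R 0<δ 0<R with zeroFree δ R 0<δ 0<R
  ... | c , 0<c , bound = c , 0<c , λ z δ≤ z≤R 1-z≤R → helper z δ≤ z≤R 1-z≤R (ℚ.∣p∣≡p∨∣p∣≡-p (ℑ z))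
    where
    1-conj : ∀ z → 1# - conj z ≡ conj (1# - z)
    1-conj (a +i b) = cong₂ _+i_ refl (solve 1 (λ b → con 0ℚ :- (:- b) := :- (con 0ℚ :- b)) refl b)
      where open ℚ-Solver
    helper : ∀ z → δ ℚ.≤ ℚ.∣ ℑ z ∣ → ∣ z ∣² ℚ.≤ R → ∣ 1# - z ∣² ℚ.≤ R →
      ℚ.∣ ℑ z ∣ ≡ ℑ z ⊎ ℚ.∣ ℑ z ∣ ≡ ℚ.- ℑ z → c ℚ.≤ ∣ Eval.ev z p ∣²
    helper z δ≤ z≤R 1-z≤R (inj₁ eq) = bound z (subst (δ ℚ.≤_) eq δ≤) z≤R 1-z≤R
    helper z δ≤ z≤R 1-z≤R (inj₂ eq) = subst (c ℚ.≤_)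
      (trans (cong ∣_∣² (ev-conj p z)) (∣conj∣² (Eval.ev z p)))
      (bound (conj z) (subst (δ ℚ.≤_) eq δ≤) (subst (ℚ._≤ R) (sym (∣conj∣² z)) z≤R)
        (subst (ℚ._≤ R) (sym (trans (cong ∣_∣² (1-conj z)) (∣conj∣² (1# - z)))) 1-z≤R))

  -- Equality with 0 is undecidable for im z, but for each ε a rational approximation b within ε/4
  -- can be compared with ε/2. If ∣b∣ is smaller, all later approximations are below ε; otherwise
  -- they stay at least ε/4 away from 0, and the lower bound contradicts p(z) = 0.
  zeroFree⇒realRooted : ∀ p → ZeroFree p → RealRooted (map fromℤ p)
  zeroFree⇒realRooted p zeroFree = inj₂ λ z p[z]≈0 ε 0<ε → realZero z p[z]≈0 ε 0<ε
    where
    realZero : ∀ z → eval (map fromℤ p) z ≈ᶜ 0ᶜ → im z ≈ᴿ 0ᴿ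
    realZero z (re≈0 , im≈0) ε 0<ε = conclude (ℚ.∣ b ∣ ℚ.<? ε₂)
      where
      ε₂ = ½ ℚ.* ε
      ε₄ = ½ ℚ.* ε₂
      0<ε₂ : 0ℚ ℚ.< ε₂
      0<ε₂ = ½-pos 0<ε
      0<ε₄ : 0ℚ ℚ.< ε₄
      0<ε₄ = ½-pos 0<ε₂
      N₁ N₂ N : ℕ
      N₁ = proj₁ (cauchy (im z) ε₄ 0<ε₄)
      N₂ = proj₁ (cauchy (re z) 1ℚ (ℚ.positive⁻¹ 1ℚ))
      N  = N₁ ℕ.⊔ N₂
      a b : ℚ
      a = seq (re z) N
      b = seq (im z) N
      im-near : ∀ n → N ℕ.≤ n → ℚ.∣ seq (im z) n ℚ.- b ∣ ℚ.< ε₄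
      im-near n N≤n = proj₂ (cauchy (im z) ε₄ 0<ε₄) n N (ℕ.m⊔n≤o⇒m≤o N₁ N₂ N≤n) (ℕ.m≤m⊔n N₁ N₂)
      re-near : ∀ n → N ℕ.≤ n → ℚ.∣ seq (re z) n ℚ.- a ∣ ℚ.< 1ℚ
      re-near n N≤n = proj₂ (cauchy (re z) 1ℚ (ℚ.positive⁻¹ 1ℚ)) n N (ℕ.m⊔n≤o⇒n≤o N₁ N₂ N≤n) (ℕ.m≤n⊔m N₁ N₂)

      conclude : Dec (ℚ.∣ b ∣ ℚ.< ε₂) → ∃ λ N → ∀ n → N ℕ.≤ n → ℚ.∣ seq (im z) n ℚ.- 0ℚ ∣ ℚ.< ε
      conclude (yes ∣b∣<ε₂) = N , λ n N≤n → begin-strict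
        ℚ.∣ seq (im z) n ℚ.- 0ℚ ∣                 ≡⟨ cong ℚ.∣_∣ (p-0 (seq (im z) n)) ⟩
        ℚ.∣ seq (im z) n ∣                       ≤⟨ by-triangle (seq (im z) n) b ⟩
        ℚ.∣ seq (im z) n ℚ.- b ∣ ℚ.+ ℚ.∣ b ∣       <⟨ ℚ.+-mono-< (im-near n N≤n) ∣b∣<ε₂ ⟩
        ε₄ ℚ.+ ε₂                                ≤⟨ ℚ.+-monoˡ-≤ ε₂ (subst (ε₄ ℚ.≤_) (½+½ ε₂)
                                                      (subst (ℚ._≤ ε₄ ℚ.+ ε₄) (ℚ.+-identityʳ ε₄) (ℚ.+-monoʳ-≤ ε₄ (ℚ.<⇒≤ 0<ε₄)))) ⟩
        ε₂ ℚ.+ ε₂                                ≡⟨ ½+½ ε ⟩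
        ε                                        ∎
        where open ℚ.≤-Reasoning
      conclude (no ∣b∣≮ε₂) = contradiction (ℚ.<-≤-trans tiny (ℚ.≤-trans (proj₂ (proj₂ away) (z at n) ε₄≤ z≤R 1-z≤R)
          (ℚ.≤-reflexive (cong ∣_∣² (sym (eval-at p z n)))))) (ℚ.<-irrefl refl)
        where
        A B R : ℚ
        A = 1ℚ ℚ.+ ℚ.∣ a ∣
        B = ε₄ ℚ.+ ℚ.∣ b ∣
        -- A and B bound the real and imaginary parts from N on; 1 + A leaves room for the real part
        -- of 1 - z.
        R = (1ℚ ℚ.+ A) ℚ.* (1ℚ ℚ.+ A) ℚ.+ B ℚ.* B
        0<A : 0ℚ ℚ.< A
        0<A = ℚ.+-mono-<-≤ (ℚ.positive⁻¹ 1ℚ) (ℚ.0≤∣p∣ a)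
        0<1+A : 0ℚ ℚ.< 1ℚ ℚ.+ A
        0<1+A = ℚ.+-mono-< (ℚ.positive⁻¹ 1ℚ) 0<A
        0<R : 0ℚ ℚ.< R
        0<R = ℚ.+-mono-<-≤ (*-pos 0<1+A 0<1+A) (square-nonneg B)
        away = zeroFree-∣ℑ∣ p zeroFree ε₄ R 0<ε₄ 0<R
        c : ℚ
        c = proj₁ away
        η : ∃ λ η → 0ℚ ℚ.< η × η ℚ.* η ℚ.+ η ℚ.* η ℚ.≤ c
        η = small c (proj₁ (proj₂ away))
        M₁ M₂ n : ℕ
        M₁ = proj₁ (re≈0 (proj₁ η) (proj₁ (proj₂ η)))
        M₂ = proj₁ (im≈0 (proj₁ η) (proj₁ (proj₂ η)))
        n  = N ℕ.⊔ (M₁ ℕ.⊔ M₂)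
        N≤n : N ℕ.≤ n
        N≤n = ℕ.m≤m⊔n N (M₁ ℕ.⊔ M₂)
        M₁≤n : M₁ ℕ.≤ n
        M₁≤n = ℕ.≤-trans (ℕ.m≤m⊔n M₁ M₂) (ℕ.m≤n⊔m N (M₁ ℕ.⊔ M₂))
        M₂≤n : M₂ ℕ.≤ n
        M₂≤n = ℕ.≤-trans (ℕ.m≤n⊔m M₁ M₂) (ℕ.m≤n⊔m N (M₁ ℕ.⊔ M₂))
        x y : ℚ
        x = seq (re z) n
        y = seq (im z) n
        ∣x∣≤A : ℚ.∣ x ∣ ℚ.≤ A
        ∣x∣≤A = ℚ.≤-trans (by-triangle x a) (ℚ.+-monoˡ-≤ ℚ.∣ a ∣ (ℚ.<⇒≤ (re-near n N≤n)))
        ∣y∣≤B : ℚ.∣ y ∣ ℚ.≤ B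
        ∣y∣≤B = ℚ.≤-trans (by-triangle y b) (ℚ.+-monoˡ-≤ ℚ.∣ b ∣ (ℚ.<⇒≤ (im-near n N≤n)))
        A≤1+A : A ℚ.≤ 1ℚ ℚ.+ A
        A≤1+A = subst (ℚ._≤ 1ℚ ℚ.+ A) (ℚ.+-identityˡ A) (ℚ.+-monoˡ-≤ A (ℚ.<⇒≤ (ℚ.positive⁻¹ 1ℚ)))
        z≤R : ∣ z at n ∣² ℚ.≤ R
        z≤R = ℚ.+-mono-≤ (square-mono (ℚ.≤-trans ∣x∣≤A A≤1+A)) (square-mono ∣y∣≤B)
        1-z≤R : ∣ 1# - z at n ∣² ℚ.≤ R
        1-z≤R = ℚ.+-mono-≤
          (square-mono (ℚ.≤-trans (ℚ.∣p+q∣≤∣p∣+∣q∣ 1ℚ (ℚ.- x)) (ℚ.+-monoʳ-≤ 1ℚ (subst (ℚ._≤ A) (sym (ℚ.∣-p∣≡∣p∣ x)) ∣x∣≤A))))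
          (square-mono (subst (ℚ._≤ B) (sym (trans (cong ℚ.∣_∣ (ℚ.+-identityˡ (ℚ.- y))) (ℚ.∣-p∣≡∣p∣ y))) ∣y∣≤B))
        -- b is within ε/4 of y, so ∣y∣ < ε/4 would give ∣b∣ < ε/2.
        ε₄≤ : ε₄ ℚ.≤ ℚ.∣ y ∣
        ε₄≤ = ℚ.≮⇒≥ λ ∣y∣<ε₄ → ∣b∣≮ε₂ (ℚ.≤-<-trans (by-triangle b y)
          (subst (ℚ.∣ b ℚ.- y ∣ ℚ.+ ℚ.∣ y ∣ ℚ.<_) (½+½ ε₂)
            (ℚ.+-mono-< (subst (ℚ._< ε₄) (∣p-q∣≡∣q-p∣ y b) (im-near n N≤n)) ∣y∣<ε₄)))
        e = eval (map fromℤ p) z at n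
        tiny : ∣ e ∣² ℚ.< c
        tiny = ℚ.<-≤-trans (ℚ.+-mono-<
          (square-mono-< (subst (ℚ._< proj₁ η) (cong ℚ.∣_∣ (p-0 (ℜ e))) (proj₂ (re≈0 (proj₁ η) (proj₁ (proj₂ η))) n M₁≤n)))
          (square-mono-< (subst (ℚ._< proj₁ η) (cong ℚ.∣_∣ (p-0 (ℑ e))) (proj₂ (im≈0 (proj₁ η) (proj₁ (proj₂ η))) n M₂≤n))))
          (proj₂ (proj₂ η))
          where
          square-mono-< : ∀ {p} → ℚ.∣ p ∣ ℚ.< proj₁ η → p ℚ.* p ℚ.< proj₁ η ℚ.* proj₁ η
          square-mono-< {p} p<η = ℚ.≤-<-trans (square-mono {p} ℚ.≤-refl) (ℚ.≤-<-trans
            (ℚ.*-monoˡ-≤-nonNeg ℚ.∣ p ∣ {{ℚ.∣-∣-nonNeg p}} (ℚ.<⇒≤ p<η))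
            (ℚ.*-monoˡ-<-pos (proj₁ η) {{ℚ.positive (proj₁ (proj₂ η))}} p<η))

  inverse : ∀ u → 0ℚ ℚ.< ∣ u ∣² → ∃ λ w → w * u ≡ 1#
  inverse (a +i b) 0<u = ((a ℚ.* r) +i (ℚ.- (b ℚ.* r))) , cong₂ _+i_
    (trans (solve 3 (λ a b r → a :* r :* a :- (:- (b :* r)) :* b := r :* (a :* a :+ b :* b)) refl a b r)
      (ℚ.*-inverseˡ (a ℚ.* a ℚ.+ b ℚ.* b)))
    (solve 3 (λ a b r → a :* r :* b :+ (:- (b :* r)) :* a := con 0ℚ) refl a b r)
    where
    open ℚ-Solver
    instance
      u≢0 : ℚ.NonZero (a ℚ.* a ℚ.+ b ℚ.* b)
      u≢0 = ℚ.pos⇒nonZero (a ℚ.* a ℚ.+ b ℚ.* b) {{ℚ.positive 0<u}}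
    r : ℚ
    r = ℚ.1/ (a ℚ.* a ℚ.+ b ℚ.* b)

  -- Since ℑ z ≥ δ > 0, the number 1 - z is invertible, and its inverse is the w at which the
  -- identity for h is used.
  zeroFree-criterion : ∀ h m n ℓ (T : ℕ → ℕ) →
    (∀ k → T k ℕ.+ ∏ (1 ℕ.+ 2 ℕ.* k) (3 ℕ.+ 4 ℕ.* k) (suc n) ℓ ≡ ∏ (3 ℕ.+ 2 ℕ.* k) (5 ℕ.+ 4 ℕ.* k) (suc n) ℓ) →
    (∀ z w → w * (1# - z) ≡ 1# → Eval.ev z h ≡ (1# - z) ^ m * chainPoly n T z w) → ZeroFree h
  zeroFree-criterion h m n ℓ T T-eq h≡ δ R 0<δ 0<R = transfer ([1-z]^*chainPoly-boundedBelow n ℓ T T-eq m)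
    where
    open Region δ R 0<δ 0<R
    transfer : BoundedBelow (λ z w _ → ∣ (1# - z) ^ m * chainPoly n T z w ∣²) → _
    transfer (c , 0<c , c≤) = c , 0<c , λ z δ≤ℑz z≤R 1-z≤R →
      let w , w-inv = inverse (1# - z) (ℚ.<-≤-trans 0<δ² (δ≤ℑ⇒δ²≤∣1-∣² {z} δ≤ℑz))
      in subst (λ a → c ℚ.≤ ∣ a ∣²) (sym (h≡ z w w-inv))
           (c≤ z w (record { δ≤ℑz = δ≤ℑz ; ∣z∣²≤R = z≤R ; ∣1-z∣²≤R = 1-z≤R ; w-inv = w-inv }))

  module _ (n ℓ : ℕ) where
    private
      d = suc n
      C = ∂Cuboid d ℓ
      h = hPolynomial (sd C)
      m = dim+1 (sd C)
      T : ℕ → ℕ → ℕ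
      T = Counting.chainTable C
      T-Δ : ∀ j k → T j (suc k) ≡ T j k ℕ.+ T (suc j) k
      T-Δ = Counting.chainTable-Δ C (Counting.∂Cuboid-uniqueAntisymmetric d ℓ)
      T-eq = Counting.chainTable-∂Cuboid d ℓ
      #F = length (PolytopalComplex.faces C)

      w^m*h≡f : ∀ z w → w * (1# - z) ≡ 1# → w ^ m * Eval.ev z h ≡ chainPoly n (T 0) z w
      w^m*h≡f z w w-inv = begin
        w ^ m * ev h
          ≡⟨ ev-hPolynomial (sd C) w w-inv ⟩
        ∑ᴷ (SimplicialComplex.simplices (sd C)) (λ σ → (z * w) ^ length σ)
          ≡⟨ ∑ᴷ-sd C (z * w) ⟩
        1# + z * w * sumTo #F (λ i → ι (length (chains C (suc i))) * (z * w) ^ i)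
          ≡⟨ cong (λ a → 1# + z * w * a) (sumTo-cong #F λ i _ → cong (λ l → ι l * (z * w) ^ i) (Counting.length-chains C i)) ⟩
        1# + z * w * sumTo #F (λ i → ι (T i 0) * (z * w) ^ i)
          ≡⟨ cong (λ a → 1# + z * w * a) (sym (newton-table (z * w) T T-Δ #F)) ⟩
        1# + z * w * newton #F (ι ∘ T 0)
          -- The sum goes up to the number of faces, but the multichain numbers have degree below d,
          -- so their differences of order d and higher vanish.
          ≡⟨ cong (λ N → 1# + z * w * newton N (ι ∘ T 0)) (sym (ℕ.m∸n+n≡m (Counting.d≤∣faces∣ d ℓ))) ⟩
        1# + z * w * newton ((#F ∸ d) ℕ.+ d) (ι ∘ T 0)
          ≡⟨ cong (λ a → 1# + z * w * a) (newton-stable d (#F ∸ d) (ι ∘ T 0) (Decomposition.ιT-degree n ℓ (T 0) T-eq)) ⟩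
        chainPoly n (T 0) z w ∎
        where
        open ≡-Reasoning
        open Eval z
        open Newton (z * w)

      h≡ : ∀ z w → w * (1# - z) ≡ 1# → Eval.ev z h ≡ (1# - z) ^ m * chainPoly n (T 0) z w
      h≡ z w w-inv = begin
        ev h                                ≡⟨ sym (*-identityˡ (ev h)) ⟩
        1# * ev h                           ≡⟨ cong (_* ev h) (sym ([1-z]^*w^ (sd C) w w-inv m)) ⟩
        (1# - z) ^ m * w ^ m * ev h         ≡⟨ *-assoc ((1# - z) ^ m) (w ^ m) (ev h) ⟩
        (1# - z) ^ m * (w ^ m * ev h)       ≡⟨ cong ((1# - z) ^ m *_) (w^m*h≡f z w w-inv) ⟩
        (1# - z) ^ m * chainPoly n (T 0) z w                ∎
        where
        open ≡-Reasoning
        open Eval z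

    zeroFree-h : ZeroFree h
    zeroFree-h = zeroFree-criterion h m n ℓ (T 0) T-eq h≡

open Analysis

corollary4p8 : (d ℓ : ℕ) → 1 ≤ d → ℓ ≤ d →
    RealRooted (map fromℤ (hPolynomial (sd (∂Cuboid d ℓ))))
corollary4p8 (suc n) ℓ _ _ = zeroFree⇒realRooted _ (zeroFree-h n ℓ)
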